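{- For every integer $k\ge2$, $$C_{+}(k-1)=\zeta(k)^2(2\gamma-1)+2\zeta^{*}(k,k,1)+\zeta^{*}(2k,1).$$ Moreover, one has the relation $2\zeta^{*}(1,1,1)+\zeta^{*}(2,1)=-\frac43\zeta(3)$, and consequently $$C_0=-2+4\gamma-3\gamma^2+\frac43\gamma^3+2(1-\gamma)\gamma_1+\gamma_2+2\zeta^{*}(1,1,1)+\zeta^{*}(2,1).$$
   Context: $\zeta$ is the Riemann zeta-function. The Stieltjes constants $\gamma=\gamma_0,\gamma_1,\gamma_2,\dots$ are defined by $\zeta(1+w)=\frac1w+\sum_{j\ge0}\frac{(-1)^j\gamma_j}{j!}w^j$. For $w\in\mathbb C$, $H_N^{(w)}:=\sum_{m=1}^N m^{ -w}$, $H_0^{(w)}:=0$, and $H_N:=H_N^{(1)}$. For $a\in\mathbb C$ with $\Re a>0$, $$C_{+}(a):=|\zeta(1+a)|^2(2\gamma-1)+\sum_{n=1}^{\infty}\frac{|H_{n-1}^{(1+a)}|^2-|\zeta(1+a)|^2}{n}$$ (an absolutely convergent series), and $$C_0:=-2+4\gamma-3\gamma^2+\tfrac43\gamma^3+2(1-\gamma)\gamma_1+\gamma_2-\tfrac43\zeta(3).$$ Harmonic regularization: for a tuple $\boldsymbol k=(k_1,\dots,k_r)$ of positive integers put $$\zeta_N(\boldsymbol k):=\sum_{1\le n_1<\cdots<n_r\le N}\frac1{n_1^{k_1}\cdots n_r^{k_r}}.$$ There is a unique polynomial $\zeta^{*}(\boldsymbol k;Y)\in\mathcal Z[Y]$,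 where $\mathcal Z$ is the algebra generated by the convergent multiple zeta values, such that $\zeta_N(\boldsymbol k)=\zeta^{*}(\boldsymbol k;H_N)+o(1)$ as $N\to\infty$. One writes $\zeta^{*}(\boldsymbol k):=\zeta^{*}(\boldsymbol k;0)$ for its constant term. -}

module Defs where

open import Algebra.Bundles using (RawRing)
open import Algebra.Definitions.RawSemiring using () renaming (_^_ to power)
open import Data.Integer.Base as ℤ using (+_)
import Data.Integer.Properties as ℤₚ
open import Data.List.Base using (List; []; _∷_; _∷ʳ_; foldl; foldr)
open import Data.List.Relation.Unary.All using (All)
open import Data.Nat.Base as ℕ using (ℕ; zero; suc; _!; z≤n; s≤s)
import Data.Nat.Properties as ℕₚ
open import Data.Product.Base using (Σ-syntax; ∃-syntax; _×_; _,_)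
open import Data.Rational.Base as ℚ using (ℚ; 0ℚ; 1ℚ; ½; ∣_∣; _/_)
import Data.Rational.Properties as ℚₚ
open import Data.Sum.Base using (inj₁; inj₂)
open import Data.Rational.Unnormalised.Base as ℚᵘ using (mkℚᵘ)
import Data.Rational.Unnormalised.Properties as ℚᵘₚ
open import Data.Rational.Solver using (module +-*-Solver)
open import Level using (0ℓ)
open import Relation.Binary.PropositionalEquality
  using (_≡_; refl; sym; trans; cong; cong₂; subst)
open import Relation.Unary using (Pred)

sum : {A : Set} → (A → A → A) → A → (ℕ → A) → ℕ → A
sum _⊕_ ε f zero    = ε
sum _⊕_ ε f (suc n) = sum _⊕_ ε f n ⊕ f n

------------------------------------------------------------------------
-- Real numbers: Cauchy sequences of rationals, considered up to the
-- equivalence _≈ʳ_ ("the difference is a null sequence").  The modulus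
-- of convergence is part of the Σ-type, so ℝ is Cauchy complete.

Cauchy : (ℕ → ℚ) → Set
Cauchy x = ∀ ε → 0ℚ ℚ.< ε →
  ∃[ N ] ∀ m n → N ℕ.≤ m → N ℕ.≤ n → ∣ x m ℚ.- x n ∣ ℚ.≤ ε

record ℝ : Set where
  constructor mkℝ
  field
    seq    : ℕ → ℚ
    cauchy : Cauchy seq

open ℝ public

infix 4 _≈ʳ_ _≤ʳ_ _<ʳ_

_≈ʳ_ : ℝ → ℝ → Set
x ≈ʳ y = ∀ ε → 0ℚ ℚ.< ε → ∃[ N ] ∀ n → N ℕ.≤ n → ∣ seq x n ℚ.- seq y n ∣ ℚ.≤ ε

_≤ʳ_ : ℝ → ℝ → Set
x ≤ʳ y = ∀ ε → 0ℚ ℚ.< ε → ∃[ N ] ∀ n → N ℕ.≤ n → seq x n ℚ.≤ seq y n ℚ.+ ε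

abstract
  const-cauchy : ∀ q → Cauchy (λ _ → q)
  const-cauchy q ε 0<ε =
    0 , λ _ _ _ _ → subst (λ r → ∣ r ∣ ℚ.≤ ε) (sym (ℚₚ.+-inverseʳ q)) (ℚₚ.<⇒≤ 0<ε)

ℚ→ℝ : ℚ → ℝ
ℚ→ℝ q = mkℝ (λ _ → q) (const-cauchy q)

private
  open +-*-Solver using (solve; _:=_; _:+_; _:-_; _:*_; :-_)

  split : ∀ a b → a ≡ (a ℚ.- b) ℚ.+ b
  split = solve 2 (λ a b → a := (a :- b) :+ b) refl

  unsplit : ∀ a b → (a ℚ.+ b) ℚ.- b ≡ a
  unsplit = solve 2 (λ a b → (a :+ b) :- b := a) refl

  +-difference : ∀ a b c d → (a ℚ.+ b) ℚ.- (c ℚ.+ d) ≡ (a ℚ.- c) ℚ.+ (b ℚ.- d)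
  +-difference = solve 4 (λ a b c d → (a :+ b) :- (c :+ d) := (a :- c) :+ (b :- d)) refl

  *-difference : ∀ a b c d → a ℚ.* b ℚ.- c ℚ.* d ≡ a ℚ.* (b ℚ.- d) ℚ.+ d ℚ.* (a ℚ.- c)
  *-difference = solve 4 (λ a b c d → a :* b :- c :* d := a :* (b :- d) :+ d :* (a :- c)) refl

  neg-sq : ∀ a → (ℚ.- a) ℚ.* (ℚ.- a) ≡ a ℚ.* a
  neg-sq = solve 1 (λ a → (:- a) :* (:- a) := a :* a) refl

  shift : ∀ c a → a ≡ (c ℚ.+ a) ℚ.- c
  shift = solve 2 (λ c a → a := (c :+ a) :- c) refl

  ½* : ∀ ε → ½ ℚ.* ε ℚ.+ ½ ℚ.* ε ≡ ε
  ½* ε = trans (sym (ℚₚ.*-distribʳ-+ ε ½ ½)) (ℚₚ.*-identityˡ ε)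

  pos-* : ∀ {p q} → 0ℚ ℚ.< p → 0ℚ ℚ.< q → 0ℚ ℚ.< p ℚ.* q
  pos-* {p} {q} 0<p 0<q = subst (ℚ._< p ℚ.* q) (ℚₚ.*-zeroʳ p)
    (ℚₚ.*-monoʳ-<-pos p {{ℚ.positive 0<p}} 0<q)

  ½-pos : ∀ {ε} → 0ℚ ℚ.< ε → 0ℚ ℚ.< ½ ℚ.* ε
  ½-pos = pos-* {½} (ℚₚ.positive⁻¹ ½)

  nonNeg : ∀ p → ℚ.NonNegative ∣ p ∣
  nonNeg p = ℚ.nonNegative (ℚₚ.0≤∣p∣ p)

  *-mono-abs : ∀ p q {b c} → 0ℚ ℚ.≤ c → ∣ p ∣ ℚ.≤ b → ∣ q ∣ ℚ.≤ c → ∣ p ℚ.* q ∣ ℚ.≤ b ℚ.* c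
  *-mono-abs p q {b} {c} 0≤c p≤b q≤c = begin
    ∣ p ℚ.* q ∣      ≡⟨ ℚₚ.∣p*q∣≡∣p∣*∣q∣ p q ⟩
    ∣ p ∣ ℚ.* ∣ q ∣  ≤⟨ ℚₚ.*-monoˡ-≤-nonNeg ∣ p ∣ {{nonNeg p}} q≤c ⟩
    ∣ p ∣ ℚ.* c      ≤⟨ ℚₚ.*-monoʳ-≤-nonNeg c {{ℚ.nonNegative 0≤c}} p≤b ⟩
    b ℚ.* c          ∎
    where open ℚₚ.≤-Reasoning

  bounded : ∀ {x} → Cauchy x → ∃[ b ] ∃[ N ] 0ℚ ℚ.< b × ∀ n → N ℕ.≤ n → ∣ x n ∣ ℚ.≤ b
  bounded {x} cx with cx 1ℚ (ℚₚ.positive⁻¹ 1ℚ)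
  ... | N , close = 1ℚ ℚ.+ ∣ x N ∣ , N , 0<b , bound
    where
    open ℚₚ.≤-Reasoning
    0<b : 0ℚ ℚ.< 1ℚ ℚ.+ ∣ x N ∣
    0<b = ℚₚ.+-mono-<-≤ (ℚₚ.positive⁻¹ 1ℚ) (ℚₚ.0≤∣p∣ (x N))
    bound : ∀ n → N ℕ.≤ n → ∣ x n ∣ ℚ.≤ 1ℚ ℚ.+ ∣ x N ∣
    bound n N≤n = begin
      ∣ x n ∣                          ≡⟨ cong ∣_∣ (split (x n) (x N)) ⟩
      ∣ (x n ℚ.- x N) ℚ.+ x N ∣        ≤⟨ ℚₚ.∣p+q∣≤∣p∣+∣q∣ (x n ℚ.- x N) (x N) ⟩
      ∣ x n ℚ.- x N ∣ ℚ.+ ∣ x N ∣      ≤⟨ ℚₚ.+-monoˡ-≤ ∣ x N ∣ (close n N N≤n ℕₚ.≤-refl) ⟩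
      1ℚ ℚ.+ ∣ x N ∣                   ∎

  abstract
    +-cauchy : ∀ {x y} → Cauchy x → Cauchy y → Cauchy (λ n → x n ℚ.+ y n)
    +-cauchy {x} {y} cx cy ε 0<ε with cx (½ ℚ.* ε) (½-pos 0<ε) | cy (½ ℚ.* ε) (½-pos 0<ε)
    ... | M , f | N , g = M ℕ.⊔ N , λ m n M⊔N≤m M⊔N≤n → begin
      ∣ (x m ℚ.+ y m) ℚ.- (x n ℚ.+ y n) ∣
        ≡⟨ cong ∣_∣ (+-difference (x m) (y m) (x n) (y n)) ⟩
      ∣ (x m ℚ.- x n) ℚ.+ (y m ℚ.- y n) ∣
        ≤⟨ ℚₚ.∣p+q∣≤∣p∣+∣q∣ (x m ℚ.- x n) (y m ℚ.- y n) ⟩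
      ∣ x m ℚ.- x n ∣ ℚ.+ ∣ y m ℚ.- y n ∣
        ≤⟨ ℚₚ.+-mono-≤ (f m n (ℕₚ.m⊔n≤o⇒m≤o M N M⊔N≤m) (ℕₚ.m⊔n≤o⇒m≤o M N M⊔N≤n))
                       (g m n (ℕₚ.m⊔n≤o⇒n≤o M N M⊔N≤m) (ℕₚ.m⊔n≤o⇒n≤o M N M⊔N≤n)) ⟩
      ½ ℚ.* ε ℚ.+ ½ ℚ.* ε
        ≡⟨ ½* ε ⟩
      ε ∎
      where
      open ℚₚ.≤-Reasoning

  abstract
    neg-cauchy : ∀ {x} → Cauchy x → Cauchy (λ n → ℚ.- x n)
    neg-cauchy {x} cx ε 0<ε with cx ε 0<ε
    ... | N , f = N , λ m n N≤m N≤n → begin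
      ∣ (ℚ.- x m) ℚ.- (ℚ.- x n) ∣  ≡⟨ cong ∣_∣ (ℚₚ.neg-distrib-+ (x m) (ℚ.- x n)) ⟨
      ∣ ℚ.- (x m ℚ.- x n) ∣        ≡⟨ ℚₚ.∣-p∣≡∣p∣ (x m ℚ.- x n) ⟩
      ∣ x m ℚ.- x n ∣              ≤⟨ f m n N≤m N≤n ⟩
      ε                            ∎
      where open ℚₚ.≤-Reasoning

  scaled : ∀ {b} → 0ℚ ℚ.< b → ∀ {ε} → 0ℚ ℚ.< ε → ∃[ δ ] 0ℚ ℚ.< δ × b ℚ.* δ ≡ ε
  scaled {b} 0<b {ε} 0<ε =
    ℚ.1/ b ℚ.* ε ,
    pos-* (ℚₚ.positive⁻¹ (ℚ.1/ b) {{ℚₚ.1/pos⇒pos b}}) 0<ε ,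
    trans (sym (ℚₚ.*-assoc b (ℚ.1/ b) ε))
      (trans (cong (ℚ._* ε) (ℚₚ.*-inverseʳ b)) (ℚₚ.*-identityˡ ε))
    where
    instance
      b-pos : ℚ.Positive b
      b-pos = ℚ.positive 0<b
      b≢0 : ℚ.NonZero b
      b≢0 = ℚₚ.pos⇒nonZero b

  abstract
    *-cauchy : ∀ {x y} → Cauchy x → Cauchy y → Cauchy (λ n → x n ℚ.* y n)
    *-cauchy {x} {y} cx cy ε 0<ε =
      let b , M , 0<b , x≤b = bounded cx
          c , N , 0<c , y≤c = bounded cy
          δ , 0<δ , bδ = scaled 0<b (½-pos 0<ε)
          η , 0<η , cη = scaled 0<c (½-pos 0<ε)
          P , f = cy δ 0<δ
          Q , g = cx η 0<η
      in (M ℕ.⊔ N) ℕ.⊔ (P ℕ.⊔ Q) , λ m n l≤m l≤n →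
      let MN≤m = ℕₚ.m⊔n≤o⇒m≤o (M ℕ.⊔ N) (P ℕ.⊔ Q) l≤m
          MN≤n = ℕₚ.m⊔n≤o⇒m≤o (M ℕ.⊔ N) (P ℕ.⊔ Q) l≤n
          PQ≤m = ℕₚ.m⊔n≤o⇒n≤o (M ℕ.⊔ N) (P ℕ.⊔ Q) l≤m
          PQ≤n = ℕₚ.m⊔n≤o⇒n≤o (M ℕ.⊔ N) (P ℕ.⊔ Q) l≤n
      in begin
      ∣ x m ℚ.* y m ℚ.- x n ℚ.* y n ∣
        ≡⟨ cong ∣_∣ (*-difference (x m) (y m) (x n) (y n)) ⟩
      ∣ x m ℚ.* (y m ℚ.- y n) ℚ.+ y n ℚ.* (x m ℚ.- x n) ∣
        ≤⟨ ℚₚ.∣p+q∣≤∣p∣+∣q∣ (x m ℚ.* (y m ℚ.- y n)) (y n ℚ.* (x m ℚ.- x n)) ⟩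
      ∣ x m ℚ.* (y m ℚ.- y n) ∣ ℚ.+ ∣ y n ℚ.* (x m ℚ.- x n) ∣
        ≤⟨ ℚₚ.+-mono-≤
             (*-mono-abs (x m) (y m ℚ.- y n) (ℚₚ.<⇒≤ 0<δ) (x≤b m (ℕₚ.m⊔n≤o⇒m≤o M N MN≤m))
               (f m n (ℕₚ.m⊔n≤o⇒m≤o P Q PQ≤m) (ℕₚ.m⊔n≤o⇒m≤o P Q PQ≤n)))
             (*-mono-abs (y n) (x m ℚ.- x n) (ℚₚ.<⇒≤ 0<η) (y≤c n (ℕₚ.m⊔n≤o⇒n≤o M N MN≤n))
               (g m n (ℕₚ.m⊔n≤o⇒n≤o P Q PQ≤m) (ℕₚ.m⊔n≤o⇒n≤o P Q PQ≤n))) ⟩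
      b ℚ.* δ ℚ.+ c ℚ.* η
        ≡⟨ cong₂ ℚ._+_ bδ cη ⟩
      ½ ℚ.* ε ℚ.+ ½ ℚ.* ε
        ≡⟨ ½* ε ⟩
      ε ∎
      where open ℚₚ.≤-Reasoning

infixl 6 _+ʳ_ _-ʳ_
infixl 7 _*ʳ_
infix  8 -ʳ_

_+ʳ_ : ℝ → ℝ → ℝ
x +ʳ y = mkℝ (λ n → seq x n ℚ.+ seq y n) (+-cauchy {seq x} {seq y} (cauchy x) (cauchy y))

_*ʳ_ : ℝ → ℝ → ℝ
x *ʳ y = mkℝ (λ n → seq x n ℚ.* seq y n) (*-cauchy {seq x} {seq y} (cauchy x) (cauchy y))

-ʳ_ : ℝ → ℝ
-ʳ x = mkℝ (λ n → ℚ.- seq x n) (neg-cauchy {seq x} (cauchy x))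

_-ʳ_ : ℝ → ℝ → ℝ
x -ʳ y = x +ʳ (-ʳ y)

0ʳ 1ʳ : ℝ
0ʳ = ℚ→ℝ 0ℚ
1ʳ = ℚ→ℝ 1ℚ

_<ʳ_ : ℝ → ℝ → Set
x <ʳ y = ∃[ ε ] 0ℚ ℚ.< ε × x +ʳ ℚ→ℝ ε ≤ʳ y

infix 4 _⟶ʳ_ _⟶_ _≈_ _#_

-- ∣ a n - x ∣ ≤ ε is written as the pair of inequalities a n ≤ x + ε, x ≤ a n + ε.
_⟶ʳ_ : (ℕ → ℝ) → ℝ → Set
a ⟶ʳ x = ∀ ε → 0ℚ ℚ.< ε → ∃[ N ] ∀ n → N ℕ.≤ n →
  (a n ≤ʳ x +ʳ ℚ→ℝ ε) × (x ≤ʳ a n +ʳ ℚ→ℝ ε)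

------------------------------------------------------------------------
-- Complex numbers

record ℂ : Set where
  constructor _+i_
  field
    re im : ℝ

open ℂ public

_≈_ : ℂ → ℂ → Set
z ≈ w = (re z ≈ʳ re w) × (im z ≈ʳ im w)

_⟶_ : (ℕ → ℂ) → ℂ → Set
a ⟶ z = ((λ n → re (a n)) ⟶ʳ re z) × ((λ n → im (a n)) ⟶ʳ im z)

ℝ→ℂ : ℝ → ℂ
ℝ→ℂ x = x +i 0ʳ

ℚ→ℂ : ℚ → ℂ
ℚ→ℂ q = ℝ→ℂ (ℚ→ℝ q)

ℕ→ℂ : ℕ → ℂ
ℕ→ℂ n = ℚ→ℂ (+ n / 1)

infixl 6 _+_ _-_
infixl 7 _*_
infix  8 -_
infixr 8 _^_

_+_ _*_ _-_ : ℂ → ℂ → ℂ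
z + w = (re z +ʳ re w) +i (im z +ʳ im w)
z * w = (re z *ʳ re w -ʳ im z *ʳ im w) +i (re z *ʳ im w +ʳ im z *ʳ re w)
z - w = (re z -ʳ re w) +i (im z -ʳ im w)

-_ : ℂ → ℂ
- z = (-ʳ re z) +i (-ʳ im z)

0ᶜ 1ᶜ : ℂ
0ᶜ = ℕ→ℂ 0
1ᶜ = ℕ→ℂ 1

ℂ-rawRing : RawRing 0ℓ 0ℓ
ℂ-rawRing = record
  { Carrier = ℂ ; _≈_ = _≈_ ; _+_ = _+_ ; _*_ = _*_ ; -_ = -_ ; 0# = 0ᶜ ; 1# = 1ᶜ }

_^_ : ℂ → ℕ → ℂ
_^_ = power (RawRing.rawSemiring ℂ-rawRing)

∣_∣² : ℂ → ℝ
∣ z ∣² = re z *ʳ re z +ʳ im z *ʳ im z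

-- Apartness, the constructive form of inequality.
_#_ : ℂ → ℂ → Set
z # w = 0ʳ <ʳ ∣ z - w ∣²

HasSum : (ℕ → ℂ) → ℂ → Set
HasSum f s = sum _+_ 0ᶜ f ⟶ s

-- Opaque, as unfolding the normalisation of fractions makes type checking
-- of the records below very slow.
opaque
  1/suc : ℕ → ℚ
  1/suc n = + 1 / suc n

  1/_! : ℕ → ℚ
  1/ j ! = _/_ (+ 1) (j !) {{j ℕₚ.!≢0}}

-- IsExp z e: exp z = e.
IsExp : ℂ → ℂ → Set
IsExp z = HasSum (λ j → ℚ→ℂ (1/ j !) * z ^ j)

-- IsPow n s p: n ^ s = p, that is exp (s log n) = p, where ℓ = log n is the
-- real solution of exp ℓ = n.
IsPow : ℕ → ℂ → ℂ → Set
IsPow n s p = Σ[ ℓ ∈ ℝ ] IsExp (ℝ→ℂ ℓ) (ℕ→ℂ n) × IsExp (s * ℝ→ℂ ℓ) p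

-- IsPowers s p: p is the sequence 1 ^ s , 2 ^ s , 3 ^ s , …, indexed from 0.
IsPowers : ℂ → (ℕ → ℂ) → Set
IsPowers s p = ∀ m → IsPow (suc m) s (p m)

private
  a+b≤c⇒b≤c : ∀ {ε b} → 0ℚ ℚ.+ ε ℚ.≤ b ℚ.+ ½ ℚ.* ε → ½ ℚ.* ε ℚ.≤ b
  a+b≤c⇒b≤c {ε} {b} h = begin
    ½ ℚ.* ε                          ≡⟨ sym (unsplit (½ ℚ.* ε) (½ ℚ.* ε)) ⟩
    (½ ℚ.* ε ℚ.+ ½ ℚ.* ε) ℚ.- ½ ℚ.* ε ≡⟨ cong (ℚ._- ½ ℚ.* ε) (½* ε) ⟩
    ε ℚ.- ½ ℚ.* ε                    ≡⟨ cong (ℚ._- ½ ℚ.* ε) (ℚₚ.+-identityˡ ε) ⟨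
    (0ℚ ℚ.+ ε) ℚ.- ½ ℚ.* ε           ≤⟨ ℚₚ.+-monoˡ-≤ (ℚ.- (½ ℚ.* ε)) h ⟩
    (b ℚ.+ ½ ℚ.* ε) ℚ.- ½ ℚ.* ε      ≡⟨ unsplit b (½ ℚ.* ε) ⟩
    b                                ∎
    where
    open ℚₚ.≤-Reasoning

  0≤sq : ∀ q → 0ℚ ℚ.≤ q ℚ.* q
  0≤sq q = subst (0ℚ ℚ.≤_) (trans (ℚₚ.∣p*q∣≡∣p∣*∣q∣ q q) (abs-sq q)) (ℚₚ.0≤∣p∣ (q ℚ.* q))
    where
    abs-sq : ∀ q → ∣ q ∣ ℚ.* ∣ q ∣ ≡ q ℚ.* q
    abs-sq q with ℚₚ.∣p∣≡p∨∣p∣≡-p q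
    ... | inj₁ e = cong₂ ℚ._*_ e e
    ... | inj₂ e = trans (cong₂ ℚ._*_ e e) (neg-sq q)

abstract
  re>0⇒∣z∣²>0 : ∀ z → 0ʳ <ʳ re z → 0ʳ <ʳ ∣ z ∣²
  re>0⇒∣z∣²>0 z (ε , 0<ε , ε≤z) =
    let N , f = ε≤z δ 0<δ
    in δ ℚ.* δ , pos-* 0<δ 0<δ , λ η 0<η → N , λ n N≤n →
    let x = seq (re z) n
        y = seq (im z) n
        δ≤x = a+b≤c⇒b≤c {ε} {x} (f n N≤n)
        0≤x = ℚₚ.≤-trans (ℚₚ.<⇒≤ 0<δ) δ≤x
    in begin
    0ℚ ℚ.+ δ ℚ.* δ             ≡⟨ ℚₚ.+-identityˡ (δ ℚ.* δ) ⟩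
    δ ℚ.* δ                    ≤⟨ ℚₚ.*-monoˡ-≤-nonNeg δ {{ℚ.nonNegative (ℚₚ.<⇒≤ 0<δ)}} δ≤x ⟩
    δ ℚ.* x                    ≤⟨ ℚₚ.*-monoʳ-≤-nonNeg x {{ℚ.nonNegative 0≤x}} δ≤x ⟩
    x ℚ.* x                    ≡⟨ ℚₚ.+-identityʳ (x ℚ.* x) ⟨
    x ℚ.* x ℚ.+ 0ℚ             ≤⟨ ℚₚ.+-monoʳ-≤ (x ℚ.* x) (0≤sq y) ⟩
    x ℚ.* x ℚ.+ y ℚ.* y        ≡⟨ ℚₚ.+-identityʳ (x ℚ.* x ℚ.+ y ℚ.* y) ⟨
    x ℚ.* x ℚ.+ y ℚ.* y ℚ.+ 0ℚ ≤⟨ ℚₚ.+-monoʳ-≤ (x ℚ.* x ℚ.+ y ℚ.* y) (ℚₚ.<⇒≤ 0<η) ⟩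
    x ℚ.* x ℚ.+ y ℚ.* y ℚ.+ η  ∎
    where
    open ℚₚ.≤-Reasoning
    δ : ℚ
    δ = ½ ℚ.* ε
    0<δ : 0ℚ ℚ.< δ
    0<δ = ½-pos 0<ε

abstract
  1+a#1 : ∀ a → 0ʳ <ʳ re a → 1ᶜ + a # 1ᶜ
  1+a#1 a (ε , 0<ε , ε≤a) = re>0⇒∣z∣²>0 ((1ᶜ + a) - 1ᶜ) (ε , 0<ε , λ η 0<η →
    let N , f = ε≤a η 0<η
    in N , λ n N≤n → subst (λ x → 0ℚ ℚ.+ ε ℚ.≤ x ℚ.+ η) (shift 1ℚ (seq (re a) n)) (f n N≤n))

abstract
  k-1>0 : ∀ k → 2 ℕ.≤ k → 0ʳ <ʳ re (ℕ→ℂ k - 1ᶜ)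
  k-1>0 k 2≤k = 1ℚ , ℚₚ.positive⁻¹ 1ℚ , λ η 0<η → 0 , λ _ _ → begin
    2/1 ℚ.- 1ℚ                  ≤⟨ ℚₚ.+-monoˡ-≤ (ℚ.- 1ℚ) 2≤k/1 ⟩
    (+ k / 1) ℚ.- 1ℚ            ≡⟨ ℚₚ.+-identityʳ ((+ k / 1) ℚ.- 1ℚ) ⟨
    (+ k / 1) ℚ.- 1ℚ ℚ.+ 0ℚ     ≤⟨ ℚₚ.+-monoʳ-≤ ((+ k / 1) ℚ.- 1ℚ) (ℚₚ.<⇒≤ 0<η) ⟩
    (+ k / 1) ℚ.- 1ℚ ℚ.+ η      ∎
    where
    open ℚₚ.≤-Reasoning
    2/1 : ℚ
    2/1 = + 2 / 1
    2≤k/1 : 2/1 ℚ.≤ + k / 1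
    2≤k/1 = ℚₚ.toℚᵘ-cancel-≤ (ℚᵘₚ.≤-respʳ-≃ (ℚᵘₚ.≃-sym (ℚₚ.toℚᵘ-fromℚᵘ (mkℚᵘ (+ k) 0)))
      (ℚᵘ.*≤* (ℤₚ.*-monoʳ-≤-nonNeg (+ 1) (ℤ.+≤+ 2≤k))))

abstract
  k#1 : ∀ k → 2 ℕ.≤ k → ℕ→ℂ k # 1ᶜ
  k#1 k 2≤k = re>0⇒∣z∣²>0 (ℕ→ℂ k - 1ᶜ) (k-1>0 k 2≤k)

------------------------------------------------------------------------
-- The Riemann zeta function and the Stieltjes constants

-- A function on ℂ ∖ {1} that is complex differentiable everywhere and is
-- given by ∑ n⁻ˢ for Re s > 1.
record RiemannZeta : Set where
  field
    ζ           : ∀ s → s # 1ᶜ → ℂ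
    ζ-cong      : ∀ {s t} (s#1 : s # 1ᶜ) (t#1 : t # 1ᶜ) → s ≈ t → ζ s s#1 ≈ ζ t t#1
    -- ∣ζ t - ζ s - d (t - s)∣ ≤ √ε ∣t - s∣ whenever ∣t - s∣ ≤ √δ.
    holomorphic : ∀ s (s#1 : s # 1ᶜ) → ∃[ d ] ∀ ε → 0ℚ ℚ.< ε → ∃[ δ ] 0ℚ ℚ.< δ ×
                  (∀ t (t#1 : t # 1ᶜ) → ∣ t - s ∣² ≤ʳ ℚ→ℝ δ →
                   ∣ ζ t t#1 - ζ s s#1 - d * (t - s) ∣² ≤ʳ ℚ→ℝ ε *ʳ ∣ t - s ∣²)
    dirichlet   : ∀ s (s#1 : s # 1ᶜ) → 1ʳ <ʳ re s →
                  Σ[ p ∈ (ℕ → ℂ) ] IsPowers (- s) p × HasSum p (ζ s s#1)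

-- The Laurent expansion of ζ at 1; u is 1/w.
record StieltjesConstants (Z : RiemannZeta) : Set where
  open RiemannZeta Z
  field
    γ       : ℕ → ℂ
    laurent : ∀ w (1+w#1 : 1ᶜ + w # 1ᶜ) u → w * u ≈ 1ᶜ →
              HasSum (λ j → (- 1ᶜ) ^ j * γ j * ℚ→ℂ (1/ j !) * w ^ j) (ζ (1ᶜ + w) 1+w#1 - u)

-- C₊ Z S a _ c: the series defining C₊(a) converges, and C₊(a) = c.  Here
-- H n is H_n^(1+a), and the n-th summand is the one usually indexed by n + 1.
C₊ : (Z : RiemannZeta) → StieltjesConstants Z → (a : ℂ) → 0ʳ <ʳ re a → ℂ → Set
C₊ Z S a a>0 c = Σ[ p ∈ (ℕ → ℂ) ] Σ[ t ∈ ℂ ]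
  let H : ℕ → ℂ
      H = sum _+_ 0ᶜ p
      ∣ζ∣² : ℝ
      ∣ζ∣² = ∣ ζ (1ᶜ + a) (1+a#1 a a>0) ∣²
  in IsPowers (- (1ᶜ + a)) p
   × HasSum (λ n → ℝ→ℂ (∣ H n ∣² -ʳ ∣ζ∣²) * ℚ→ℂ (1/suc n)) t
   × c ≈ ℝ→ℂ ∣ζ∣² * (ℕ→ℂ 2 * γ 0 - 1ᶜ) + t
  where
  open RiemannZeta Z
  open StieltjesConstants S

ζ-at : RiemannZeta → ∀ k → 2 ℕ.≤ k → ℂ
ζ-at Z k 2≤k = RiemannZeta.ζ Z (ℕ→ℂ k) (k#1 k 2≤k)

ζ3 : RiemannZeta → ℂ
ζ3 Z = ζ-at Z 3 (s≤s (s≤s z≤n))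

C₀ : (Z : RiemannZeta) → StieltjesConstants Z → ℂ
C₀ Z S = - ℕ→ℂ 2 + ℕ→ℂ 4 * γ 0 - ℕ→ℂ 3 * γ 0 ^ 2 + ℚ→ℂ (+ 4 / 3) * γ 0 ^ 3
       + ℕ→ℂ 2 * (1ᶜ - γ 0) * γ 1 + γ 2 - ℚ→ℂ (+ 4 / 3) * ζ3 Z
  where open StieltjesConstants S

------------------------------------------------------------------------
-- Harmonic regularization of multiple harmonic sums

-- 1 / (m + 1) ^ k
recip^ : ℕ → ℕ → ℚ
recip^ m k = power ℚ.+-*-rawSemiring (1/suc m) k

-- ζ_N(k₁,…,k_r), computed from the inside out through
-- ζ_N(k₁,…,k_r) = ∑_{n=1}^N ζ_{n-1}(k₁,…,k_{r-1}) / n^{k_r}; m stands for n - 1.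
ζ[_] : List ℕ → ℕ → ℚ
ζ[ ks ] = foldl (λ F k → sum ℚ._+_ 0ℚ (λ m → F m ℚ.* recip^ m k)) (λ _ → 1ℚ) ks

harmonic : ℕ → ℚ
harmonic = sum ℚ._+_ 0ℚ 1/suc

-- The ℚ-algebra generated by the convergent multiple zeta values, i.e. those
-- whose exponents are all positive with the last one at least 2.
data 𝒵 : Pred ℝ 0ℓ where
  mzv      : ∀ {ks k x} → All (1 ℕ.≤_) ks → 2 ℕ.≤ k →
             (λ N → ℚ→ℝ (ζ[ ks ∷ʳ k ] N)) ⟶ʳ x → 𝒵 x
  rational : ∀ q → 𝒵 (ℚ→ℝ q)
  add      : ∀ {x y} → 𝒵 x → 𝒵 y → 𝒵 (x +ʳ y)
  mul      : ∀ {x y} → 𝒵 x → 𝒵 y → 𝒵 (x *ʳ y)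
  resp     : ∀ {x y} → x ≈ʳ y → 𝒵 x → 𝒵 y

-- Coefficient lists, constant term first.
Poly : Set
Poly = List ℝ

eval : Poly → ℝ → ℝ
eval P Y = foldr (λ c v → c +ʳ Y *ʳ v) 0ʳ P

coeff : Poly → ℕ → ℝ
coeff []      _       = 0ʳ
coeff (c ∷ P) zero    = c
coeff (c ∷ P) (suc i) = coeff P i

_≈ₚ_ : Poly → Poly → Set
P ≈ₚ Q = ∀ i → coeff P i ≈ʳ coeff Q i

-- P ∈ 𝒵[Y] and ζ_N(ks) = P(H_N) + o(1).
record Regularizes (ks : List ℕ) (P : Poly) : Set where
  field
    coefficients : All 𝒵 P
    asymptotic   : (λ N → ℚ→ℝ (ζ[ ks ] N) -ʳ eval P (ℚ→ℝ (harmonic N))) ⟶ʳ 0ʳ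

-- ζ*⟨ ks ⟩≡ x: the polynomial ζ*(ks;Y) exists and is unique, and its
-- constant term is x.
record ζ*⟨_⟩≡_ (ks : List ℕ) (x : ℝ) : Set where
  field
    ζ*Y          : Poly
    regularizes  : Regularizes ks ζ*Y
    unique       : ∀ Q → Regularizes ks Q → Q ≈ₚ ζ*Y
    constantTerm : coeff ζ*Y 0 ≈ʳ x

-- With the harmonic (stuffle) product, ζ_N(k,k) H_N and ζ_N(2k) H_N expand into ζ_N(k,k,1) and
-- ζ_N(2k,1) plus truncations of convergent multiple zeta values.  Replacing ζ_N(k,k) by its limit
-- in these products costs o(1), as its tails are o(1/log N); this gives the regularized values as minus a sum of
-- convergent ones.  Since ζ_n(k)² = 2ζ_n(k,k) + ζ_n(2k), the partial sums of C₊(k-1) are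
-- 2ζ_N(k,k,1) + ζ_N(2k,1) - ζ(k)² H_N, whose divergent parts cancel.  Likewise Newton's identity
-- gives ζ*(1,1,1) = ζ(3)/3, and ζ*(2,1) = -ζ(1,2) - ζ(3) = -2ζ(3) by Euler's relation, proved from
-- an identity for the truncated sums.  The coefficients of ζ*(k;Y) are unique because H_N → ∞.  The
-- powers n^(-k), defined through exp and log, are identified using the functional equation of exp.

module Submission where

open import Algebra.Definitions.RawSemiring using () renaming (_^_ to power)
open import Data.Integer.Base as ℤ using (+_)
import Data.Integer.Properties as ℤₚ
open import Data.List.Base using (List; []; _∷_; map; foldr)
open import Data.List.Relation.Unary.All using (All; []; _∷_)
open import Data.Nat.Base as ℕ using (ℕ; zero; suc; _!; z≤n; s≤s)
import Data.Nat.Properties as ℕₚ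
open import Data.Product.Base using (∃-syntax; _×_; _,_; proj₁; proj₂)
open import Data.Rational.Base as ℚ using (ℚ; 0ℚ; 1ℚ; ½; ∣_∣; _/_; mkℚ)
import Data.Rational.Properties as ℚₚ
open import Data.Rational.Unnormalised.Base as ℚᵘ using (mkℚᵘ; *≡*)
import Data.Rational.Unnormalised.Properties as ℚᵘₚ
open import Data.Sum.Base using (inj₁; inj₂)
open import Function.Base using (_∘_)
open import Relation.Binary.PropositionalEquality
  using (_≡_; refl; sym; trans; cong; cong₂; subst; subst₂; module ≡-Reasoning)
open import Relation.Nullary.Decidable using (dec⇒maybe)
open import Tactic.RingSolver using (solve-∀)
open import Tactic.RingSolver.Core.AlmostCommutativeRing
  using (AlmostCommutativeRing; fromCommutativeRing)

-- Inside this module the unmarked operators are those of ℚ, the operators of ℂ carry a ᶜ.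
module Regularization where

  open import Data.Rational.Base using (_+_; _*_; _-_; -_; _≤_; _<_)
  open import Defs hiding (_≈_; _+_; _*_; _-_; -_; _^_)
  open import Defs using ()
    renaming (_≈_ to _≈ᶜ_; _+_ to _+ᶜ_; _*_ to _*ᶜ_; _-_ to _-ᶜ_; -_ to -ᶜ_; _^_ to _^ᶜ_)

  -- A real is a sequence of rationals, and each convergent multiple zeta value used here is
  -- represented by the sequence of its own truncations ζ_N. An identity between truncated sums
  -- therefore holds for the reals index by index. A limit of reals involves two indices, the N of
  -- the sum and the i of the approximation; replacing a coefficient by its limit means comparing
  -- ζ_N with ζ_i for i ≥ N. All tails are measured by one explicit majorant, `tailBound`, of the
  -- size of H_N² / N. It yields convergence of the nested sums, the rate needed next to a factor
  -- H_N, and the vanishing of the error in Euler's relation. The growth estimates use H_N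
  -- throughout and never a logarithm. Logarithms occur only inside n^(-k), where the real ℓ with
  -- exp ℓ = n is supplied by the Dirichlet series of the given zeta function. The value exp(-kℓ) is
  -- then recognized by its product with exp(kℓ). The functional equation behind this needs an
  -- estimate uniform on bounded sets, since the argument is itself a sequence of approximations.

  ℚ-ring : AlmostCommutativeRing _ _
  ℚ-ring = fromCommutativeRing ℚₚ.+-*-commutativeRing λ x → dec⇒maybe (0ℚ ℚₚ.≟ x)

  -- Rational arithmetic

  -- Reduces an inequality to a ring identity and the sign of an explicit difference; many estimates
  -- below have this form.
  ≤-by : ∀ {p q} d → q ≡ p + d → 0ℚ ≤ d → p ≤ q
  ≤-by {p} {q} d q≡ 0≤d = begin
    p      ≡⟨ ℚₚ.+-identityʳ p ⟨
    p + 0ℚ ≤⟨ ℚₚ.+-monoʳ-≤ p 0≤d ⟩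
    p + d  ≡⟨ q≡ ⟨
    q      ∎
    where open ℚₚ.≤-Reasoning

  p≤q⇒0≤q-p : ∀ {p q} → p ≤ q → 0ℚ ≤ q - p
  p≤q⇒0≤q-p {p} {q} p≤q = subst (_≤ q - p) (ℚₚ.+-inverseʳ p) (ℚₚ.+-monoˡ-≤ (- p) p≤q)

  0≤-+ : ∀ {p q} → 0ℚ ≤ p → 0ℚ ≤ q → 0ℚ ≤ p + q
  0≤-+ = ℚₚ.+-mono-≤

  *-monoˡ-≤ : ∀ {a p q} → 0ℚ ≤ a → p ≤ q → a * p ≤ a * q
  *-monoˡ-≤ {a} 0≤a = ℚₚ.*-monoˡ-≤-nonNeg a {{ℚ.nonNegative 0≤a}}

  0≤-* : ∀ {p q} → 0ℚ ≤ p → 0ℚ ≤ q → 0ℚ ≤ p * q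
  0≤-* {p} {q} 0≤p 0≤q = subst (_≤ p * q) (ℚₚ.*-zeroʳ p) (*-monoˡ-≤ 0≤p 0≤q)

  0<-* : ∀ {p q} → 0ℚ < p → 0ℚ < q → 0ℚ < p * q
  0<-* {p} {q} 0<p 0<q = subst (_< p * q) (ℚₚ.*-zeroʳ p)
    (ℚₚ.*-monoʳ-<-pos p {{ℚ.positive 0<p}} 0<q)

  *-mono-≤ : ∀ {a b c d} → 0ℚ ≤ a → a ≤ b → 0ℚ ≤ c → c ≤ d → a * c ≤ b * d
  *-mono-≤ {a} {b} {c} {d} 0≤a a≤b 0≤c c≤d = ≤-by (b * (d - c) + c * (b - a)) (eq a b c d)
    (0≤-+ (0≤-* (ℚₚ.≤-trans 0≤a a≤b) (p≤q⇒0≤q-p c≤d)) (0≤-* 0≤c (p≤q⇒0≤q-p a≤b)))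
    where
    eq : ∀ a b c d → b * d ≡ a * c + (b * (d - c) + c * (b - a))
    eq = solve-∀ ℚ-ring

  *-cancelˡ-≤ : ∀ {a p q} → 0ℚ < a → a * p ≤ a * q → p ≤ q
  *-cancelˡ-≤ {a} 0<a = ℚₚ.*-cancelˡ-≤-pos a {{ℚ.positive 0<a}}

  0≤1 : 0ℚ ≤ 1ℚ
  0≤1 = ℚₚ.nonNegative⁻¹ 1ℚ

  0<½ : 0ℚ < ½
  0<½ = ℚₚ.positive⁻¹ ½

  ½-pos : ∀ {ε} → 0ℚ < ε → 0ℚ < ½ * ε
  ½-pos = 0<-* 0<½

  ½+½ : ∀ ε → ½ * ε + ½ * ε ≡ ε
  ½+½ = solve-∀ ℚ-ring

  square≥0 : ∀ p → 0ℚ ≤ p * p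
  square≥0 p = subst (0ℚ ≤_) (trans (ℚₚ.∣p*q∣≡∣p∣*∣q∣ p p) ∣p∣²≡p²) (ℚₚ.0≤∣p∣ (p * p))
    where
    neg-sq : ∀ a → (- a) * (- a) ≡ a * a
    neg-sq = solve-∀ ℚ-ring
    ∣p∣²≡p² : ∣ p ∣ * ∣ p ∣ ≡ p * p
    ∣p∣²≡p² with ℚₚ.∣p∣≡p∨∣p∣≡-p p
    ... | inj₁ e = cong₂ _*_ e e
    ... | inj₂ e = trans (cong₂ _*_ e e) (neg-sq p)

  p≤∣p∣ : ∀ p → p ≤ ∣ p ∣
  p≤∣p∣ p with ℚₚ.≤-total 0ℚ p
  ... | inj₁ 0≤p = ℚₚ.≤-reflexive (sym (ℚₚ.0≤p⇒∣p∣≡p 0≤p))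
  ... | inj₂ p≤0 = ℚₚ.≤-trans p≤0 (ℚₚ.0≤∣p∣ p)

  ∣∣≤-intro : ∀ {p e} → p ≤ e → - p ≤ e → ∣ p ∣ ≤ e
  ∣∣≤-intro {p} p≤e -p≤e with ℚₚ.∣p∣≡p∨∣p∣≡-p p
  ... | inj₁ e = subst (_≤ _) (sym e) p≤e
  ... | inj₂ e = subst (_≤ _) (sym e) -p≤e

  ∣p-q∣≡∣q-p∣ : ∀ p q → ∣ p - q ∣ ≡ ∣ q - p ∣
  ∣p-q∣≡∣q-p∣ p q = trans (sym (ℚₚ.∣-p∣≡∣p∣ (p - q))) (cong ∣_∣ (eq p q))
    where
    eq : ∀ p q → - (p - q) ≡ q - p
    eq = solve-∀ ℚ-ring

  ∣∣≤-+ : ∀ {p q a b} → ∣ p ∣ ≤ a → ∣ q ∣ ≤ b → ∣ p + q ∣ ≤ a + b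
  ∣∣≤-+ {p} {q} p≤a q≤b = ℚₚ.≤-trans (ℚₚ.∣p+q∣≤∣p∣+∣q∣ p q) (ℚₚ.+-mono-≤ p≤a q≤b)

  ∣∣≤-* : ∀ {p q a b} → ∣ p ∣ ≤ a → ∣ q ∣ ≤ b → ∣ p * q ∣ ≤ a * b
  ∣∣≤-* {p} {q} p≤a q≤b = subst (_≤ _) (sym (ℚₚ.∣p*q∣≡∣p∣*∣q∣ p q))
    (*-mono-≤ (ℚₚ.0≤∣p∣ p) p≤a (ℚₚ.0≤∣p∣ q) q≤b)

  ∣∣≤⇒≤+ : ∀ {p q e} → ∣ p - q ∣ ≤ e → p ≤ q + e
  ∣∣≤⇒≤+ {p} {q} {e} h = ≤-by (e - (p - q)) (eq p q e) (p≤q⇒0≤q-p (ℚₚ.≤-trans (p≤∣p∣ (p - q)) h))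
    where
    eq : ∀ p q e → q + e ≡ p + (e - (p - q))
    eq = solve-∀ ℚ-ring

  ≤+⇒∣∣≤ : ∀ {p q e} → p ≤ q + e → q ≤ p + e → ∣ p - q ∣ ≤ e
  ≤+⇒∣∣≤ {p} {q} {e} p≤ q≤ = ∣∣≤-intro
    (≤-by (q + e - p) (eq₁ p q e) (p≤q⇒0≤q-p p≤)) (≤-by (p + e - q) (eq₂ p q e) (p≤q⇒0≤q-p q≤))
    where
    eq₁ : ∀ p q e → e ≡ p - q + (q + e - p)
    eq₁ = solve-∀ ℚ-ring
    eq₂ : ∀ p q e → e ≡ - (p - q) + (p + e - q)
    eq₂ = solve-∀ ℚ-ring

  ∣∣≤-trans : ∀ {p q r a b} → ∣ p - q ∣ ≤ a → ∣ q - r ∣ ≤ b → ∣ p - r ∣ ≤ a + b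
  ∣∣≤-trans {p} {q} {r} {a} {b} h k = subst (λ t → ∣ t ∣ ≤ a + b) (eq p q r) (∣∣≤-+ {p - q} {q - r} h k)
    where
    eq : ∀ p q r → p - q + (q - r) ≡ p - r
    eq = solve-∀ ℚ-ring

  -- Natural numbers and their reciprocals as rationals

  opaque
    -- Opaque like `1/suc`, so that natural numbers enter only through the laws below and fractions
    -- are not normalised.
    ν : ℕ → ℚ
    ν n = + n / 1

  opaque
    unfolding ν

    ν-def : ∀ n → + n / 1 ≡ ν n
    ν-def n = refl

    ν-zero : ν 0 ≡ 0ℚ
    ν-zero = refl

    ν-one : ν 1 ≡ 1ℚ
    ν-one = refl

    toℚᵘ-ν : ∀ n → ℚ.toℚᵘ (ν n) ℚᵘ.≃ mkℚᵘ (+ n) 0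
    toℚᵘ-ν n = ℚₚ.toℚᵘ-fromℚᵘ (mkℚᵘ (+ n) 0)

  ν-* : ∀ m n → ν (m ℕ.* n) ≡ ν m * ν n
  ν-* m n = ℚₚ.toℚᵘ-injective (ℚᵘₚ.≃-trans (toℚᵘ-ν (m ℕ.* n)) (ℚᵘₚ.≃-sym
    (ℚᵘₚ.≃-trans (ℚₚ.toℚᵘ-homo-* (ν m) (ν n)) (ℚᵘₚ.≃-trans (ℚᵘₚ.*-cong (toℚᵘ-ν m) (toℚᵘ-ν n))
      (*≡* (cong (ℤ._* + 1) (sym (ℤₚ.pos-* m n))))))))

  ν-+ : ∀ m n → ν (m ℕ.+ n) ≡ ν m + ν n
  ν-+ m n = ℚₚ.toℚᵘ-injective (ℚᵘₚ.≃-trans (toℚᵘ-ν (m ℕ.+ n)) (ℚᵘₚ.≃-sym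
    (ℚᵘₚ.≃-trans (ℚₚ.toℚᵘ-homo-+ (ν m) (ν n)) (ℚᵘₚ.≃-trans (ℚᵘₚ.+-cong (toℚᵘ-ν m) (toℚᵘ-ν n))
      (*≡* (cong (ℤ._* + 1) (cong₂ ℤ._+_ (ℤₚ.*-identityʳ (+ m)) (ℤₚ.*-identityʳ (+ n)))))))))

  ν-suc : ∀ n → ν (suc n) ≡ 1ℚ + ν n
  ν-suc n = trans (ν-+ 1 n) (cong (_+ ν n) ν-one)

  ν-mono : ∀ {m n} → m ℕ.≤ n → ν m ≤ ν n
  ν-mono {m} {n} m≤n = ℚₚ.toℚᵘ-cancel-≤ (ℚᵘₚ.≤-respˡ-≃ (ℚᵘₚ.≃-sym (toℚᵘ-ν m))
    (ℚᵘₚ.≤-respʳ-≃ (ℚᵘₚ.≃-sym (toℚᵘ-ν n))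
      (ℚᵘ.*≤* (ℤₚ.*-monoʳ-≤-nonNeg (+ 1) (ℤ.+≤+ m≤n)))))

  0≤ν : ∀ n → 0ℚ ≤ ν n
  0≤ν n = subst (_≤ ν n) ν-zero (ν-mono {0} {n} z≤n)

  0<ν-suc : ∀ n → 0ℚ < ν (suc n)
  0<ν-suc n = ℚₚ.<-≤-trans (ℚₚ.positive⁻¹ 1ℚ) (subst (_≤ ν (suc n)) ν-one (ν-mono {1} {suc n} (s≤s z≤n)))

  private
    unit-fraction : ∀ n → (+ 1 / suc n) * ν (suc n) ≡ 1ℚ
    unit-fraction n = ℚₚ.toℚᵘ-injective (ℚᵘₚ.≃-trans (ℚₚ.toℚᵘ-homo-* (+ 1 / suc n) (ν (suc n)))
      (ℚᵘₚ.≃-trans (ℚᵘₚ.*-cong (ℚₚ.toℚᵘ-fromℚᵘ (mkℚᵘ (+ 1) n)) (toℚᵘ-ν (suc n)))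
        (*≡* (trans (ℤₚ.*-identityʳ _) (trans (ℤₚ.*-identityˡ (+ suc n))
          (sym (trans (ℤₚ.*-identityˡ _) (cong (λ t → + suc t) (ℕₚ.*-identityʳ n)))))))))

  opaque
    unfolding 1/suc

    1/suc-inverse : ∀ n → 1/suc n * ν (suc n) ≡ 1ℚ
    1/suc-inverse = unit-fraction

    1/!-inverse : ∀ n → 1/ n ! * ν (n !) ≡ 1ℚ
    1/!-inverse n with n ! | n ℕₚ.!≢0
    ... | suc m | _ = unit-fraction m

  0<1/suc : ∀ n → 0ℚ < 1/suc n
  0<1/suc n = ℚₚ.*-cancelʳ-<-nonNeg (ν (suc n)) {{ℚ.nonNegative (0≤ν (suc n))}}
    (subst₂ _<_ (sym (ℚₚ.*-zeroˡ (ν (suc n)))) (sym (1/suc-inverse n)) (ℚₚ.positive⁻¹ 1ℚ))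

  0≤1/suc : ∀ n → 0ℚ ≤ 1/suc n
  0≤1/suc = ℚₚ.<⇒≤ ∘ 0<1/suc

  ν-suc-cancel : ∀ n {p q} → ν (suc n) * p ≡ ν (suc n) * q → p ≡ q
  ν-suc-cancel n {p} {q} h = trans (lem p) (trans (cong (1/suc n *_) h) (sym (lem q)))
    where
    assoc : ∀ a b p → a * b * p ≡ a * (b * p)
    assoc = solve-∀ ℚ-ring
    lem : ∀ p → p ≡ 1/suc n * (ν (suc n) * p)
    lem p = trans (sym (ℚₚ.*-identityˡ p)) (trans (cong (_* p) (sym (1/suc-inverse n)))
      (assoc (1/suc n) (ν (suc n)) p))

  1/suc-antimono : ∀ {m n} → m ℕ.≤ n → 1/suc n ≤ 1/suc m
  1/suc-antimono {m} {n} m≤n = begin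
    1/suc n                        ≡⟨ ℚₚ.*-identityʳ (1/suc n) ⟨
    1/suc n * 1ℚ                   ≡⟨ cong (1/suc n *_) (1/suc-inverse m) ⟨
    1/suc n * (1/suc m * ν (suc m)) ≤⟨ *-monoˡ-≤ (0≤1/suc n) (*-monoˡ-≤ (0≤1/suc m) (ν-mono (s≤s m≤n))) ⟩
    1/suc n * (1/suc m * ν (suc n)) ≡⟨ comm (1/suc n) (1/suc m) (ν (suc n)) ⟩
    1/suc m * (1/suc n * ν (suc n)) ≡⟨ cong (1/suc m *_) (1/suc-inverse n) ⟩
    1/suc m * 1ℚ                   ≡⟨ ℚₚ.*-identityʳ (1/suc m) ⟩
    1/suc m                        ∎
    where
    open ℚₚ.≤-Reasoning
    comm : ∀ a b c → a * (b * c) ≡ b * (a * c)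
    comm = solve-∀ ℚ-ring

  1/suc-zero : 1/suc 0 ≡ 1ℚ
  1/suc-zero = trans (sym (ℚₚ.*-identityʳ (1/suc 0))) (trans (cong (1/suc 0 *_) (sym ν-one)) (1/suc-inverse 0))

  1/suc≤1 : ∀ n → 1/suc n ≤ 1ℚ
  1/suc≤1 n = subst (1/suc n ≤_) 1/suc-zero (1/suc-antimono {0} {n} z≤n)

  1/!-zero : 1/ 0 ! ≡ 1ℚ
  1/!-zero = trans (sym (ℚₚ.*-identityʳ (1/ 0 !))) (trans (cong (1/ 0 ! *_) (sym ν-one)) (1/!-inverse 0))

  1/!-suc : ∀ n → ν (suc n) * 1/ suc n ! ≡ 1/ n !
  1/!-suc n = begin
    ν (suc n) * 1/ suc n !                              ≡⟨ ℚₚ.*-identityʳ _ ⟨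
    ν (suc n) * 1/ suc n ! * 1ℚ                         ≡⟨ cong (ν (suc n) * 1/ suc n ! *_) (1/!-inverse n) ⟨
    ν (suc n) * 1/ suc n ! * (1/ n ! * ν (n !))         ≡⟨ eq (ν (suc n)) (1/ suc n !) (1/ n !) (ν (n !)) ⟩
    1/ n ! * (1/ suc n ! * (ν (suc n) * ν (n !)))       ≡⟨ cong (λ t → 1/ n ! * (1/ suc n ! * t)) (ν-* (suc n) (n !)) ⟨
    1/ n ! * (1/ suc n ! * ν (suc n !))                 ≡⟨ cong (1/ n ! *_) (1/!-inverse (suc n)) ⟩
    1/ n ! * 1ℚ                                         ≡⟨ ℚₚ.*-identityʳ _ ⟩
    1/ n !                                              ∎
    where
    open ≡-Reasoning
    eq : ∀ a b c d → a * b * (c * d) ≡ c * (b * (a * d))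
    eq = solve-∀ ℚ-ring

  -- The numerator is the bound: a nonnegative fraction does not exceed it, and a negative one lies
  -- below 0.
  archimedean : ∀ p → ∃[ n ] p ≤ ν n
  archimedean p@(mkℚ (ℤ.-[1+ _ ]) _ _) = 0 , subst (p ≤_) (sym ν-zero) (ℚₚ.nonPositive⁻¹ p)
  archimedean p@(mkℚ (+ m) d c) = m , (begin
    p                       ≡⟨ ℚₚ.↥p/↧p≡p p ⟨
    + m / suc d             ≡⟨ m/d ⟩
    ν m * (+ 1 / suc d)     ≤⟨ *-monoˡ-≤ (0≤ν m) 1/d≤1 ⟩
    ν m * 1ℚ                ≡⟨ ℚₚ.*-identityʳ (ν m) ⟩
    ν m                     ∎)
    where
    open ℚₚ.≤-Reasoning
    1/d≤1 : (+ 1 / suc d) ≤ 1ℚ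
    1/d≤1 = ℚₚ.toℚᵘ-cancel-≤ (ℚᵘₚ.≤-respˡ-≃ (ℚᵘₚ.≃-sym (ℚₚ.toℚᵘ-fromℚᵘ (mkℚᵘ (+ 1) d)))
      (ℚᵘ.*≤* (ℤₚ.*-monoˡ-≤-nonNeg (+ 1) (ℤ.+≤+ (s≤s z≤n)))))
    m/d : + m / suc d ≡ ν m * (+ 1 / suc d)
    m/d = ℚₚ.toℚᵘ-injective (ℚᵘₚ.≃-trans (ℚₚ.toℚᵘ-fromℚᵘ (mkℚᵘ (+ m) d)) (ℚᵘₚ.≃-sym
      (ℚᵘₚ.≃-trans (ℚₚ.toℚᵘ-homo-* (ν m) (+ 1 / suc d))
        (ℚᵘₚ.≃-trans (ℚᵘₚ.*-cong (toℚᵘ-ν m) (ℚₚ.toℚᵘ-fromℚᵘ (mkℚᵘ (+ 1) d)))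
          (*≡* (cong₂ ℤ._*_ (ℤₚ.*-identityʳ (+ m)) (cong (λ t → + suc t) (sym (ℕₚ.+-identityʳ d)))))))))

  1/suc-small : ∀ c {ε} → 0ℚ ≤ c → 0ℚ < ε → ∃[ n ] c * 1/suc n ≤ ε
  1/suc-small c {ε} 0≤c 0<ε =
    let n , h = archimedean (c * ℚ.1/ ε) in n , *-cancelˡ-≤ (0<ν-suc n) (begin
    ν (suc n) * (c * 1/suc n)  ≡⟨ eq₁ (ν (suc n)) c (1/suc n) ⟩
    c * (1/suc n * ν (suc n))  ≡⟨ cong (c *_) (1/suc-inverse n) ⟩
    c * 1ℚ                     ≡⟨ cong (c *_) (ℚₚ.*-inverseˡ ε) ⟨
    c * (ℚ.1/ ε * ε)           ≡⟨ ℚₚ.*-assoc c (ℚ.1/ ε) ε ⟨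
    c * ℚ.1/ ε * ε             ≤⟨ ℚₚ.*-monoʳ-≤-nonNeg ε {{ℚₚ.pos⇒nonNeg ε}} (ℚₚ.≤-trans h (ν-mono (ℕₚ.n≤1+n n))) ⟩
    ν (suc n) * ε              ∎)
    where
    open ℚₚ.≤-Reasoning
    instance
      ε-pos : ℚ.Positive ε
      ε-pos = ℚ.positive 0<ε
      ε≢0 : ℚ.NonZero ε
      ε≢0 = ℚₚ.pos⇒nonZero ε
    eq₁ : ∀ a b c → a * (b * c) ≡ b * (c * a)
    eq₁ = solve-∀ ℚ-ring

  -- Real numbers

  ≈ʳ-pointwise : ∀ {x y} → (∀ n → seq x n ≡ seq y n) → x ≈ʳ y
  ≈ʳ-pointwise {x} {y} eq ε 0<ε = 0 , λ n _ → subst (λ t → ∣ t ∣ ≤ ε)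
    (trans (sym (ℚₚ.+-inverseʳ (seq y n))) (cong (_- seq y n) (sym (eq n)))) (ℚₚ.<⇒≤ 0<ε)

  ≈ʳ-refl : ∀ {x} → x ≈ʳ x
  ≈ʳ-refl {x} = ≈ʳ-pointwise {x} {x} λ _ → refl

  ≈ʳ-sym : ∀ {x y} → x ≈ʳ y → y ≈ʳ x
  ≈ʳ-sym {x} {y} x≈y ε 0<ε = let N , h = x≈y ε 0<ε in
    N , λ n N≤n → subst (_≤ ε) (∣p-q∣≡∣q-p∣ (seq x n) (seq y n)) (h n N≤n)

  ≈ʳ-trans : ∀ {x y z} → x ≈ʳ y → y ≈ʳ z → x ≈ʳ z
  ≈ʳ-trans {x} {y} {z} x≈y y≈z ε 0<ε =
    let M , f = x≈y (½ * ε) (½-pos 0<ε)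
        N , g = y≈z (½ * ε) (½-pos 0<ε)
    in M ℕ.⊔ N , λ n l → subst (∣ seq x n - seq z n ∣ ≤_) (½+½ ε)
      (∣∣≤-trans {seq x n} (f n (ℕₚ.m⊔n≤o⇒m≤o M N l)) (g n (ℕₚ.m⊔n≤o⇒n≤o M N l)))

  ℝ-bounded : ∀ x → ∃[ b ] 0ℚ ≤ b × ∃[ N ] ∀ n → N ℕ.≤ n → ∣ seq x n ∣ ≤ b
  ℝ-bounded x =
    let N , close = cauchy x 1ℚ (ℚₚ.positive⁻¹ 1ℚ)
    in 1ℚ + ∣ seq x N ∣ , 0≤-+ 0≤1 (ℚₚ.0≤∣p∣ (seq x N)) , N , λ n N≤n →
      subst (λ t → ∣ t ∣ ≤ 1ℚ + ∣ seq x N ∣) (eq (seq x n) (seq x N))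
        (∣∣≤-+ {seq x n - seq x N} {seq x N} (close n N N≤n ℕₚ.≤-refl) ℚₚ.≤-refl)
    where
    eq : ∀ a b → a - b + b ≡ a
    eq = solve-∀ ℚ-ring

  -- The rational form of _⟶ʳ_, which avoids the nested quantification over ℝ.
  Lim : (ℕ → ℝ) → ℝ → Set
  Lim a x = ∀ ε → 0ℚ < ε → ∃[ N ] ∀ n → N ℕ.≤ n →
    ∃[ I ] ∀ i → I ℕ.≤ i → ∣ seq (a n) i - seq x i ∣ ≤ ε

  Lim⇒⟶ : ∀ {a x} → Lim a x → a ⟶ʳ x
  Lim⇒⟶ {a} {x} lim ε 0<ε = let N , f = lim ε 0<ε in N , λ n N≤n →
    let I , g = f n N≤n in
      (λ η 0<η → I , λ i I≤i →
        weaken η 0<η (∣∣≤⇒≤+ {seq (a n) i} {seq x i} (g i I≤i)))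
    , (λ η 0<η → I , λ i I≤i →
        weaken η 0<η (∣∣≤⇒≤+ {seq x i} {seq (a n) i}
          (subst (_≤ ε) (∣p-q∣≡∣q-p∣ (seq (a n) i) (seq x i)) (g i I≤i))))
    where
    weaken : ∀ {p q} η → 0ℚ < η → p ≤ q → p ≤ q + η
    weaken {p} {q} η 0<η p≤q = ℚₚ.≤-trans p≤q (≤-by η refl (ℚₚ.<⇒≤ 0<η))

  ⟶⇒Lim : ∀ {a x} → a ⟶ʳ x → Lim a x
  ⟶⇒Lim {a} {x} lim ε 0<ε = let N , f = lim (½ * ε) (½-pos 0<ε) in N , λ n N≤n →
    let (u , v) = f n N≤n
        I , g = u (½ * ε) (½-pos 0<ε)
        J , h = v (½ * ε) (½-pos 0<ε)
    in I ℕ.⊔ J , λ i l → ≤+⇒∣∣≤ {seq (a n) i} {seq x i}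
      (subst (seq (a n) i ≤_) (halves (seq x i)) (g i (ℕₚ.m⊔n≤o⇒m≤o I J l)))
      (subst (seq x i ≤_) (halves (seq (a n) i)) (h i (ℕₚ.m⊔n≤o⇒n≤o I J l)))
    where
    eq : ∀ q e → q + ½ * e + ½ * e ≡ q + e
    eq = solve-∀ ℚ-ring
    halves : ∀ q → q + ½ * ε + ½ * ε ≡ q + ε
    halves q = eq q ε

  lim-const : ∀ {x y} → x ≈ʳ y → Lim (λ _ → x) y
  lim-const x≈y ε 0<ε = 0 , λ _ _ → x≈y ε 0<ε

  lim-const⁻¹ : ∀ {x y} → Lim (λ _ → x) y → x ≈ʳ y
  lim-const⁻¹ lim ε 0<ε = let N , f = lim ε 0<ε in f N ℕₚ.≤-refl

  lim-unique : ∀ {a x y} → Lim a x → Lim a y → x ≈ʳ y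
  lim-unique {a} {x} {y} p q ε 0<ε =
    let M , f = p (½ * ε) (½-pos 0<ε)
        N , g = q (½ * ε) (½-pos 0<ε)
        I , h = f (M ℕ.⊔ N) (ℕₚ.m≤m⊔n M N)
        J , k = g (M ℕ.⊔ N) (ℕₚ.m≤n⊔m M N)
    in I ℕ.⊔ J , λ i l → subst (∣ seq x i - seq y i ∣ ≤_) (½+½ ε)
      (∣∣≤-trans {seq x i} {seq (a (M ℕ.⊔ N)) i}
        (subst (_≤ ½ * ε) (∣p-q∣≡∣q-p∣ (seq (a (M ℕ.⊔ N)) i) (seq x i)) (h i (ℕₚ.m⊔n≤o⇒m≤o I J l)))
        (k i (ℕₚ.m⊔n≤o⇒n≤o I J l)))

  lim-respˡ : ∀ {a b x} → (∀ n → a n ≈ʳ b n) → Lim a x → Lim b x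
  lim-respˡ {a} {b} {x} a≈b lim ε 0<ε =
    let N , f = lim (½ * ε) (½-pos 0<ε)
    in N , λ n N≤n →
    let I , g = f n N≤n
        J , h = a≈b n (½ * ε) (½-pos 0<ε)
    in I ℕ.⊔ J , λ i l → subst (∣ seq (b n) i - seq x i ∣ ≤_) (½+½ ε)
      (∣∣≤-trans {seq (b n) i} {seq (a n) i}
        (subst (_≤ ½ * ε) (∣p-q∣≡∣q-p∣ (seq (a n) i) (seq (b n) i)) (h i (ℕₚ.m⊔n≤o⇒n≤o I J l)))
        (g i (ℕₚ.m⊔n≤o⇒m≤o I J l)))

  lim-+ : ∀ {a b x y} → Lim a x → Lim b y → Lim (λ n → a n +ʳ b n) (x +ʳ y)
  lim-+ {a} {b} {x} {y} p q ε 0<ε =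
    let M , f = p (½ * ε) (½-pos 0<ε)
        N , g = q (½ * ε) (½-pos 0<ε)
    in M ℕ.⊔ N , λ n l →
    let I , h = f n (ℕₚ.m⊔n≤o⇒m≤o M N l)
        J , k = g n (ℕₚ.m⊔n≤o⇒n≤o M N l)
    in I ℕ.⊔ J , λ i l′ → subst₂ _≤_
      (cong ∣_∣ (eq (seq (a n) i) (seq x i) (seq (b n) i) (seq y i))) (½+½ ε)
      (∣∣≤-+ {seq (a n) i - seq x i} {seq (b n) i - seq y i}
        (h i (ℕₚ.m⊔n≤o⇒m≤o I J l′)) (k i (ℕₚ.m⊔n≤o⇒n≤o I J l′)))
    where
    eq : ∀ a x b y → a - x + (b - y) ≡ a + b - (x + y)
    eq = solve-∀ ℚ-ring

  lim-* : ∀ {a b x y} → Lim a x → Lim b y → Lim (λ n → a n *ʳ b n) (x *ʳ y)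
  lim-* {a} {b} {x} {y} p q ε 0<ε =
    let B , 0≤B , K , x≤B = ℝ-bounded x
        C , 0≤C , L , y≤C = ℝ-bounded y
        -- Taking δ of the form 1/(d+1) also gives δ ≤ 1, hence ∣b∣ ≤ 1 + C near the limit.
        d , Dδ≤ε = 1/suc-small (1ℚ + C + B) (0≤-+ (0≤-+ 0≤1 0≤C) 0≤B) 0<ε
        δ = 1/suc d
        M , f = p δ (0<1/suc d)
        N , g = q δ (0<1/suc d)
    in M ℕ.⊔ N , λ n l →
    let I , h = f n (ℕₚ.m⊔n≤o⇒m≤o M N l)
        J , k = g n (ℕₚ.m⊔n≤o⇒n≤o M N l)
    in (I ℕ.⊔ J) ℕ.⊔ (K ℕ.⊔ L) , λ i l′ →
    let IJ = ℕₚ.m⊔n≤o⇒m≤o (I ℕ.⊔ J) (K ℕ.⊔ L) l′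
        KL = ℕₚ.m⊔n≤o⇒n≤o (I ℕ.⊔ J) (K ℕ.⊔ L) l′
        aᵢ = seq (a n) i
        bᵢ = seq (b n) i
        xᵢ = seq x i
        yᵢ = seq y i
        ∣a-x∣ = h i (ℕₚ.m⊔n≤o⇒m≤o I J IJ)
        ∣b-y∣ = k i (ℕₚ.m⊔n≤o⇒n≤o I J IJ)
        ∣b∣ : ∣ bᵢ ∣ ≤ 1ℚ + C
        ∣b∣ = subst (λ t → ∣ t ∣ ≤ 1ℚ + C) (eq₁ bᵢ yᵢ)
          (∣∣≤-+ {bᵢ - yᵢ} {yᵢ} (ℚₚ.≤-trans ∣b-y∣ (1/suc≤1 d)) (y≤C i (ℕₚ.m⊔n≤o⇒n≤o K L KL)))
    in begin
      ∣ aᵢ * bᵢ - xᵢ * yᵢ ∣                  ≡⟨ cong ∣_∣ (eq₂ aᵢ xᵢ bᵢ yᵢ) ⟩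
      ∣ (aᵢ - xᵢ) * bᵢ + xᵢ * (bᵢ - yᵢ) ∣   ≤⟨ ∣∣≤-+ {(aᵢ - xᵢ) * bᵢ} {xᵢ * (bᵢ - yᵢ)}
        (∣∣≤-* {aᵢ - xᵢ} {bᵢ} ∣a-x∣ ∣b∣) (∣∣≤-* {xᵢ} {bᵢ - yᵢ} (x≤B i (ℕₚ.m⊔n≤o⇒m≤o K L KL)) ∣b-y∣) ⟩
      δ * (1ℚ + C) + B * δ                  ≡⟨ eq₃ δ C B ⟩
      (1ℚ + C + B) * δ                      ≤⟨ Dδ≤ε ⟩
      ε                                     ∎
    where
    open ℚₚ.≤-Reasoning
    eq₁ : ∀ b y → b - y + y ≡ b
    eq₁ = solve-∀ ℚ-ring
    eq₂ : ∀ a x b y → a * b - x * y ≡ (a - x) * b + x * (b - y)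
    eq₂ = solve-∀ ℚ-ring
    eq₃ : ∀ d c b → d * (1ℚ + c) + b * d ≡ (1ℚ + c + b) * d
    eq₃ = solve-∀ ℚ-ring

  lim-neg : ∀ {a x} → Lim a x → Lim (λ n → -ʳ a n) (-ʳ x)
  lim-neg {a} {x} lim ε 0<ε = let N , f = lim ε 0<ε in N , λ n N≤n →
    let I , g = f n N≤n in I , λ i I≤i →
      subst (_≤ ε) (trans (∣p-q∣≡∣q-p∣ (seq (a n) i) (seq x i)) (cong ∣_∣ (eq (seq (a n) i) (seq x i)))) (g i I≤i)
    where
    eq : ∀ a x → x - a ≡ - a - (- x)
    eq = solve-∀ ℚ-ring

  -- Applied to a multiple zeta value, whose representing sequence consists of truncated sums, this
  -- is the convergence of those sums to it.
  lim-ℚ : ∀ x → Lim (λ n → ℚ→ℝ (seq x n)) x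
  lim-ℚ x ε 0<ε = let N , f = cauchy x ε 0<ε in N , λ n N≤n → N , λ i N≤i → f n i N≤n N≤i

  -- Equality of reals is convergence of a constant sequence, so congruence follows from the limit
  -- law.
  +ʳ-cong : ∀ {x x′ y y′} → x ≈ʳ x′ → y ≈ʳ y′ → x +ʳ y ≈ʳ x′ +ʳ y′
  +ʳ-cong {x} {x′} {y} {y′} p q = lim-const⁻¹ {x +ʳ y} {x′ +ʳ y′}
    (lim-+ {λ _ → x} {λ _ → y} {x′} {y′} (lim-const {x} {x′} p) (lim-const {y} {y′} q))

  *ʳ-cong : ∀ {x x′ y y′} → x ≈ʳ x′ → y ≈ʳ y′ → x *ʳ y ≈ʳ x′ *ʳ y′
  *ʳ-cong {x} {x′} {y} {y′} p q = lim-const⁻¹ {x *ʳ y} {x′ *ʳ y′}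
    (lim-* {λ _ → x} {λ _ → y} {x′} {y′} (lim-const {x} {x′} p) (lim-const {y} {y′} q))

  -ʳ-cong : ∀ {x x′} → x ≈ʳ x′ → -ʳ x ≈ʳ -ʳ x′
  -ʳ-cong {x} {x′} p = lim-const⁻¹ { -ʳ x} { -ʳ x′} (lim-neg {λ _ → x} {x′} (lim-const {x} {x′} p))

  lim-respʳ : ∀ {a x y} → x ≈ʳ y → Lim a x → Lim a y
  lim-respʳ {a} {x} {y} x≈y lim ε 0<ε =
    let N , f = lim (½ * ε) (½-pos 0<ε)
        J , h = x≈y (½ * ε) (½-pos 0<ε)
    in N , λ n N≤n →
    let I , g = f n N≤n
    in I ℕ.⊔ J , λ i l → subst (∣ seq (a n) i - seq y i ∣ ≤_) (½+½ ε)
      (∣∣≤-trans {seq (a n) i} {seq x i} (g i (ℕₚ.m⊔n≤o⇒m≤o I J l)) (h i (ℕₚ.m⊔n≤o⇒n≤o I J l)))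

  -- Finite sums and powers of rationals

  Σℚ : (ℕ → ℚ) → ℕ → ℚ
  Σℚ = sum _+_ 0ℚ

  infixr 8 _^ℚ_
  _^ℚ_ : ℚ → ℕ → ℚ
  _^ℚ_ = power ℚ.+-*-rawSemiring

  Σ-cong : ∀ {f g : ℕ → ℚ} n → (∀ i → i ℕ.< n → f i ≡ g i) → Σℚ f n ≡ Σℚ g n
  Σ-cong zero    eq = refl
  Σ-cong (suc n) eq = cong₂ _+_ (Σ-cong n λ i i<n → eq i (ℕₚ.m<n⇒m<1+n i<n)) (eq n ℕₚ.≤-refl)

  Σ-mono : ∀ {f g : ℕ → ℚ} n → (∀ i → i ℕ.< n → f i ≤ g i) → Σℚ f n ≤ Σℚ g n
  Σ-mono zero    le = ℚₚ.≤-refl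
  Σ-mono (suc n) le = ℚₚ.+-mono-≤ (Σ-mono n λ i i<n → le i (ℕₚ.m<n⇒m<1+n i<n)) (le n ℕₚ.≤-refl)

  Σ-abs : ∀ {f g : ℕ → ℚ} n → (∀ i → i ℕ.< n → ∣ f i ∣ ≤ g i) → ∣ Σℚ f n ∣ ≤ Σℚ g n
  Σ-abs     zero    le = ℚₚ.≤-refl
  Σ-abs {f} (suc n) le = ∣∣≤-+ {Σℚ f n} {f n}
    (Σ-abs n λ i i<n → le i (ℕₚ.m<n⇒m<1+n i<n)) (le n ℕₚ.≤-refl)

  Σ-+ : ∀ f g n → Σℚ (λ i → f i + g i) n ≡ Σℚ f n + Σℚ g n
  Σ-+ f g zero    = refl
  Σ-+ f g (suc n) = trans (cong (_+ (f n + g n)) (Σ-+ f g n)) (eq (Σℚ f n) (Σℚ g n) (f n) (g n))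
    where
    eq : ∀ a b c d → a + b + (c + d) ≡ a + c + (b + d)
    eq = solve-∀ ℚ-ring

  Σ-*ˡ : ∀ c f n → Σℚ (λ i → c * f i) n ≡ c * Σℚ f n
  Σ-*ˡ c f zero    = sym (ℚₚ.*-zeroʳ c)
  Σ-*ˡ c f (suc n) = trans (cong (_+ c * f n) (Σ-*ˡ c f n)) (sym (ℚₚ.*-distribˡ-+ c (Σℚ f n) (f n)))

  Σ-const : ∀ c n → Σℚ (λ _ → c) n ≡ ν n * c
  Σ-const c zero    = sym (trans (cong (_* c) ν-zero) (ℚₚ.*-zeroˡ c))
  Σ-const c (suc n) = trans (cong (_+ c) (Σ-const c n))
    (trans (eq (ν n) c) (cong (_* c) (sym (ν-suc n))))
    where
    eq : ∀ n c → n * c + c ≡ (1ℚ + n) * c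
    eq = solve-∀ ℚ-ring

  Σ-shift : ∀ f n → Σℚ f (suc n) ≡ f 0 + Σℚ (f ∘ suc) n
  Σ-shift f zero    = ℚₚ.+-comm 0ℚ (f 0)
  Σ-shift f (suc n) = trans (cong (_+ f (suc n)) (Σ-shift f n)) (ℚₚ.+-assoc (f 0) (Σℚ (f ∘ suc) n) (f (suc n)))

  Σ≥0 : ∀ {f : ℕ → ℚ} n → (∀ i → 0ℚ ≤ f i) → 0ℚ ≤ Σℚ f n
  Σ≥0 zero    0≤f = ℚₚ.≤-refl
  Σ≥0 (suc n) 0≤f = 0≤-+ (Σ≥0 n 0≤f) (0≤f n)

  ^-+ : ∀ x m n → x ^ℚ (m ℕ.+ n) ≡ x ^ℚ m * x ^ℚ n
  ^-+ x zero    n = sym (ℚₚ.*-identityˡ (x ^ℚ n))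
  ^-+ x (suc m) n = trans (cong (x *_) (^-+ x m n)) (sym (ℚₚ.*-assoc x (x ^ℚ m) (x ^ℚ n)))

  ^≥0 : ∀ {x} → 0ℚ ≤ x → ∀ n → 0ℚ ≤ x ^ℚ n
  ^≥0 0≤x zero    = 0≤1
  ^≥0 0≤x (suc n) = 0≤-* 0≤x (^≥0 0≤x n)

  -- The exponential series

  expTerm : ℚ → ℕ → ℚ
  expTerm x j = 1/ j ! * x ^ℚ j

  expSum : ℚ → ℕ → ℚ
  expSum x = Σℚ (expTerm x)

  expTerm-zero : ∀ x → expTerm x 0 ≡ 1ℚ
  expTerm-zero x = trans (ℚₚ.*-identityʳ (1/ 0 !)) 1/!-zero

  expTerm-suc : ∀ x j → ν (suc j) * expTerm x (suc j) ≡ x * expTerm x j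
  expTerm-suc x j = trans (eq₁ (ν (suc j)) (1/ suc j !) x (x ^ℚ j))
    (trans (cong (λ t → x * (t * x ^ℚ j)) (1/!-suc j)) refl)
    where
    eq₁ : ∀ a b x y → a * (b * (x * y)) ≡ x * (a * b * y)
    eq₁ = solve-∀ ℚ-ring

  expTerm-suc′ : ∀ x j → expTerm x (suc j) ≡ x * 1/suc j * expTerm x j
  expTerm-suc′ x j = ν-suc-cancel j (trans (expTerm-suc x j) (sym (begin
    ν (suc j) * (x * 1/suc j * expTerm x j)  ≡⟨ eq (ν (suc j)) x (1/suc j) (expTerm x j) ⟩
    1/suc j * ν (suc j) * (x * expTerm x j)  ≡⟨ cong (_* (x * expTerm x j)) (1/suc-inverse j) ⟩
    1ℚ * (x * expTerm x j)                   ≡⟨ ℚₚ.*-identityˡ _ ⟩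
    x * expTerm x j                          ∎)))
    where
    open ≡-Reasoning
    eq : ∀ n x r e → n * (x * r * e) ≡ r * n * (x * e)
    eq = solve-∀ ℚ-ring

  -- The binomial theorem divided by m!. Multiplication by m+1 = i + (m+1-i) acts on the convolution
  -- by the Leibniz rule: each half lowers one factor and leaves x or y times the sum for m.
  expTerm-+ : ∀ x y m → Σℚ (λ i → expTerm x i * expTerm y (m ℕ.∸ i)) (suc m) ≡ expTerm (x + y) m
  expTerm-+ x y zero = trans (ℚₚ.+-identityˡ _) (trans
    (cong₂ _*_ (expTerm-zero x) (expTerm-zero y)) (sym (expTerm-zero (x + y))))
  expTerm-+ x y (suc m) = ν-suc-cancel m (begin
    ν (suc m) * Σℚ (λ i → X i * Y (suc m ℕ.∸ i)) (2 ℕ.+ m)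
      ≡⟨ Σ-*ˡ (ν (suc m)) _ (2 ℕ.+ m) ⟨
    Σℚ (λ i → ν (suc m) * (X i * Y (suc m ℕ.∸ i))) (2 ℕ.+ m)
      ≡⟨ Σ-cong (2 ℕ.+ m) (λ i i<2+m → trans
           (cong (_* (X i * Y (suc m ℕ.∸ i))) (trans (cong ν (sym (ℕₚ.m+[n∸m]≡n (ℕₚ.≤-pred i<2+m)))) (ν-+ i _)))
           (leibniz (ν i) (ν (suc m ℕ.∸ i)) (X i) (Y (suc m ℕ.∸ i)))) ⟩
    Σℚ (λ i → left i + right i) (2 ℕ.+ m)
      ≡⟨ Σ-+ left right (2 ℕ.+ m) ⟩
    Σℚ left (2 ℕ.+ m) + Σℚ right (2 ℕ.+ m)
      ≡⟨ cong₂ _+_ (Σ-shift left (suc m)) refl ⟩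
    left 0 + Σℚ (left ∘ suc) (suc m) + (Σℚ right (suc m) + right (suc m))
      ≡⟨ cong₂ _+_
           (cong₂ _+_ left-0 (trans
             (Σ-cong {left ∘ suc} {λ i → x * (X i * Y (m ℕ.∸ i))} (suc m) λ i _ → trans
               (cong (_* Y (m ℕ.∸ i)) (expTerm-suc x i)) (ℚₚ.*-assoc x (X i) (Y (m ℕ.∸ i))))
             (Σ-*ˡ x _ (suc m))))
           (cong₂ _+_ (trans
             (Σ-cong {right} {λ i → y * (X i * Y (m ℕ.∸ i))} (suc m) λ i i<1+m → trans
               (cong (λ t → X i * (ν t * Y t)) (ℕₚ.+-∸-assoc 1 (ℕₚ.≤-pred i<1+m)))
               (trans (cong (X i *_) (expTerm-suc y (m ℕ.∸ i))) (swap (X i) y (Y (m ℕ.∸ i)))))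
             (Σ-*ˡ y _ (suc m))) right-last) ⟩
    0ℚ + x * S + (y * S + 0ℚ)
      ≡⟨ collect x y S ⟩
    (x + y) * S
      ≡⟨ cong ((x + y) *_) (expTerm-+ x y m) ⟩
    (x + y) * expTerm (x + y) m
      ≡⟨ expTerm-suc (x + y) m ⟨
    ν (suc m) * expTerm (x + y) (suc m) ∎)
    where
    open ≡-Reasoning
    X Y left right : ℕ → ℚ
    X = expTerm x
    Y = expTerm y
    left i  = ν i * X i * Y (suc m ℕ.∸ i)
    right i = X i * (ν (suc m ℕ.∸ i) * Y (suc m ℕ.∸ i))
    S : ℚ
    S = Σℚ (λ i → X i * Y (m ℕ.∸ i)) (suc m)
    leibniz : ∀ a b p q → (a + b) * (p * q) ≡ a * p * q + p * (b * q)
    leibniz = solve-∀ ℚ-ring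
    swap : ∀ p y q → p * (y * q) ≡ y * (p * q)
    swap = solve-∀ ℚ-ring
    collect : ∀ x y s → 0ℚ + x * s + (y * s + 0ℚ) ≡ (x + y) * s
    collect = solve-∀ ℚ-ring
    zeroˡ : ∀ p q → 0ℚ * p * q ≡ 0ℚ
    zeroˡ = solve-∀ ℚ-ring
    zeroʳ : ∀ p q → p * (0ℚ * q) ≡ 0ℚ
    zeroʳ = solve-∀ ℚ-ring
    left-0 : left 0 ≡ 0ℚ
    left-0 = trans (cong (λ t → t * X 0 * Y (suc m)) ν-zero) (zeroˡ (X 0) (Y (suc m)))
    right-last : right (suc m) ≡ 0ℚ
    right-last = trans
      (cong (λ t → X (suc m) * (t * Y (m ℕ.∸ m))) (trans (cong ν (ℕₚ.n∸n≡0 m)) ν-zero))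
      (zeroʳ (X (suc m)) (Y (m ℕ.∸ m)))

  -- The left side runs over the pairs i + j < n. Passing to n+1 adds the diagonal i + j = n, which
  -- is `expTerm-+`.
  expSum-triangle : ∀ x y n → Σℚ (λ i → expTerm x i * expSum y (n ℕ.∸ i)) n ≡ expSum (x + y) n
  expSum-triangle x y zero    = refl
  expSum-triangle x y (suc n) = begin
    Σℚ (λ i → X i * expSum y (suc n ℕ.∸ i)) (suc n)
      ≡⟨ Σ-cong (suc n) (λ i i<1+n → trans (cong (λ t → X i * expSum y t) (ℕₚ.+-∸-assoc 1 (ℕₚ.≤-pred i<1+n)))
           (ℚₚ.*-distribˡ-+ (X i) (expSum y (n ℕ.∸ i)) (Y (n ℕ.∸ i)))) ⟩
    Σℚ (λ i → X i * expSum y (n ℕ.∸ i) + X i * Y (n ℕ.∸ i)) (suc n)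
      ≡⟨ Σ-+ _ _ (suc n) ⟩
    Σℚ (λ i → X i * expSum y (n ℕ.∸ i)) n + X n * expSum y (n ℕ.∸ n) + Σℚ (λ i → X i * Y (n ℕ.∸ i)) (suc n)
      ≡⟨ cong₂ _+_ (cong₂ _+_ (expSum-triangle x y n) last) (expTerm-+ x y n) ⟩
    expSum (x + y) n + 0ℚ + expTerm (x + y) n
      ≡⟨ cong (_+ expTerm (x + y) n) (ℚₚ.+-identityʳ (expSum (x + y) n)) ⟩
    expSum (x + y) (suc n) ∎
    where
    open ≡-Reasoning
    X Y : ℕ → ℚ
    X = expTerm x
    Y = expTerm y
    last : X n * expSum y (n ℕ.∸ n) ≡ 0ℚ
    last = trans (cong (λ t → X n * expSum y t) (ℕₚ.n∸n≡0 n)) (ℚₚ.*-zeroʳ (X n))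

  eventually-decreasing⇒bounded : ∀ {f : ℕ → ℚ} K → (∀ i → K ℕ.≤ i → f (suc i) ≤ f i) →
    ∃[ C ] 0ℚ ≤ C × ∀ i → f i ≤ C
  eventually-decreasing⇒bounded {f} zero    dec = ∣ f 0 ∣ , ℚₚ.0≤∣p∣ (f 0) , bound
    where
    bound : ∀ i → f i ≤ ∣ f 0 ∣
    bound zero    = p≤∣p∣ (f 0)
    bound (suc i) = ℚₚ.≤-trans (dec i z≤n) (bound i)
  eventually-decreasing⇒bounded {f} (suc K) dec
    with eventually-decreasing⇒bounded {f ∘ suc} K (λ i K≤i → dec (suc i) (s≤s K≤i))
  ... | C , 0≤C , f≤C = ∣ f 0 ∣ + C , 0≤-+ (ℚₚ.0≤∣p∣ (f 0)) 0≤C , bound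
    where
    bound : ∀ i → f i ≤ ∣ f 0 ∣ + C
    bound zero    = ℚₚ.≤-trans (p≤∣p∣ (f 0)) (≤-by C refl 0≤C)
    bound (suc i) = ℚₚ.≤-trans (f≤C i) (≤-by ∣ f 0 ∣ (ℚₚ.+-comm ∣ f 0 ∣ C) (ℚₚ.0≤∣p∣ (f 0)))

  ¼^ : ℕ → ℚ
  ¼^ n = (½ * ½) ^ℚ n

  ¼^≥0 : ∀ n → 0ℚ ≤ ¼^ n
  ¼^≥0 = ^≥0 (ℚₚ.<⇒≤ (0<-* 0<½ 0<½))

  -- The ratio 1/4 is a product of two factors 1/2, so that (1/2)^n absorbs ν n and another (1/2)^n
  -- absorbs ν (suc n).
  ¼^-small : ∀ n → ν n * ¼^ n ≤ 1/suc n
  ¼^-small n = *-cancelˡ-≤ (0<ν-suc n) (begin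
    ν (suc n) * (ν n * ¼^ n)               ≡⟨ cong (λ t → ν (suc n) * (ν n * t)) (¼^≡ n) ⟩
    ν (suc n) * (ν n * (½ ^ℚ n * ½ ^ℚ n))  ≡⟨ eq (ν (suc n)) (ν n) (½ ^ℚ n) ⟩
    ν (suc n) * ½ ^ℚ n * (ν n * ½ ^ℚ n)    ≤⟨ *-mono-≤
      (0≤-* (0≤ν (suc n)) (½^≥0 n)) (lin n) (0≤-* (0≤ν n) (½^≥0 n)) (lin′ n) ⟩
    1ℚ * 1ℚ                                ≡⟨⟩
    1ℚ                                     ≡⟨ 1/suc-inverse n ⟨
    1/suc n * ν (suc n)                    ≡⟨ ℚₚ.*-comm (1/suc n) (ν (suc n)) ⟩
    ν (suc n) * 1/suc n                    ∎)
    where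
    open ℚₚ.≤-Reasoning
    eq : ∀ a b h → a * (b * (h * h)) ≡ a * h * (b * h)
    eq = solve-∀ ℚ-ring
    ½^≥0 : ∀ n → 0ℚ ≤ ½ ^ℚ n
    ½^≥0 = ^≥0 (ℚₚ.<⇒≤ 0<½)
    eq₂ : ∀ h → ½ * ½ * (h * h) ≡ ½ * h * (½ * h)
    eq₂ = solve-∀ ℚ-ring
    ¼^≡ : ∀ n → ¼^ n ≡ ½ ^ℚ n * ½ ^ℚ n
    ¼^≡ zero    = refl
    ¼^≡ (suc n) = trans (cong (½ * ½ *_) (¼^≡ n)) (eq₂ (½ ^ℚ n))
    eq₃ : ∀ a h → 1ℚ ≡ (1ℚ + a) * (½ * h) + (½ * (1ℚ - a * h) + ½ * (1ℚ - h))
    eq₃ = solve-∀ ℚ-ring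
    ½^≤1 : ∀ n → ½ ^ℚ n ≤ 1ℚ
    ½^≤1 zero    = ℚₚ.≤-refl
    ½^≤1 (suc n) = ℚₚ.≤-trans (*-monoˡ-≤ (ℚₚ.<⇒≤ 0<½) (½^≤1 n)) (≤-by ½ refl (ℚₚ.<⇒≤ 0<½))
    lin : ∀ n → ν (suc n) * ½ ^ℚ n ≤ 1ℚ
    lin zero    = ℚₚ.≤-reflexive (trans (ℚₚ.*-identityʳ (ν 1)) ν-one)
    lin (suc n) = ≤-by (½ * (1ℚ - ν (suc n) * ½ ^ℚ n) + ½ * (1ℚ - ½ ^ℚ n))
      (trans (eq₃ (ν (suc n)) (½ ^ℚ n))
        (cong (λ t → t * ½ ^ℚ (suc n) + (½ * (1ℚ - ν (suc n) * ½ ^ℚ n) + ½ * (1ℚ - ½ ^ℚ n))) (sym (ν-suc (suc n)))))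
      (0≤-+ (0≤-* (ℚₚ.<⇒≤ 0<½) (p≤q⇒0≤q-p (lin n))) (0≤-* (ℚₚ.<⇒≤ 0<½) (p≤q⇒0≤q-p (½^≤1 n))))
    lin′ : ∀ n → ν n * ½ ^ℚ n ≤ 1ℚ
    lin′ n = ℚₚ.≤-trans (ℚₚ.*-monoʳ-≤-nonNeg (½ ^ℚ n) {{ℚ.nonNegative (½^≥0 n)}} (ν-mono (ℕₚ.n≤1+n n))) (lin n)

  -- Here `M` i is (4B)^i / i!. It decreases as soon as i+1 ≥ 4B, so it is bounded, and taking out
  -- 4^i leaves the geometric factor.
  expTerm-bound : ∀ B → 0ℚ ≤ B → ∃[ C ] 0ℚ ≤ C × ∀ x → ∣ x ∣ ≤ B → ∀ i → ∣ expTerm x i ∣ ≤ C * ¼^ i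
  expTerm-bound B 0≤B =
    let K , h = archimedean (4ℚ * B)
        C , 0≤C , M≤C = eventually-decreasing⇒bounded {M} K λ i K≤i →
          ℚₚ.≤-trans (ℚₚ.*-monoʳ-≤-nonNeg (M i) {{ℚ.nonNegative (M≥0 i)}} (begin
            4ℚ * B * 1/suc i        ≤⟨ ℚₚ.*-monoʳ-≤-nonNeg (1/suc i) {{ℚ.nonNegative (0≤1/suc i)}}
                                         (ℚₚ.≤-trans h (ν-mono (ℕₚ.m≤n⇒m≤1+n K≤i))) ⟩
            ν (suc i) * 1/suc i     ≡⟨ ℚₚ.*-comm (ν (suc i)) (1/suc i) ⟩
            1/suc i * ν (suc i)     ≡⟨ 1/suc-inverse i ⟩
            1ℚ                      ∎))
            (ℚₚ.≤-reflexive (ℚₚ.*-identityˡ (M i)))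
    in C , 0≤C , λ x ∣x∣≤B i → ℚₚ.≤-trans (bound x ∣x∣≤B i)
         (ℚₚ.*-monoʳ-≤-nonNeg (¼^ i) {{ℚ.nonNegative (¼^≥0 i)}} (M≤C i))
    where
    open ℚₚ.≤-Reasoning
    4ℚ : ℚ
    4ℚ = 1ℚ + 1ℚ + 1ℚ + 1ℚ
    M : ℕ → ℚ
    M zero    = 1ℚ
    M (suc i) = 4ℚ * B * 1/suc i * M i
    M≥0 : ∀ i → 0ℚ ≤ M i
    M≥0 zero    = 0≤1
    M≥0 (suc i) = 0≤-* (0≤-* (0≤-* (ℚₚ.nonNegative⁻¹ 4ℚ) 0≤B) (0≤1/suc i)) (M≥0 i)
    eq : ∀ b r m q → b * r * (m * q) ≡ (1ℚ + 1ℚ + 1ℚ + 1ℚ) * b * r * m * (½ * ½ * q)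
    eq = solve-∀ ℚ-ring
    bound : ∀ x → ∣ x ∣ ≤ B → ∀ i → ∣ expTerm x i ∣ ≤ M i * ¼^ i
    bound x ∣x∣≤B zero    = ℚₚ.≤-reflexive (cong ∣_∣ (expTerm-zero x))
    bound x ∣x∣≤B (suc i) = begin
      ∣ expTerm x (suc i) ∣              ≡⟨ cong ∣_∣ (expTerm-suc′ x i) ⟩
      ∣ x * 1/suc i * expTerm x i ∣      ≤⟨ ∣∣≤-* {x * 1/suc i} {expTerm x i}
        (∣∣≤-* {x} {1/suc i} ∣x∣≤B (ℚₚ.≤-reflexive (ℚₚ.0≤p⇒∣p∣≡p (0≤1/suc i)))) (bound x ∣x∣≤B i) ⟩
      B * 1/suc i * (M i * ¼^ i)         ≡⟨ eq B (1/suc i) (M i) (¼^ i) ⟩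
      M (suc i) * ¼^ (suc i)             ∎

  -- A geometric tail. The sharp factor would be 4/3; with 2 the induction closes with the slack C/2
  -- times `¼^` (i + d).
  expSum-tail : ∀ {C y} → 0ℚ ≤ C → (∀ i → ∣ expTerm y i ∣ ≤ C * ¼^ i) →
    ∀ d i → ∣ expSum y (i ℕ.+ d) - expSum y d ∣ ≤ (C + C) * (¼^ d - ¼^ (i ℕ.+ d))
  expSum-tail {C} {y} 0≤C le d zero = ℚₚ.≤-reflexive (trans (cong ∣_∣ (ℚₚ.+-inverseʳ (expSum y d)))
    (sym (trans (cong ((C + C) *_) (ℚₚ.+-inverseʳ (¼^ d))) (ℚₚ.*-zeroʳ (C + C)))))
  expSum-tail {C} {y} 0≤C le d (suc i) = begin
    ∣ E + expTerm y (i ℕ.+ d) - expSum y d ∣    ≡⟨ cong ∣_∣ (eq₁ E (expTerm y (i ℕ.+ d)) (expSum y d)) ⟩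
    ∣ E - expSum y d + expTerm y (i ℕ.+ d) ∣    ≤⟨ ∣∣≤-+ {E - expSum y d} {expTerm y (i ℕ.+ d)}
      (expSum-tail 0≤C le d i) (le (i ℕ.+ d)) ⟩
    (C + C) * (¼^ d - ¼^ (i ℕ.+ d)) + C * ¼^ (i ℕ.+ d)  ≤⟨ ≤-by (C * (½ * ¼^ (i ℕ.+ d)))
      (eq₂ C (¼^ d) (¼^ (i ℕ.+ d))) (0≤-* 0≤C (0≤-* (ℚₚ.<⇒≤ 0<½) (¼^≥0 (i ℕ.+ d)))) ⟩
    (C + C) * (¼^ d - ¼^ (suc i ℕ.+ d))                 ∎
    where
    open ℚₚ.≤-Reasoning
    E : ℚ
    E = expSum y (i ℕ.+ d)
    eq₁ : ∀ a p b → a + p - b ≡ a - b + p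
    eq₁ = solve-∀ ℚ-ring
    eq₂ : ∀ c p q → (c + c) * (p - ½ * ½ * q) ≡ (c + c) * (p - q) + c * q + c * (½ * q)
    eq₂ = solve-∀ ℚ-ring

  -- The product of two partial sums covers a square, `expSum-triangle` its lower triangle. Row i of
  -- the rest is X_i times a tail of the other series, at most C ¼^i · 2C ¼^(n-i) = 2C² ¼^n, and
  -- there are n rows. Uniformity in x and y lets one n serve all late approximations of a real.
  expSum-+ : ∀ B → 0ℚ ≤ B → ∃[ D ] 0ℚ ≤ D × ∀ x y n → ∣ x ∣ ≤ B → ∣ y ∣ ≤ B →
    ∣ expSum x n * expSum y n - expSum (x + y) n ∣ ≤ D * 1/suc n
  expSum-+ B 0≤B = let C , 0≤C , le = expTerm-bound B 0≤B in
    C * (C + C) , 0≤-* 0≤C (0≤-+ 0≤C 0≤C) , λ x y n x≤B y≤B →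
    let X = expTerm x
        E = expSum y
        tail : ∀ i → i ℕ.< n → ∣ E n - E (n ℕ.∸ i) ∣ ≤ (C + C) * ¼^ (n ℕ.∸ i)
        tail i i<n = subst (λ m → ∣ E m - E (n ℕ.∸ i) ∣ ≤ (C + C) * ¼^ (n ℕ.∸ i)) (ℕₚ.m+[n∸m]≡n (ℕₚ.<⇒≤ i<n))
          (ℚₚ.≤-trans (expSum-tail 0≤C (le y y≤B) (n ℕ.∸ i) i)
            (*-monoˡ-≤ (0≤-+ 0≤C 0≤C) (≤-by (¼^ (i ℕ.+ (n ℕ.∸ i))) (eq₃ (¼^ (n ℕ.∸ i)) _) (¼^≥0 (i ℕ.+ (n ℕ.∸ i))))))
    in begin
    ∣ expSum x n * E n - expSum (x + y) n ∣
      ≡⟨ cong (λ t → ∣ expSum x n * E n - t ∣) (expSum-triangle x y n) ⟨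
    ∣ expSum x n * E n - Σℚ (λ i → X i * E (n ℕ.∸ i)) n ∣
      ≡⟨ cong ∣_∣ (difference X (λ i → E (n ℕ.∸ i)) (E n) n) ⟨
    ∣ Σℚ (λ i → X i * (E n - E (n ℕ.∸ i))) n ∣
      ≤⟨ Σ-abs n (λ i i<n → ℚₚ.≤-trans (∣∣≤-* {X i} {E n - E (n ℕ.∸ i)} (le x x≤B i) (tail i i<n))
           (ℚₚ.≤-reflexive (trans (eq₁ C (¼^ i) (¼^ (n ℕ.∸ i)))
             (cong (C * (C + C) *_) (trans (sym (^-+ (½ * ½) i (n ℕ.∸ i))) (cong ¼^ (ℕₚ.m+[n∸m]≡n (ℕₚ.<⇒≤ i<n)))))))) ⟩
    Σℚ (λ _ → C * (C + C) * ¼^ n) n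
      ≡⟨ Σ-const (C * (C + C) * ¼^ n) n ⟩
    ν n * (C * (C + C) * ¼^ n)
      ≡⟨ eq₂ (ν n) (C * (C + C)) (¼^ n) ⟩
    C * (C + C) * (ν n * ¼^ n)
      ≤⟨ *-monoˡ-≤ (0≤-* 0≤C (0≤-+ 0≤C 0≤C)) (¼^-small n) ⟩
    C * (C + C) * 1/suc n ∎
    where
    open ℚₚ.≤-Reasoning
    eq₁ : ∀ c p q → c * p * ((c + c) * q) ≡ c * (c + c) * (p * q)
    eq₁ = solve-∀ ℚ-ring
    eq₂ : ∀ n c p → n * (c * p) ≡ c * (n * p)
    eq₂ = solve-∀ ℚ-ring
    eq₃ : ∀ p q → p ≡ p - q + q
    eq₃ = solve-∀ ℚ-ring
    eq₄ : ∀ a b x e c → a * e - b + x * (e - c) ≡ (a + x) * e - (b + x * c)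
    eq₄ = solve-∀ ℚ-ring
    difference : ∀ (X F : ℕ → ℚ) e n → Σℚ (λ i → X i * (e - F i)) n ≡ Σℚ X n * e - Σℚ (λ i → X i * F i) n
    difference X F e zero    = sym (trans (cong (_- 0ℚ) (ℚₚ.*-zeroˡ e)) refl)
    difference X F e (suc n) = trans (cong (_+ X n * (e - F n)) (difference X F e n))
      (eq₄ (Σℚ X n) (Σℚ (λ i → X i * F i) n) (X n) e (F n))

  -- The exponential of a real number and its functional equation

  _^ʳ_ : ℝ → ℕ → ℝ
  x ^ʳ zero  = 1ʳ
  x ^ʳ suc n = x *ʳ x ^ʳ n

  expSumʳ : ℝ → ℕ → ℝ
  expSumʳ x = sum _+ʳ_ 0ʳ λ j → ℚ→ℝ (1/ j !) *ʳ x ^ʳ j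

  seq-^ʳ : ∀ x n i → seq (x ^ʳ n) i ≡ seq x i ^ℚ n
  seq-^ʳ x zero    i = refl
  seq-^ʳ x (suc n) i = cong (seq x i *_) (seq-^ʳ x n i)

  seq-expSumʳ : ∀ x n i → seq (expSumʳ x n) i ≡ expSum (seq x i) n
  seq-expSumʳ x zero    i = refl
  seq-expSumʳ x (suc n) i = cong₂ _+_ (seq-expSumʳ x n i) (cong (1/ n ! *_) (seq-^ʳ x n i))

  Expʳ : ℝ → ℝ → Set
  Expʳ x e = Lim (expSumʳ x) e

  expʳ-resp : ∀ {x y e} → (∀ i → seq x i ≡ seq y i) → Expʳ x e → Expʳ y e
  expʳ-resp {x} {y} {e} x≡y = lim-respˡ {expSumʳ x} {expSumʳ y} {e} λ n →
    ≈ʳ-pointwise {expSumʳ x n} {expSumʳ y n} λ i → trans (seq-expSumʳ x n i)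
      (trans (cong (λ t → expSum t n) (x≡y i)) (sym (seq-expSumʳ y n i)))

  expʳ-0 : Expʳ 0ʳ 1ʳ
  -- The index starts at 1 because the empty partial sum is 0.
  expʳ-0 ε 0<ε = 1 , λ { (suc n) _ → 0 , λ i _ → subst (_≤ ε)
    (sym (trans (cong (λ t → ∣ t - 1ℚ ∣) (trans (seq-expSumʳ 0ʳ (suc n) i) (expSum-0 n))) refl)) (ℚₚ.<⇒≤ 0<ε) }
    where
    eq : ∀ a b → 1ℚ + a * (0ℚ * b) ≡ 1ℚ
    eq = solve-∀ ℚ-ring
    expSum-0 : ∀ n → expSum 0ℚ (suc n) ≡ 1ℚ
    expSum-0 zero    = trans (ℚₚ.+-identityˡ _) (expTerm-zero 0ℚ)
    expSum-0 (suc n) = trans (cong (_+ expTerm 0ℚ (suc n)) (expSum-0 n)) (eq (1/ suc n !) (0ℚ ^ℚ n))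

  -- The products of partial sums tend to a b. By `expSum-+` they differ from the partial sums at x
  -- + y by O(1/n), once the approximations of x and y have reached their bounds.
  expʳ-+ : ∀ {x y a b} → Expʳ x a → Expʳ y b → Expʳ (x +ʳ y) (a *ʳ b)
  expʳ-+ {x} {y} {a} {b} p q ε 0<ε =
    let B , 0≤B , K , x≤B = ℝ-bounded x
        C , 0≤C , L , y≤C = ℝ-bounded y
        D , 0≤D , close = expSum-+ (B + C) (0≤-+ 0≤B 0≤C)
        d , Dδ≤ε = 1/suc-small D 0≤D (½-pos 0<ε)
        N , f = lim-* {expSumʳ x} {expSumʳ y} {a} {b} p q (½ * ε) (½-pos 0<ε)
    in N ℕ.⊔ d , λ n l →
    let I , g = f n (ℕₚ.m⊔n≤o⇒m≤o N d l)
    in I ℕ.⊔ (K ℕ.⊔ L) , λ i l′ →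
    let KL = ℕₚ.m⊔n≤o⇒n≤o I (K ℕ.⊔ L) l′
        xᵢ = seq x i
        yᵢ = seq y i
        product = expSum xᵢ n * expSum yᵢ n
        cauchyProduct : ∣ expSum (xᵢ + yᵢ) n - product ∣ ≤ ½ * ε
        cauchyProduct = subst (_≤ ½ * ε) (∣p-q∣≡∣q-p∣ product (expSum (xᵢ + yᵢ) n)) (begin
          ∣ product - expSum (xᵢ + yᵢ) n ∣ ≤⟨ close xᵢ yᵢ n
            (ℚₚ.≤-trans (x≤B i (ℕₚ.m⊔n≤o⇒m≤o K L KL)) (≤-by C refl 0≤C))
            (ℚₚ.≤-trans (y≤C i (ℕₚ.m⊔n≤o⇒n≤o K L KL)) (≤-by B (ℚₚ.+-comm B C) 0≤B)) ⟩
          D * 1/suc n                      ≤⟨ *-monoˡ-≤ 0≤D (1/suc-antimono (ℕₚ.m⊔n≤o⇒n≤o N d l)) ⟩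
          D * 1/suc d                      ≤⟨ Dδ≤ε ⟩
          ½ * ε                            ∎)
    in subst₂ _≤_ (cong (λ t → ∣ t - seq a i * seq b i ∣) (sym (seq-expSumʳ (x +ʳ y) n i))) (½+½ ε)
      (∣∣≤-trans {expSum (xᵢ + yᵢ) n} {product} {seq a i * seq b i} cauchyProduct
        (subst (λ t → ∣ t - seq a i * seq b i ∣ ≤ ½ * ε)
          (cong₂ _*_ (seq-expSumʳ x n i) (seq-expSumʳ y n i)) (g i (ℕₚ.m⊔n≤o⇒m≤o I (K ℕ.⊔ L) l′))))
    where open ℚₚ.≤-Reasoning

  expʳ-* : ∀ {x a} → Expʳ x a → ∀ k → Expʳ (ℚ→ℝ (ν k) *ʳ x) (a ^ʳ k)
  expʳ-* {x} {a} p zero = expʳ-resp {0ʳ} {ℚ→ℝ (ν 0) *ʳ x} {1ʳ}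
    (λ i → sym (trans (cong (_* seq x i) ν-zero) (ℚₚ.*-zeroˡ (seq x i)))) expʳ-0
  expʳ-* {x} {a} p (suc k) = expʳ-resp {x +ʳ ℚ→ℝ (ν k) *ʳ x} {ℚ→ℝ (ν (suc k)) *ʳ x} {a ^ʳ suc k}
    (λ i → trans (eq (ν k) (seq x i)) (cong (_* seq x i) (sym (ν-suc k))))
    (expʳ-+ {x} {ℚ→ℝ (ν k) *ʳ x} {a} {a ^ʳ k} p (expʳ-* {x} {a} p k))
    where
    eq : ∀ k x → x + k * x ≡ (1ℚ + k) * x
    eq = solve-∀ ℚ-ring

  -- Since exp(kx) = (m+1)^k, the functional equation gives p (m+1)^k = exp 0 = 1; multiplying by
  -- the rational 1/(m+1)^k isolates p.
  expʳ-neg-* : ∀ {x m p} k → Expʳ x (ℚ→ℝ (ν (suc m))) → Expʳ (ℚ→ℝ (- ν k) *ʳ x) p → p ≈ʳ ℚ→ℝ (recip^ m k)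
  expʳ-neg-* {x} {m} {p} k ex ep =
    ≈ʳ-trans {p} {1ʳ *ʳ ℚ→ℝ (recip^ m k)} {ℚ→ℝ (recip^ m k)}
      (≈ʳ-trans {p} {p *ʳ M ^ʳ k *ʳ ℚ→ℝ (recip^ m k)} {1ʳ *ʳ ℚ→ℝ (recip^ m k)}
        (≈ʳ-pointwise {p} {p *ʳ M ^ʳ k *ʳ ℚ→ℝ (recip^ m k)} λ i → begin
          seq p i                                     ≡⟨ ℚₚ.*-identityʳ _ ⟨
          seq p i * 1ℚ                                ≡⟨ cong (seq p i *_) (inverse k) ⟨
          seq p i * (ν (suc m) ^ℚ k * 1/suc m ^ℚ k)   ≡⟨ ℚₚ.*-assoc (seq p i) _ _ ⟨
          seq p i * ν (suc m) ^ℚ k * 1/suc m ^ℚ k     ≡⟨ cong (λ t → seq p i * t * recip^ m k) (seq-^ʳ M k i) ⟨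
          seq p i * seq (M ^ʳ k) i * recip^ m k       ∎)
        (*ʳ-cong {p *ʳ M ^ʳ k} {1ʳ} {ℚ→ℝ (recip^ m k)} {ℚ→ℝ (recip^ m k)} pMᵏ≈1
          (≈ʳ-refl {ℚ→ℝ (recip^ m k)})))
      (≈ʳ-pointwise {1ʳ *ʳ ℚ→ℝ (recip^ m k)} {ℚ→ℝ (recip^ m k)} λ _ → ℚₚ.*-identityˡ (recip^ m k))
    where
    open ≡-Reasoning
    M : ℝ
    M = ℚ→ℝ (ν (suc m))
    eq : ∀ a b c d → a * b * (c * d) ≡ c * a * (b * d)
    eq = solve-∀ ℚ-ring
    inverse : ∀ k → ν (suc m) ^ℚ k * 1/suc m ^ℚ k ≡ 1ℚ
    inverse zero    = refl
    inverse (suc k) = trans (eq (ν (suc m)) (ν (suc m) ^ℚ k) (1/suc m) (1/suc m ^ℚ k))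
      (cong₂ _*_ (1/suc-inverse m) (inverse k))
    cancel : ∀ n x → - n * x + n * x ≡ 0ℚ
    cancel = solve-∀ ℚ-ring
    y z : ℝ
    y = ℚ→ℝ (- ν k) *ʳ x
    z = ℚ→ℝ (ν k) *ʳ x
    pMᵏ≈1 : p *ʳ M ^ʳ k ≈ʳ 1ʳ
    pMᵏ≈1 = lim-unique {expSumʳ 0ʳ} {p *ʳ M ^ʳ k} {1ʳ}
      (expʳ-resp {y +ʳ z} {0ʳ} {p *ʳ M ^ʳ k} (λ i → cancel (ν k) (seq x i))
        (expʳ-+ {y} {z} {p} {M ^ʳ k} ep (expʳ-* {x} {M} ex k)))
      expʳ-0

  -- Multiple harmonic sums

  nested : (ℕ → ℚ) → ℕ → ℕ → ℚ
  nested F k = Σℚ (λ m → F m * recip^ m k)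

  -- 1/p + 1/q = (p + q)/(pq). This is the source of the convolution sum and of the recursion for
  -- `eulerError`; its case b = 0 is the telescoping of 1/(n+1).
  1/suc-partial-fractions : ∀ {a b n} → suc a ℕ.+ suc b ≡ suc n →
    1/suc a * 1/suc b ≡ 1/suc n * (1/suc a + 1/suc b)
  1/suc-partial-fractions {a} {b} {n} a+b≡n = sym (begin
    r * (p + q)                                ≡⟨ cong₂ (λ u v → r * (u + v)) (expand p q (1/suc-inverse b)) (trans (expand q p (1/suc-inverse a)) (comm q p (ν (suc a)))) ⟩
    r * (p * q * ν (suc b) + p * q * ν (suc a)) ≡⟨ factor r p q (ν (suc a)) (ν (suc b)) ⟩
    p * q * (r * (ν (suc a) + ν (suc b)))      ≡⟨ cong (λ t → p * q * (r * t)) (trans (sym (ν-+ (suc a) (suc b))) (cong ν a+b≡n)) ⟩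
    p * q * (r * ν (suc n))                    ≡⟨ cong (p * q *_) (1/suc-inverse n) ⟩
    p * q * 1ℚ                                 ≡⟨ ℚₚ.*-identityʳ (p * q) ⟩
    p * q                                      ∎)
    where
    open ≡-Reasoning
    p q r : ℚ
    p = 1/suc a
    q = 1/suc b
    r = 1/suc n
    expand : ∀ p q {n} → q * n ≡ 1ℚ → p ≡ p * q * n
    expand p q {n} qn≡1 = trans (sym (ℚₚ.*-identityʳ p)) (trans (cong (p *_) (sym qn≡1)) (sym (ℚₚ.*-assoc p q n)))
    comm : ∀ p q n → p * q * n ≡ q * p * n
    comm = solve-∀ ℚ-ring
    factor : ∀ r p q a b → r * (p * q * b + p * q * a) ≡ p * q * (r * (a + b))
    factor = solve-∀ ℚ-ring

  recip^≥0 : ∀ m k → 0ℚ ≤ recip^ m k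
  recip^≥0 m k = ^≥0 (0≤1/suc m) k

  recip^≤1 : ∀ m k → recip^ m k ≤ 1ℚ
  recip^≤1 m zero    = ℚₚ.≤-refl
  recip^≤1 m (suc k) = *-mono-≤ {b = 1ℚ} {d = 1ℚ} (0≤1/suc m) (1/suc≤1 m) (recip^≥0 m k) (recip^≤1 m k)

  recip^-suc≤ : ∀ m k → recip^ m (suc k) ≤ 1/suc m
  recip^-suc≤ m k = ℚₚ.≤-trans (*-monoˡ-≤ (0≤1/suc m) (recip^≤1 m k)) (ℚₚ.≤-reflexive (ℚₚ.*-identityʳ (1/suc m)))

  recip^-2+≤ : ∀ m k → recip^ m (2 ℕ.+ k) ≤ 1/suc m * 1/suc m
  recip^-2+≤ m k = *-monoˡ-≤ (0≤1/suc m) (recip^-suc≤ m k)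

  -- Stuffle products and Newton's identity for truncated sums

  ζ[1]≡harmonic : ∀ N → ζ[ 1 ∷ [] ] N ≡ harmonic N
  ζ[1]≡harmonic N = Σ-cong N λ i _ → eq (1/suc i)
    where
    eq : ∀ r → 1ℚ * (r * 1ℚ) ≡ r
    eq = solve-∀ ℚ-ring

  -- The pairs of indices are sorted into n₁ < n₂, n₁ > n₂ and n₁ = n₂.
  stuffle₁₁ : ∀ a b N → ζ[ a ∷ [] ] N * ζ[ b ∷ [] ] N ≡
    ζ[ a ∷ b ∷ [] ] N + ζ[ b ∷ a ∷ [] ] N + ζ[ a ℕ.+ b ∷ [] ] N
  stuffle₁₁ a b zero    = refl
  stuffle₁₁ a b (suc N) = begin
    (A + 1ℚ * ρ) * (B + 1ℚ * σ)
      ≡⟨ eq₁ A B ρ σ ⟩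
    A * B + (A * σ + B * ρ + 1ℚ * (ρ * σ))
      ≡⟨ cong₂ _+_ (stuffle₁₁ a b N) (cong (λ t → A * σ + B * ρ + 1ℚ * t) (sym (^-+ (1/suc N) a b))) ⟩
    AB + BA + C + (A * σ + B * ρ + 1ℚ * recip^ N (a ℕ.+ b))
      ≡⟨ eq₂ AB BA C (A * σ) (B * ρ) (1ℚ * recip^ N (a ℕ.+ b)) ⟩
    AB + A * σ + (BA + B * ρ) + (C + 1ℚ * recip^ N (a ℕ.+ b)) ∎
    where
    open ≡-Reasoning
    A B AB BA C ρ σ : ℚ
    A  = ζ[ a ∷ [] ] N
    B  = ζ[ b ∷ [] ] N
    AB = ζ[ a ∷ b ∷ [] ] N
    BA = ζ[ b ∷ a ∷ [] ] N
    C  = ζ[ a ℕ.+ b ∷ [] ] N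
    ρ  = recip^ N a
    σ  = recip^ N b
    eq₁ : ∀ A B ρ σ → (A + 1ℚ * ρ) * (B + 1ℚ * σ) ≡ A * B + (A * σ + B * ρ + 1ℚ * (ρ * σ))
    eq₁ = solve-∀ ℚ-ring
    eq₂ : ∀ a b c x y z → a + b + c + (x + y + z) ≡ a + x + (b + y) + (c + z)
    eq₂ = solve-∀ ℚ-ring

  -- The index of c has five positions relative to the other two. The one beyond both is split off:
  -- for c = 1 and b ≥ 2 it alone diverges.
  stuffle₂₁ : ∀ a b c N → ζ[ a ∷ b ∷ [] ] N * ζ[ c ∷ [] ] N ≡
    ζ[ a ∷ b ∷ c ∷ [] ] N + (ζ[ a ∷ c ∷ b ∷ [] ] N + ζ[ c ∷ a ∷ b ∷ [] ] N
      + ζ[ a ℕ.+ c ∷ b ∷ [] ] N + ζ[ a ∷ b ℕ.+ c ∷ [] ] N)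
  stuffle₂₁ a b c zero    = refl
  stuffle₂₁ a b c (suc N) = begin
    (P + A * ρ) * (C + 1ℚ * σ)
      ≡⟨ eq₁ P A ρ C σ ⟩
    P * C + (P * σ + A * C * ρ + A * (ρ * σ))
      ≡⟨ cong₂ (λ u v → u + (P * σ + v * ρ + A * (ρ * σ))) (stuffle₂₁ a b c N) (stuffle₁₁ a c N) ⟩
    x + (y + z + u + v) + (P * σ + (AC + CA + A+C) * ρ + A * (ρ * σ))
      ≡⟨ cong (λ t → x + (y + z + u + v) + (P * σ + (AC + CA + A+C) * ρ + A * t)) (^-+ (1/suc N) b c) ⟨
    x + (y + z + u + v) + (P * σ + (AC + CA + A+C) * ρ + A * recip^ N (b ℕ.+ c))
      ≡⟨ eq₂ x y z u v (P * σ) AC CA A+C ρ (A * recip^ N (b ℕ.+ c)) ⟩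
    x + P * σ + (y + AC * ρ + (z + CA * ρ) + (u + A+C * ρ) + (v + A * recip^ N (b ℕ.+ c))) ∎
    where
    open ≡-Reasoning
    P A C x y z u v AC CA A+C ρ σ : ℚ
    P   = ζ[ a ∷ b ∷ [] ] N
    A   = ζ[ a ∷ [] ] N
    C   = ζ[ c ∷ [] ] N
    x   = ζ[ a ∷ b ∷ c ∷ [] ] N
    y   = ζ[ a ∷ c ∷ b ∷ [] ] N
    z   = ζ[ c ∷ a ∷ b ∷ [] ] N
    u   = ζ[ a ℕ.+ c ∷ b ∷ [] ] N
    v   = ζ[ a ∷ b ℕ.+ c ∷ [] ] N
    AC  = ζ[ a ∷ c ∷ [] ] N
    CA  = ζ[ c ∷ a ∷ [] ] N
    A+C = ζ[ a ℕ.+ c ∷ [] ] N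
    ρ   = recip^ N b
    σ   = recip^ N c
    eq₁ : ∀ P A ρ C σ → (P + A * ρ) * (C + 1ℚ * σ) ≡ P * C + (P * σ + A * C * ρ + A * (ρ * σ))
    eq₁ = solve-∀ ℚ-ring
    eq₂ : ∀ x y z u v p e f g ρ q → x + (y + z + u + v) + (p + (e + f + g) * ρ + q) ≡
      x + p + (y + e * ρ + (z + f * ρ) + (u + g * ρ) + (v + q))
    eq₂ = solve-∀ ℚ-ring

  -- 6e₃ = p₁³ - 3p₁p₂ + 2p₃ in the variables 1, 1/2, ..., 1/N. A further variable r adds 3r · 2e₂
  -- to the left side, and 2e₂ = p₁² - p₂ is the stuffle product of H_N with itself.
  newton₃ : ∀ N → ζ[ 1 ∷ 1 ∷ 1 ∷ [] ] N * (1ℚ + 1ℚ + 1ℚ + 1ℚ + 1ℚ + 1ℚ) ≡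
    harmonic N * (harmonic N * harmonic N) - (1ℚ + 1ℚ + 1ℚ) * (ζ[ 2 ∷ [] ] N * harmonic N)
      + (1ℚ + 1ℚ) * ζ[ 3 ∷ [] ] N
  newton₃ zero    = refl
  newton₃ (suc N) = begin
    (e₃ + e₂ * (r * 1ℚ)) * (1ℚ + 1ℚ + 1ℚ + 1ℚ + 1ℚ + 1ℚ)
      ≡⟨ eq₁ e₃ e₂ r ⟩
    e₃ * (1ℚ + 1ℚ + 1ℚ + 1ℚ + 1ℚ + 1ℚ) + (1ℚ + 1ℚ + 1ℚ) * (e₂ + e₂) * r
      ≡⟨ cong₂ (λ u v → u + (1ℚ + 1ℚ + 1ℚ) * v * r) (newton₃ N) newton₂ ⟩
    h * (h * h) - (1ℚ + 1ℚ + 1ℚ) * (p₂ * h) + (1ℚ + 1ℚ) * p₃ + (1ℚ + 1ℚ + 1ℚ) * (h * h - p₂) * r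
      ≡⟨ eq₂ h p₂ p₃ r ⟩
    (h + r) * ((h + r) * (h + r)) - (1ℚ + 1ℚ + 1ℚ) * ((p₂ + 1ℚ * (r * (r * 1ℚ))) * (h + r))
      + (1ℚ + 1ℚ) * (p₃ + 1ℚ * (r * (r * (r * 1ℚ)))) ∎
    where
    open ≡-Reasoning
    h p₂ p₃ e₂ e₃ r : ℚ
    h  = harmonic N
    p₂ = ζ[ 2 ∷ [] ] N
    p₃ = ζ[ 3 ∷ [] ] N
    e₂ = ζ[ 1 ∷ 1 ∷ [] ] N
    e₃ = ζ[ 1 ∷ 1 ∷ 1 ∷ [] ] N
    r  = 1/suc N
    eq₀ : ∀ e p → e + e ≡ e + e + p - p
    eq₀ = solve-∀ ℚ-ring
    eq₁ : ∀ e f r → (e + f * (r * 1ℚ)) * (1ℚ + 1ℚ + 1ℚ + 1ℚ + 1ℚ + 1ℚ) ≡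
      e * (1ℚ + 1ℚ + 1ℚ + 1ℚ + 1ℚ + 1ℚ) + (1ℚ + 1ℚ + 1ℚ) * (f + f) * r
    eq₁ = solve-∀ ℚ-ring
    eq₂ : ∀ h p₂ p₃ r →
      h * (h * h) - (1ℚ + 1ℚ + 1ℚ) * (p₂ * h) + (1ℚ + 1ℚ) * p₃ + (1ℚ + 1ℚ + 1ℚ) * (h * h - p₂) * r ≡
      (h + r) * ((h + r) * (h + r)) - (1ℚ + 1ℚ + 1ℚ) * ((p₂ + 1ℚ * (r * (r * 1ℚ))) * (h + r))
        + (1ℚ + 1ℚ) * (p₃ + 1ℚ * (r * (r * (r * 1ℚ))))
    eq₂ = solve-∀ ℚ-ring
    newton₂ : e₂ + e₂ ≡ h * h - p₂
    newton₂ = trans (eq₀ e₂ p₂) (cong (_- p₂)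
      (trans (sym (stuffle₁₁ 1 1 N)) (cong₂ _*_ (ζ[1]≡harmonic N) (ζ[1]≡harmonic N))))

  -- Growth of the harmonic numbers

  harmonic≥0 : ∀ n → 0ℚ ≤ harmonic n
  harmonic≥0 n = Σ≥0 n 0≤1/suc

  harmonic-≤-+ : ∀ m b → harmonic (m ℕ.+ b) ≤ harmonic b + ν m * 1/suc b
  harmonic-≤-+ zero    b = ℚₚ.≤-reflexive (sym (trans
    (cong (λ t → harmonic b + t * 1/suc b) ν-zero) (eq (harmonic b) (1/suc b))))
    where
    eq : ∀ h r → h + 0ℚ * r ≡ h
    eq = solve-∀ ℚ-ring
  harmonic-≤-+ (suc m) b = ℚₚ.≤-trans
    (ℚₚ.+-mono-≤ (harmonic-≤-+ m b) (1/suc-antimono {b} {m ℕ.+ b} (ℕₚ.m≤n+m b m)))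
    (ℚₚ.≤-reflexive (trans (eq (harmonic b) (ν m) (1/suc b)) (cong (λ t → harmonic b + t * 1/suc b) (sym (ν-suc m)))))
    where
    eq : ∀ h n r → h + n * r + r ≡ h + (1ℚ + n) * r
    eq = solve-∀ ℚ-ring

  harmonic-mono : ∀ {m n} → m ℕ.≤ n → harmonic m ≤ harmonic n
  harmonic-mono {m} {n} m≤n = subst (λ t → harmonic m ≤ harmonic t) (ℕₚ.m∸n+n≡m m≤n) (go (n ℕ.∸ m))
    where
    go : ∀ d → harmonic m ≤ harmonic (d ℕ.+ m)
    go zero    = ℚₚ.≤-refl
    go (suc d) = ℚₚ.≤-trans (go d) (≤-by (1/suc (d ℕ.+ m)) refl (0≤1/suc (d ℕ.+ m)))

  harmonic-≥-+ : ∀ m b → harmonic b + ν m * 1/suc (m ℕ.+ b) ≤ harmonic (m ℕ.+ b)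
  harmonic-≥-+ m b = go m ℕₚ.≤-refl
    where
    open ℚₚ.≤-Reasoning
    r : ℚ
    r = 1/suc (m ℕ.+ b)
    eq₀ : ∀ h r → h + 0ℚ * r ≡ h
    eq₀ = solve-∀ ℚ-ring
    eq : ∀ h n r → h + (1ℚ + n) * r ≡ h + n * r + r
    eq = solve-∀ ℚ-ring
    go : ∀ i → i ℕ.≤ m → harmonic b + ν i * r ≤ harmonic (i ℕ.+ b)
    go zero    _   = ℚₚ.≤-reflexive (trans (cong (λ t → harmonic b + t * r) ν-zero) (eq₀ (harmonic b) r))
    go (suc i) i<m = begin
      harmonic b + ν (suc i) * r         ≡⟨ cong (λ t → harmonic b + t * r) (ν-suc i) ⟩
      harmonic b + (1ℚ + ν i) * r        ≡⟨ eq (harmonic b) (ν i) r ⟩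
      harmonic b + ν i * r + r           ≤⟨ ℚₚ.+-mono-≤ (go i (ℕₚ.<⇒≤ i<m)) (1/suc-antimono (ℕₚ.+-monoˡ-≤ b (ℕₚ.<⇒≤ i<m))) ⟩
      harmonic (suc i ℕ.+ b)             ∎

  -- Oresme's doubling: from K to 2K the sum grows by at least K/(2K+1), which is at least 1/3 for K
  -- ≥ 1.
  harmonic-unbounded : ∀ c → ∃[ N ] ∀ n → N ℕ.≤ n → c ≤ harmonic n
  harmonic-unbounded c =
    let j , 3c≤j = archimedean ((1ℚ + 1ℚ + 1ℚ) * c)
        N , j≤3H = go j
    in N , λ n N≤n → ℚₚ.≤-trans (*-cancelˡ-≤ (ℚₚ.positive⁻¹ (1ℚ + 1ℚ + 1ℚ)) (ℚₚ.≤-trans 3c≤j j≤3H)) (harmonic-mono N≤n)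
    where
    open ℚₚ.≤-Reasoning
    eq₁ : ∀ k → (1ℚ + 1ℚ + 1ℚ) * k ≡ 1ℚ + (k + k) + (k - 1ℚ)
    eq₁ = solve-∀ ℚ-ring
    eq₂ : ∀ k h r → (1ℚ + 1ℚ + 1ℚ) * (h + k * r) ≡ r * ((1ℚ + 1ℚ + 1ℚ) * k) + (1ℚ + 1ℚ + 1ℚ) * h
    eq₂ = solve-∀ ℚ-ring
    go : ∀ j → ∃[ N ] ν j ≤ (1ℚ + 1ℚ + 1ℚ) * harmonic N
    go zero    = 0 , ℚₚ.≤-reflexive ν-zero
    go (suc j) = let N , j≤3H = go j
                     K = suc N
                     r = 1/suc (K ℕ.+ K)
      in K ℕ.+ K , (begin
      ν (suc j)                                     ≡⟨ ν-suc j ⟩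
      1ℚ + ν j                                      ≡⟨ cong (_+ ν j) (1/suc-inverse (K ℕ.+ K)) ⟨
      r * ν (suc (K ℕ.+ K)) + ν j                   ≡⟨ cong (λ t → r * t + ν j) (trans (ν-suc (K ℕ.+ K)) (cong (λ t → 1ℚ + t) (ν-+ K K))) ⟩
      r * (1ℚ + (ν K + ν K)) + ν j                  ≤⟨ ℚₚ.+-mono-≤
        (*-monoˡ-≤ (0≤1/suc (K ℕ.+ K)) (≤-by (ν K - 1ℚ) (eq₁ (ν K))
          (p≤q⇒0≤q-p (subst (_≤ ν K) ν-one (ν-mono {1} {K} (s≤s z≤n))))))
        (ℚₚ.≤-trans j≤3H (*-monoˡ-≤ (ℚₚ.nonNegative⁻¹ (1ℚ + 1ℚ + 1ℚ)) (harmonic-mono (ℕₚ.n≤1+n N)))) ⟩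
      r * ((1ℚ + 1ℚ + 1ℚ) * ν K) + (1ℚ + 1ℚ + 1ℚ) * harmonic K  ≡⟨ eq₂ (ν K) (harmonic K) r ⟨
      (1ℚ + 1ℚ + 1ℚ) * (harmonic K + ν K * r)       ≤⟨ *-monoˡ-≤ (ℚₚ.nonNegative⁻¹ (1ℚ + 1ℚ + 1ℚ)) (harmonic-≥-+ K K) ⟩
      (1ℚ + 1ℚ + 1ℚ) * harmonic (K ℕ.+ K)           ∎)

  -- Telescoping majorant for the tails of ∑ (1 + H_n²) / (n + 1)².
  tailBound : ℕ → ℚ
  tailBound n = (1ℚ + 1ℚ) * (H * H + (1ℚ + 1ℚ) * H + (1ℚ + 1ℚ + 1ℚ + 1ℚ)) * 1/suc n
    where
    H : ℚ
    H = harmonic n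

  dominant : ℕ → ℚ
  dominant n = (1ℚ + harmonic n * harmonic n) * (1/suc n * 1/suc n)

  dominant≥0 : ∀ n → 0ℚ ≤ dominant n
  dominant≥0 n = 0≤-* (0≤-+ 0≤1 (square≥0 (harmonic n))) (square≥0 (1/suc n))

  tailBound≥0 : ∀ n → 0ℚ ≤ tailBound n
  tailBound≥0 n = 0≤-* (0≤-* (ℚₚ.nonNegative⁻¹ (1ℚ + 1ℚ)) (0≤-+ (0≤-+ (square≥0 (harmonic n))
    (0≤-* (ℚₚ.nonNegative⁻¹ (1ℚ + 1ℚ)) (harmonic≥0 n))) (ℚₚ.nonNegative⁻¹ (1ℚ + 1ℚ + 1ℚ + 1ℚ)))) (0≤1/suc n)

  -- The polynomial in `tailBound` imitates the integral of (log x)² / x², whose tail is ((log x)² +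
  -- 2 log x + 2)/x; the outer 2 and the larger constant leave room for discretization. The slack is
  -- exactly r s (1 - r)(h² + 3).
  tailBound-step : ∀ n → tailBound (suc n) + dominant n ≤ tailBound n
  tailBound-step n = ≤-by (r * s * (1ℚ - r) * (h * h + (1ℚ + 1ℚ + 1ℚ)))
    -- The identity is polynomial only up to a multiple of r - s(r + 1), which vanishes because s =
    -- 1/(n+2).
    (trans (eq h r s) (trans (cong (λ t → rest + cofactor * (r - t)) (sym r≡)) (zero′ rest cofactor r)))
    (0≤-* (0≤-* (0≤-* (0≤1/suc n) (0≤1/suc (suc n))) (p≤q⇒0≤q-p (1/suc≤1 n)))
      (0≤-+ (square≥0 h) (ℚₚ.nonNegative⁻¹ (1ℚ + 1ℚ + 1ℚ))))
    where
    h r s rest cofactor : ℚ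
    h = harmonic n
    r = 1/suc n
    s = 1/suc (suc n)
    rest = tailBound (suc n) + dominant n + r * s * (1ℚ - r) * (h * h + (1ℚ + 1ℚ + 1ℚ))
    cofactor = (1ℚ + 1ℚ) * (h * h + (1ℚ + 1ℚ) * h + (1ℚ + 1ℚ + 1ℚ + 1ℚ)) - (1ℚ + h * h) * r
    r≡ : r ≡ s * (r + 1ℚ)
    r≡ = trans (sym (ℚₚ.*-identityʳ r)) (trans (cong (r *_) (sym 1/suc-zero))
      (trans (1/suc-partial-fractions {n} {0} {suc n} (cong suc (ℕₚ.+-comm n 1)))
        (cong (λ t → s * (r + t)) 1/suc-zero)))
    zero′ : ∀ x c r → x + c * (r - r) ≡ x
    zero′ = solve-∀ ℚ-ring
    eq : ∀ h r s → (1ℚ + 1ℚ) * (h * h + (1ℚ + 1ℚ) * h + (1ℚ + 1ℚ + 1ℚ + 1ℚ)) * r ≡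
      (1ℚ + 1ℚ) * ((h + r) * (h + r) + (1ℚ + 1ℚ) * (h + r) + (1ℚ + 1ℚ + 1ℚ + 1ℚ)) * s
        + (1ℚ + h * h) * (r * r) + r * s * (1ℚ - r) * (h * h + (1ℚ + 1ℚ + 1ℚ))
        + ((1ℚ + 1ℚ) * (h * h + (1ℚ + 1ℚ) * h + (1ℚ + 1ℚ + 1ℚ + 1ℚ)) - (1ℚ + h * h) * r) * (r - s * (r + 1ℚ))
    eq = solve-∀ ℚ-ring

  tailBound-antimono : ∀ {m n} → m ℕ.≤ n → tailBound n ≤ tailBound m
  tailBound-antimono {m} {n} m≤n = subst (λ t → tailBound t ≤ tailBound m) (ℕₚ.m∸n+n≡m m≤n) (go (n ℕ.∸ m))
    where
    go : ∀ d → tailBound (d ℕ.+ m) ≤ tailBound m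
    go zero    = ℚₚ.≤-refl
    go (suc d) = ℚₚ.≤-trans (≤-by (dominant (d ℕ.+ m)) refl (dominant≥0 (d ℕ.+ m)))
      (ℚₚ.≤-trans (tailBound-step (d ℕ.+ m)) (go d))

  -- With K = j + 1, splitting at about K and K² gives H_n ≤ 3K for some n ≥ K³.
  tailBound-null : ∀ ε → 0ℚ < ε → ∃[ N ] ∀ n → N ℕ.≤ n → tailBound n ≤ ε
  tailBound-null ε 0<ε =
    let j , small = 1/suc-small 38ℚ (ℚₚ.nonNegative⁻¹ 38ℚ) 0<ε
    in N₃ j , λ n N≤n → ℚₚ.≤-trans (tailBound-antimono N≤n) (ℚₚ.≤-trans (bound j) small)
    where
    open ℚₚ.≤-Reasoning
    -- From H ≤ 3K and K ≥ 1: 2(H² + 2H + 4) ≤ 2(9 + 6 + 4)K² = 38K².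
    38ℚ : ℚ
    38ℚ = + 38 / 1
    N₂ N₃ : ℕ → ℕ
    N₂ j = suc j ℕ.* suc j ℕ.+ j
    N₃ j = suc j ℕ.* (suc j ℕ.* suc j) ℕ.+ N₂ j
    ν*1/suc≤1 : ∀ m n → ν m * 1/suc (m ℕ.+ n) ≤ 1ℚ
    ν*1/suc≤1 m n = begin
      ν m * 1/suc (m ℕ.+ n)               ≤⟨ ℚₚ.*-monoʳ-≤-nonNeg (1/suc (m ℕ.+ n)) {{ℚ.nonNegative (0≤1/suc (m ℕ.+ n))}}
                                               (ν-mono (ℕₚ.m≤n⇒m≤1+n (ℕₚ.m≤m+n m n))) ⟩
      ν (suc (m ℕ.+ n)) * 1/suc (m ℕ.+ n) ≡⟨ ℚₚ.*-comm (ν (suc (m ℕ.+ n))) (1/suc (m ℕ.+ n)) ⟩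
      1/suc (m ℕ.+ n) * ν (suc (m ℕ.+ n)) ≡⟨ 1/suc-inverse (m ℕ.+ n) ⟩
      1ℚ                                  ∎
    H₁ : ∀ j → harmonic j ≤ ν (suc j)
    H₁ j = begin
      harmonic j                    ≤⟨ Σ-mono {1/suc} {λ _ → 1ℚ} j (λ i _ → 1/suc≤1 i) ⟩
      Σℚ (λ _ → 1ℚ) j               ≡⟨ Σ-const 1ℚ j ⟩
      ν j * 1ℚ                      ≡⟨ ℚₚ.*-identityʳ (ν j) ⟩
      ν j                           ≤⟨ ν-mono (ℕₚ.n≤1+n j) ⟩
      ν (suc j)                     ∎
    H₂ : ∀ j → harmonic (N₂ j) ≤ ν (suc j) + ν (suc j)
    H₂ j = begin
      harmonic (N₂ j)                                     ≤⟨ harmonic-≤-+ (suc j ℕ.* suc j) j ⟩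
      harmonic j + ν (suc j ℕ.* suc j) * 1/suc j          ≡⟨ cong (λ t → harmonic j + t * 1/suc j) (ν-* (suc j) (suc j)) ⟩
      harmonic j + ν (suc j) * ν (suc j) * 1/suc j        ≡⟨ eq (harmonic j) (ν (suc j)) (1/suc j) ⟩
      harmonic j + ν (suc j) * (1/suc j * ν (suc j))      ≡⟨ cong (λ t → harmonic j + ν (suc j) * t) (1/suc-inverse j) ⟩
      harmonic j + ν (suc j) * 1ℚ                         ≡⟨ cong (λ t → harmonic j + t) (ℚₚ.*-identityʳ (ν (suc j))) ⟩
      harmonic j + ν (suc j)                              ≤⟨ ℚₚ.+-monoˡ-≤ (ν (suc j)) (H₁ j) ⟩
      ν (suc j) + ν (suc j)                               ∎
      where
      eq : ∀ h k r → h + k * k * r ≡ h + k * (r * k)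
      eq = solve-∀ ℚ-ring
    H₃ : ∀ j → harmonic (N₃ j) ≤ ν (suc j) + ν (suc j) + ν (suc j)
    H₃ j = begin
      harmonic (N₃ j)
        ≤⟨ harmonic-≤-+ (suc j ℕ.* (suc j ℕ.* suc j)) (N₂ j) ⟩
      harmonic (N₂ j) + ν (suc j ℕ.* (suc j ℕ.* suc j)) * 1/suc (N₂ j)
        ≡⟨ cong (λ t → harmonic (N₂ j) + t) (trans (cong (_* 1/suc (N₂ j)) (ν-* (suc j) (suc j ℕ.* suc j))) (ℚₚ.*-assoc (ν (suc j)) _ _)) ⟩
      harmonic (N₂ j) + ν (suc j) * (ν (suc j ℕ.* suc j) * 1/suc (N₂ j))
        ≤⟨ ℚₚ.+-mono-≤ (H₂ j) (*-monoˡ-≤ (0≤ν (suc j)) (ν*1/suc≤1 (suc j ℕ.* suc j) j)) ⟩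
      ν (suc j) + ν (suc j) + ν (suc j) * 1ℚ
        ≡⟨ cong (λ t → ν (suc j) + ν (suc j) + t) (ℚₚ.*-identityʳ (ν (suc j))) ⟩
      ν (suc j) + ν (suc j) + ν (suc j) ∎
    bound : ∀ j → tailBound (N₃ j) ≤ 38ℚ * 1/suc j
    bound j = *-cancelˡ-≤ (0<ν-suc j) (begin
      K * (two * (H * H + two * H + (1ℚ + 1ℚ + 1ℚ + 1ℚ)) * s)
        ≤⟨ *-monoˡ-≤ (0≤ν (suc j)) (ℚₚ.*-monoʳ-≤-nonNeg s {{ℚ.nonNegative (0≤1/suc (N₃ j))}} quadratic) ⟩
      K * (38ℚ * (K * K) * s)
        ≡⟨ eq₂ K s ⟩
      38ℚ * (K * (K * K) * s)
        ≡⟨ cong (λ t → 38ℚ * (t * s)) (trans (cong (K *_) (sym (ν-* (suc j) (suc j)))) (sym (ν-* (suc j) (suc j ℕ.* suc j)))) ⟩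
      38ℚ * (ν (suc j ℕ.* (suc j ℕ.* suc j)) * s)
        ≤⟨ *-monoˡ-≤ (ℚₚ.nonNegative⁻¹ 38ℚ) (ν*1/suc≤1 (suc j ℕ.* (suc j ℕ.* suc j)) (N₂ j)) ⟩
      38ℚ * 1ℚ
        ≡⟨ cong (38ℚ *_) (1/suc-inverse j) ⟨
      38ℚ * (1/suc j * K)
        ≡⟨ eq₃ 38ℚ (1/suc j) K ⟩
      K * (38ℚ * 1/suc j) ∎)
      where
      K H s two : ℚ
      K = ν (suc j)
      H = harmonic (N₃ j)
      s = 1/suc (N₃ j)
      two = 1ℚ + 1ℚ
      eq₁ : ∀ K H → 38ℚ * (K * K) ≡ (1ℚ + 1ℚ) * (H * H + (1ℚ + 1ℚ) * H + (1ℚ + 1ℚ + 1ℚ + 1ℚ))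
        + (1ℚ + 1ℚ) * ((K + K + K - H) * (K + K + K + H + (1ℚ + 1ℚ))
          + (1ℚ + 1ℚ) * (K - 1ℚ) * (K + K + K + (1ℚ + 1ℚ) * (K + 1ℚ)))
      eq₁ = solve-∀ ℚ-ring
      eq₂ : ∀ K s → K * (38ℚ * (K * K) * s) ≡ 38ℚ * (K * (K * K) * s)
      eq₂ = solve-∀ ℚ-ring
      eq₃ : ∀ c r K → c * (r * K) ≡ K * (c * r)
      eq₃ = solve-∀ ℚ-ring
      0≤K : 0ℚ ≤ K
      0≤K = 0≤ν (suc j)
      1≤K : 1ℚ ≤ K
      1≤K = subst (_≤ K) ν-one (ν-mono {1} {suc j} (s≤s z≤n))
      0≤2 : 0ℚ ≤ two
      0≤2 = ℚₚ.nonNegative⁻¹ two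
      quadratic : two * (H * H + two * H + (1ℚ + 1ℚ + 1ℚ + 1ℚ)) ≤ 38ℚ * (K * K)
      quadratic = ≤-by _ (eq₁ K H) (0≤-* 0≤2 (0≤-+
        (0≤-* (p≤q⇒0≤q-p (H₃ j)) (0≤-+ (0≤-+ (0≤-+ (0≤-+ 0≤K 0≤K) 0≤K) (harmonic≥0 (N₃ j))) 0≤2))
        (0≤-* (0≤-* 0≤2 (p≤q⇒0≤q-p 1≤K)) (0≤-+ (0≤-+ (0≤-+ 0≤K 0≤K) 0≤K) (0≤-* 0≤2 (0≤-+ 0≤K 0≤1))))))

  -- Euler's relation ζ(1,2) = ζ(3)

  Σ-reverse : ∀ f n → Σℚ (λ i → f (n ℕ.∸ suc i)) n ≡ Σℚ f n
  Σ-reverse f zero    = refl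
  Σ-reverse f (suc n) = trans (Σ-shift (λ i → f (n ℕ.∸ i)) n)
    (trans (cong (λ t → f n + t) (Σ-reverse f n)) (ℚₚ.+-comm (f n) (Σℚ f n)))

  suc+suc-∸ : ∀ {i n} → i ℕ.< n → suc i ℕ.+ suc (n ℕ.∸ suc i) ≡ suc n
  suc+suc-∸ {i} {n} i<n = trans (ℕₚ.+-suc (suc i) (n ℕ.∸ suc i)) (cong suc (ℕₚ.m+[n∸m]≡n i<n))

  -- The sum of 1/(ab) over a + b = n+1. After partial fractions each half is H_n, one of them read
  -- backwards.
  1/suc-convolution : ∀ n → Σℚ (λ i → 1/suc i * 1/suc (n ℕ.∸ suc i)) n ≡
    1/suc n * (harmonic n + harmonic n)
  1/suc-convolution n = begin
    Σℚ (λ i → 1/suc i * 1/suc (n ℕ.∸ suc i)) n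
      ≡⟨ Σ-cong n (λ i i<n → 1/suc-partial-fractions {i} {n ℕ.∸ suc i} {n} (suc+suc-∸ i<n)) ⟩
    Σℚ (λ i → 1/suc n * (1/suc i + 1/suc (n ℕ.∸ suc i))) n
      ≡⟨ Σ-*ˡ (1/suc n) (λ i → 1/suc i + 1/suc (n ℕ.∸ suc i)) n ⟩
    1/suc n * Σℚ (λ i → 1/suc i + 1/suc (n ℕ.∸ suc i)) n
      ≡⟨ cong (1/suc n *_) (trans (Σ-+ 1/suc (λ i → 1/suc (n ℕ.∸ suc i)) n)
           (cong (λ t → harmonic n + t) (Σ-reverse 1/suc n))) ⟩
    1/suc n * (harmonic n + harmonic n) ∎
    where open ≡-Reasoning

  -- The sum of 1/(a²b) over the corner a, b ≤ N, a + b > N of a square. The square is ζ_N(1,2) +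
  -- ζ_N(2,1) + ζ_N(3) by stuffle; the triangle a + b ≤ N is ζ_N(2,1) + 2ζ_N(1,2) by partial
  -- fractions. Their comparison is the origin of `euler-finite`.
  eulerError : ℕ → ℚ
  eulerError N = Σℚ (λ i → (harmonic N - harmonic (N ℕ.∸ suc i)) * (1/suc i * 1/suc i)) N

  -- From N to N+1 the bracket in each old term changes by r - q. With 1/p + 1/q = 1/r, partial
  -- fractions give (r - q)p² = -rpq, so the convolution sum evaluates the total change as -2H r².
  -- The new last term is (H + r)r².
  eulerError-suc : ∀ N → eulerError (suc N) + harmonic N * (1/suc N * 1/suc N) ≡
    eulerError N + 1/suc N * (1/suc N * 1/suc N)
  eulerError-suc N = begin
    Σℚ (λ i → (H + r - harmonic (N ℕ.∸ i)) * (1/suc i * 1/suc i)) N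
      + (H + r - harmonic (N ℕ.∸ N)) * (r * r) + H * (r * r)
      ≡⟨ cong₂ (λ u v → u + (H + r - v) * (r * r) + H * (r * r))
           (Σ-cong N step) (cong harmonic (ℕₚ.n∸n≡0 N)) ⟩
    Σℚ (λ i → old i + (- r) * conv i) N + (H + r - 0ℚ) * (r * r) + H * (r * r)
      ≡⟨ cong (λ t → t + (H + r - 0ℚ) * (r * r) + H * (r * r)) (trans (Σ-+ old (λ i → (- r) * conv i) N)
           (cong (λ t → eulerError N + t) (trans (Σ-*ˡ (- r) conv N) (cong ((- r) *_) (1/suc-convolution N))))) ⟩
    eulerError N + (- r) * (r * (H + H)) + (H + r - 0ℚ) * (r * r) + H * (r * r)
      ≡⟨ eq₁ (eulerError N) r H ⟩
    eulerError N + r * (r * r) ∎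
    where
    open ≡-Reasoning
    H r : ℚ
    H = harmonic N
    r = 1/suc N
    old conv : ℕ → ℚ
    old i  = (H - harmonic (N ℕ.∸ suc i)) * (1/suc i * 1/suc i)
    conv i = 1/suc i * 1/suc (N ℕ.∸ suc i)
    eq₁ : ∀ e r H → e + (- r) * (r * (H + H)) + (H + r - 0ℚ) * (r * r) + H * (r * r) ≡ e + r * (r * r)
    eq₁ = solve-∀ ℚ-ring
    eq₂ : ∀ H r h p q → (H + r - (h + q)) * (p * p) ≡ (H - h) * (p * p) + (r * (p + q) - q * r - q * p) * p
    eq₂ = solve-∀ ℚ-ring
    eq₃ : ∀ a r p q → a + (p * q - q * r - q * p) * p ≡ a + (- r) * (p * q)
    eq₃ = solve-∀ ℚ-ring
    step : ∀ i → i ℕ.< N → (H + r - harmonic (N ℕ.∸ i)) * (1/suc i * 1/suc i) ≡ old i + (- r) * conv i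
    step i i<N = begin
      (H + r - harmonic (N ℕ.∸ i)) * (p * p)
        ≡⟨ cong (λ t → (H + r - harmonic t) * (p * p)) (ℕₚ.+-∸-assoc 1 i<N) ⟩
      (H + r - (harmonic (N ℕ.∸ suc i) + q)) * (p * p)
        ≡⟨ eq₂ H r (harmonic (N ℕ.∸ suc i)) p q ⟩
      old i + (r * (p + q) - q * r - q * p) * p
        ≡⟨ cong (λ t → old i + (t - q * r - q * p) * p) (1/suc-partial-fractions {i} {N ℕ.∸ suc i} {N} (suc+suc-∸ i<N)) ⟨
      old i + (p * q - q * r - q * p) * p
        ≡⟨ eq₃ (old i) r p q ⟩
      old i + (- r) * conv i ∎
      where
      p q : ℚ
      p = 1/suc i
      q = 1/suc (N ℕ.∸ suc i)

  euler-finite : ∀ N → ζ[ 1 ∷ 2 ∷ [] ] N + eulerError N ≡ ζ[ 3 ∷ [] ] N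
  euler-finite zero    = refl
  euler-finite (suc N) = begin
    ζ₁₂ + ζ[ 1 ∷ [] ] N * (r * (r * 1ℚ)) + eulerError (suc N)
      ≡⟨ cong (λ t → ζ₁₂ + t * (r * (r * 1ℚ)) + eulerError (suc N)) (ζ[1]≡harmonic N) ⟩
    ζ₁₂ + harmonic N * (r * (r * 1ℚ)) + eulerError (suc N)
      ≡⟨ eq₁ ζ₁₂ (harmonic N) r (eulerError (suc N)) ⟩
    ζ₁₂ + (eulerError (suc N) + harmonic N * (r * r))
      ≡⟨ cong (λ t → ζ₁₂ + t) (eulerError-suc N) ⟩
    ζ₁₂ + (eulerError N + r * (r * r))
      ≡⟨ eq₂ ζ₁₂ (eulerError N) r ⟩
    ζ₁₂ + eulerError N + 1ℚ * (r * (r * (r * 1ℚ)))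
      ≡⟨ cong (_+ 1ℚ * (r * (r * (r * 1ℚ)))) (euler-finite N) ⟩
    ζ[ 3 ∷ [] ] N + 1ℚ * (r * (r * (r * 1ℚ))) ∎
    where
    open ≡-Reasoning
    r ζ₁₂ : ℚ
    r = 1/suc N
    ζ₁₂ = ζ[ 1 ∷ 2 ∷ [] ] N
    eq₁ : ∀ z h r e → z + h * (r * (r * 1ℚ)) + e ≡ z + (e + h * (r * r))
    eq₁ = solve-∀ ℚ-ring
    eq₂ : ∀ z e r → z + (e + r * (r * r)) ≡ z + e + 1ℚ * (r * (r * (r * 1ℚ)))
    eq₂ = solve-∀ ℚ-ring

  -- H_N - H_b ≤ (i+1)/(b+1) with b = N-i-1 cancels one factor 1/(i+1). What remains is the
  -- convolution sum 2H_N/(N+1), which is below `tailBound`.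
  eulerError-bound : ∀ N → ∣ eulerError N ∣ ≤ tailBound N
  eulerError-bound N = begin
    ∣ eulerError N ∣
      ≤⟨ Σ-abs N term ⟩
    Σℚ (λ i → 1/suc i * 1/suc (N ℕ.∸ suc i)) N
      ≡⟨ 1/suc-convolution N ⟩
    1/suc N * (harmonic N + harmonic N)
      ≤⟨ ≤-by _ (eq (harmonic N) (1/suc N)) (0≤-* (0≤-* 0≤2 (0≤-+ (0≤-+ (square≥0 (harmonic N)) (harmonic≥0 N))
           (ℚₚ.nonNegative⁻¹ (1ℚ + 1ℚ + 1ℚ + 1ℚ)))) (0≤1/suc N)) ⟩
    tailBound N ∎
    where
    open ℚₚ.≤-Reasoning
    0≤2 : 0ℚ ≤ 1ℚ + 1ℚ
    0≤2 = ℚₚ.nonNegative⁻¹ (1ℚ + 1ℚ)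
    eq : ∀ h r → (1ℚ + 1ℚ) * (h * h + (1ℚ + 1ℚ) * h + (1ℚ + 1ℚ + 1ℚ + 1ℚ)) * r ≡
      r * (h + h) + (1ℚ + 1ℚ) * (h * h + h + (1ℚ + 1ℚ + 1ℚ + 1ℚ)) * r
    eq = solve-∀ ℚ-ring
    eq₁ : ∀ n p q → n * q * (p * p) ≡ p * n * (p * q)
    eq₁ = solve-∀ ℚ-ring
    eq₂ : ∀ a b c → b + c ≡ a + (b + c - a)
    eq₂ = solve-∀ ℚ-ring
    eq₃ : ∀ h a c → c ≡ a - h + (h + c - a)
    eq₃ = solve-∀ ℚ-ring
    term : ∀ i → i ℕ.< N →
      ∣ (harmonic N - harmonic (N ℕ.∸ suc i)) * (1/suc i * 1/suc i) ∣ ≤ 1/suc i * 1/suc (N ℕ.∸ suc i)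
    term i i<N = begin
      ∣ d * (p * p) ∣
        ≡⟨ ℚₚ.0≤p⇒∣p∣≡p (0≤-* (p≤q⇒0≤q-p (harmonic-mono (ℕₚ.m∸n≤m N (suc i)))) (square≥0 p)) ⟩
      d * (p * p)
        ≤⟨ ℚₚ.*-monoʳ-≤-nonNeg (p * p) {{ℚ.nonNegative (square≥0 p)}} d≤ ⟩
      ν (suc i) * q * (p * p)
        ≡⟨ eq₁ (ν (suc i)) p q ⟩
      p * ν (suc i) * (p * q)
        ≡⟨ cong (_* (p * q)) (1/suc-inverse i) ⟩
      1ℚ * (p * q)
        ≡⟨ ℚₚ.*-identityˡ (p * q) ⟩
      p * q ∎
      where
      b : ℕ
      b = N ℕ.∸ suc i
      p q d : ℚ
      p = 1/suc i
      q = 1/suc b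
      d = harmonic N - harmonic b
      d≤ : d ≤ ν (suc i) * q
      d≤ = ≤-by _ (eq₃ (harmonic b) (harmonic N) (ν (suc i) * q))
        (p≤q⇒0≤q-p (subst (λ t → harmonic t ≤ harmonic b + ν (suc i) * q) (ℕₚ.m+[n∸m]≡n i<N) (harmonic-≤-+ (suc i) b)))

  -- Convergence of nested sums

  module _ {f : ℕ → ℚ} {N : ℕ} (f≤ : ∀ m → N ℕ.≤ m → f m ≤ dominant m) where
    private
      go : ∀ d → Σℚ f (d ℕ.+ N) ≤ Σℚ f N + (tailBound N - tailBound (d ℕ.+ N))
      go zero    = ℚₚ.≤-reflexive (eq (Σℚ f N) (tailBound N))
        where
        eq : ∀ a b → a ≡ a + (b - b)
        eq = solve-∀ ℚ-ring
      go (suc d) = begin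
        Σℚ f M + f M                                  ≤⟨ ℚₚ.+-mono-≤ (go d) (f≤ M (ℕₚ.m≤n+m N d)) ⟩
        Σℚ f N + (tailBound N - tailBound M) + dominant M
          ≤⟨ ≤-by _ (eq (Σℚ f N) (tailBound N) (tailBound M) (dominant M) (tailBound (suc M))) (p≤q⇒0≤q-p (tailBound-step M)) ⟩
        Σℚ f N + (tailBound N - tailBound (suc M))    ∎
        where
        open ℚₚ.≤-Reasoning
        M : ℕ
        M = d ℕ.+ N
        eq : ∀ a b c e g → a + (b - g) ≡ a + (b - c) + e + (c - (g + e))
        eq = solve-∀ ℚ-ring

    Σ-tail : ∀ {i} → N ℕ.≤ i → Σℚ f i ≤ Σℚ f N + tailBound N
    Σ-tail {i} N≤i = subst (λ t → Σℚ f t ≤ Σℚ f N + tailBound N) (ℕₚ.m∸n+n≡m N≤i)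
      (ℚₚ.≤-trans (go d) (≤-by (tailBound (d ℕ.+ N)) (eq (Σℚ f N) (tailBound N) (tailBound (d ℕ.+ N))) (tailBound≥0 (d ℕ.+ N))))
      where
      d : ℕ
      d = i ℕ.∸ N
      eq : ∀ a b c → a + b ≡ a + (b - c) + c
      eq = solve-∀ ℚ-ring

  Σ-increasing : ∀ {f} → (∀ m → 0ℚ ≤ f m) → ∀ {m n} → m ℕ.≤ n → Σℚ f m ≤ Σℚ f n
  Σ-increasing {f} 0≤f {m} {n} m≤n = subst (λ t → Σℚ f m ≤ Σℚ f t) (ℕₚ.m∸n+n≡m m≤n) (go (n ℕ.∸ m))
    where
    go : ∀ d → Σℚ f m ≤ Σℚ f (d ℕ.+ m)
    go zero    = ℚₚ.≤-refl
    go (suc d) = ℚₚ.≤-trans (go d) (≤-by (f (d ℕ.+ m)) refl (0≤f (d ℕ.+ m)))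

  -- The growth allowed to an inner sum F so that the terms of `nested` F (2 + k) stay below
  -- `dominant`; inner sums of depth at most 2 qualify.
  record Tame (F : ℕ → ℚ) : Set where
    field
      nonneg : ∀ m → 0ℚ ≤ F m
      bound  : ∀ m → F m ≤ 1ℚ + harmonic m * harmonic m

  open Tame

  nested-term≥0 : ∀ (F : ℕ → ℚ) → (∀ m → 0ℚ ≤ F m) → ∀ k m → 0ℚ ≤ F m * recip^ m k
  nested-term≥0 F 0≤F k m = 0≤-* (0≤F m) (recip^≥0 m k)

  abstract
    nested-cauchy : ∀ {F} → Tame F → ∀ k → Cauchy (nested F (2 ℕ.+ k))
    nested-cauchy {F} tame k ε 0<ε =
      let N , small = tailBound-null (½ * ε) (½-pos 0<ε)
          near : ∀ i → N ℕ.≤ i → ∣ S i - S N ∣ ≤ ½ * ε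
          near i N≤i = ≤+⇒∣∣≤ {S i} {S N}
            (ℚₚ.≤-trans (Σ-tail (λ m _ → *-mono-≤ (nonneg tame m) (bound tame m) (recip^≥0 m (2 ℕ.+ k)) (recip^-2+≤ m k)) N≤i)
              (ℚₚ.+-monoʳ-≤ (S N) (small N ℕₚ.≤-refl)))
            (ℚₚ.≤-trans (Σ-increasing (nested-term≥0 F (nonneg tame) (2 ℕ.+ k)) N≤i)
              (≤-by (½ * ε) refl (ℚₚ.<⇒≤ (½-pos 0<ε))))
      in N , λ m n N≤m N≤n → subst (∣ S m - S n ∣ ≤_) (½+½ ε) (∣∣≤-trans {S m} {S N} {S n} (near m N≤m)
        (subst (_≤ ½ * ε) (∣p-q∣≡∣q-p∣ (S n) (S N)) (near n N≤n)))
      where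
      S : ℕ → ℚ
      S = nested F (2 ℕ.+ k)

  nestedLimit : ∀ {F} → Tame F → ℕ → ℝ
  nestedLimit {F} tame k = mkℝ (nested F (2 ℕ.+ k)) (nested-cauchy tame k)

  -- Convergence at a rate o(1/log N), needed to replace ζ_N by its limit in ζ_N H_N.
  Slow : ℝ → Set
  Slow x = ∀ N i → N ℕ.≤ i → ∣ harmonic N * (seq x N - seq x i) ∣ ≤ tailBound N

  -- The factor H_N is moved into the tail: for m ≥ N it is at most H_m, and by hypothesis H_m F(m)
  -- still has the size that `dominant` permits.
  nested-slow : ∀ {F} (tame : Tame F) → (∀ m → harmonic m * F m ≤ 1ℚ + harmonic m * harmonic m) →
    ∀ k → Slow (nestedLimit tame k)
  nested-slow {F} tame HF≤ k N i N≤i = ∣∣≤-intro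
    (ℚₚ.≤-trans (≤-by (H * (S i - S N)) (eq₁ H (S N) (S i))
      (0≤-* (harmonic≥0 N) (p≤q⇒0≤q-p (Σ-increasing (nested-term≥0 F (nonneg tame) (2 ℕ.+ k)) N≤i)))) (tailBound≥0 N))
    (≤-by _ (eq₂ H (S N) (S i) (tailBound N)) (p≤q⇒0≤q-p
      (subst₂ (λ u v → u ≤ v + tailBound N) (Σ-*ˡ H _ i) (Σ-*ˡ H _ N) (Σ-tail term N≤i))))
    where
    H : ℚ
    H = harmonic N
    S : ℕ → ℚ
    S = nested F (2 ℕ.+ k)
    eq₁ : ∀ h a b → 0ℚ ≡ h * (a - b) + h * (b - a)
    eq₁ = solve-∀ ℚ-ring
    eq₂ : ∀ h a b t → t ≡ - (h * (a - b)) + (h * a + t - h * b)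
    eq₂ = solve-∀ ℚ-ring
    term : ∀ m → N ℕ.≤ m → H * (F m * recip^ m (2 ℕ.+ k)) ≤ dominant m
    term m N≤m = subst (_≤ dominant m) (ℚₚ.*-assoc H (F m) _)
      (*-mono-≤ (0≤-* (harmonic≥0 N) (nonneg tame m))
        (ℚₚ.≤-trans (ℚₚ.*-monoʳ-≤-nonNeg (F m) {{ℚ.nonNegative (nonneg tame m)}} (harmonic-mono N≤m)) (HF≤ m))
        (recip^≥0 m (2 ℕ.+ k)) (recip^-2+≤ m k))

  nested-≤-harmonic : ∀ {F c} n k → (∀ m → 0ℚ ≤ F m) → (∀ m → m ℕ.< n → F m ≤ c) →
    nested F (suc k) n ≤ c * harmonic n
  nested-≤-harmonic {F} {c} n k 0≤F F≤c = ℚₚ.≤-trans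
    (Σ-mono {g = λ m → c * 1/suc m} n λ m m<n → *-mono-≤ (0≤F m) (F≤c m m<n) (recip^≥0 m (suc k)) (recip^-suc≤ m k))
    (ℚₚ.≤-reflexive (Σ-*ˡ c 1/suc n))

  ζ₁≥0 : ∀ a m → 0ℚ ≤ ζ[ a ∷ [] ] m
  ζ₁≥0 a m = Σ≥0 m (nested-term≥0 (λ _ → 1ℚ) (λ _ → 0≤1) a)

  ζ₁≤harmonic : ∀ a m → ζ[ suc a ∷ [] ] m ≤ harmonic m
  ζ₁≤harmonic a m = subst (ζ[ suc a ∷ [] ] m ≤_) (ℚₚ.*-identityˡ (harmonic m))
    (nested-≤-harmonic m a (λ _ → 0≤1) (λ _ _ → ℚₚ.≤-refl))

  ζ₂≥0 : ∀ a b m → 0ℚ ≤ ζ[ a ∷ b ∷ [] ] m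
  ζ₂≥0 a b m = Σ≥0 m (nested-term≥0 ζ[ a ∷ [] ] (ζ₁≥0 a) b)

  ζ₂≤harmonic² : ∀ a b m → ζ[ suc a ∷ suc b ∷ [] ] m ≤ harmonic m * harmonic m
  ζ₂≤harmonic² a b m = nested-≤-harmonic m b (ζ₁≥0 (suc a))
    (λ i i<m → ℚₚ.≤-trans (ζ₁≤harmonic a i) (harmonic-mono (ℕₚ.<⇒≤ i<m)))

  private
    h²≤ : ∀ h → h * h ≤ 1ℚ + h * h
    h²≤ h = ≤-by 1ℚ (ℚₚ.+-comm 1ℚ (h * h)) 0≤1

    h≤ : ∀ {h} → 0ℚ ≤ h → h ≤ 1ℚ + h * h
    h≤ {h} 0≤h = ≤-by _ (eq h) (0≤-+ (square≥0 (1ℚ - h)) 0≤h)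
      where
      eq : ∀ h → 1ℚ + h * h ≡ h + ((1ℚ - h) * (1ℚ - h) + h)
      eq = solve-∀ ℚ-ring

  tame₀ : Tame (λ _ → 1ℚ)
  tame₀ = record { nonneg = λ _ → 0≤1 ; bound = λ m → ≤-by _ refl (square≥0 (harmonic m)) }

  tame₁ : ∀ a → Tame ζ[ suc a ∷ [] ]
  tame₁ a = record
    { nonneg = ζ₁≥0 (suc a)
    ; bound  = λ m → ℚₚ.≤-trans (ζ₁≤harmonic a m) (h≤ (harmonic≥0 m))
    }

  tame₂ : ∀ a b → Tame ζ[ suc a ∷ suc b ∷ [] ]
  tame₂ a b = record
    { nonneg = ζ₂≥0 (suc a) (suc b)
    ; bound  = λ m → ℚₚ.≤-trans (ζ₂≤harmonic² a b m) (h²≤ (harmonic m))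
    }

  -- The indices are shifted: these are ζ(2 + k), ζ(1 + a, 2 + k) and ζ(1 + a, 1 + b, 2 + k).

  ζ₁ : ℕ → ℝ
  ζ₁ = nestedLimit tame₀

  ζ₂ : ℕ → ℕ → ℝ
  ζ₂ a = nestedLimit (tame₁ a)

  ζ₃ : ℕ → ℕ → ℕ → ℝ
  ζ₃ a b = nestedLimit (tame₂ a b)

  ζ₁-slow : ∀ k → Slow (ζ₁ k)
  ζ₁-slow = nested-slow tame₀ λ m →
    subst (_≤ 1ℚ + harmonic m * harmonic m) (sym (ℚₚ.*-identityʳ (harmonic m))) (h≤ (harmonic≥0 m))

  ζ₂-slow : ∀ a k → Slow (ζ₂ a k)
  ζ₂-slow a = nested-slow (tame₁ a) λ m →
    ℚₚ.≤-trans (*-monoˡ-≤ (harmonic≥0 m) (ζ₁≤harmonic a m)) (h²≤ (harmonic m))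

  2≤2+ : ∀ k → 2 ℕ.≤ 2 ℕ.+ k
  2≤2+ k = s≤s (s≤s z≤n)

  ζ₁∈𝒵 : ∀ k → 𝒵 (ζ₁ k)
  ζ₁∈𝒵 k = mzv {[]} {2 ℕ.+ k} [] (2≤2+ k) (Lim⇒⟶ {λ N → ℚ→ℝ (ζ[ 2 ℕ.+ k ∷ [] ] N)} {ζ₁ k} (lim-ℚ (ζ₁ k)))

  ζ₂∈𝒵 : ∀ a k → 𝒵 (ζ₂ a k)
  ζ₂∈𝒵 a k = mzv {suc a ∷ []} {2 ℕ.+ k} (s≤s z≤n ∷ []) (2≤2+ k)
    (Lim⇒⟶ {λ N → ℚ→ℝ (ζ[ suc a ∷ 2 ℕ.+ k ∷ [] ] N)} {ζ₂ a k} (lim-ℚ (ζ₂ a k)))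

  ζ₃∈𝒵 : ∀ a b k → 𝒵 (ζ₃ a b k)
  ζ₃∈𝒵 a b k = mzv {suc a ∷ suc b ∷ []} {2 ℕ.+ k} (s≤s z≤n ∷ s≤s z≤n ∷ []) (2≤2+ k)
    (Lim⇒⟶ {λ N → ℚ→ℝ (ζ[ suc a ∷ suc b ∷ 2 ℕ.+ k ∷ [] ] N)} {ζ₃ a b k} (lim-ℚ (ζ₃ a b k)))

  -- At each index the two representing sequences differ by exactly `eulerError`.
  euler : ζ₂ 0 0 ≈ʳ ζ₁ 1
  euler ε 0<ε = let N , small = tailBound-null ε 0<ε in N , λ n N≤n → begin
    ∣ ζ[ 1 ∷ 2 ∷ [] ] n - ζ[ 3 ∷ [] ] n ∣                            ≡⟨ ∣p-q∣≡∣q-p∣ (ζ[ 1 ∷ 2 ∷ [] ] n) (ζ[ 3 ∷ [] ] n) ⟩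
    ∣ ζ[ 3 ∷ [] ] n - ζ[ 1 ∷ 2 ∷ [] ] n ∣                            ≡⟨ cong (λ t → ∣ t - ζ[ 1 ∷ 2 ∷ [] ] n ∣) (euler-finite n) ⟨
    ∣ ζ[ 1 ∷ 2 ∷ [] ] n + eulerError n - ζ[ 1 ∷ 2 ∷ [] ] n ∣         ≡⟨ cong ∣_∣ (eq (ζ[ 1 ∷ 2 ∷ [] ] n) (eulerError n)) ⟩
    ∣ eulerError n ∣                                                  ≤⟨ eulerError-bound n ⟩
    tailBound n                                                       ≤⟨ small n N≤n ⟩
    ε                                                                 ∎
    where
    open ℚₚ.≤-Reasoning
    eq : ∀ z e → z + e - z ≡ e
    eq = solve-∀ ℚ-ring

  -- Harmonic regularization

  evalℚ : List ℚ → ℚ → ℚ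
  evalℚ qs h = foldr (λ q v → q + h * v) 0ℚ qs

  seq-eval-rational : ∀ qs h i → seq (eval (map ℚ→ℝ qs) (ℚ→ℝ h)) i ≡ evalℚ qs h
  seq-eval-rational []       h i = refl
  seq-eval-rational (q ∷ qs) h i = cong (λ t → q + h * t) (seq-eval-rational qs h i)

  rationals∈𝒵 : ∀ qs → All 𝒵 (map ℚ→ℝ qs)
  rationals∈𝒵 []       = []
  rationals∈𝒵 (q ∷ qs) = rational q ∷ rationals∈𝒵 qs

  -- The identity is exact with the coefficients truncated at N. Passing to their limits costs c₀(N)
  -- - c₀, which is null by the Cauchy property, and H_N (c₁(N) - c₁), which is null by slowness.
  -- The higher coefficients are rational constants and contribute no error.
  regularizes-intro : ∀ ks c₀ c₁ qs → 𝒵 c₀ → 𝒵 c₁ → Slow c₁ →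
    (∀ N → ζ[ ks ] N ≡ seq c₀ N + harmonic N * (seq c₁ N + harmonic N * evalℚ qs (harmonic N))) →
    Regularizes ks (c₀ ∷ c₁ ∷ map ℚ→ℝ qs)
  regularizes-intro ks c₀ c₁ qs c₀∈𝒵 c₁∈𝒵 slow ζ≡ = record
    { coefficients = c₀∈𝒵 ∷ c₁∈𝒵 ∷ rationals∈𝒵 qs
    ; asymptotic   = Lim⇒⟶ {λ N → ℚ→ℝ (ζ[ ks ] N) -ʳ eval (c₀ ∷ c₁ ∷ map ℚ→ℝ qs) (ℚ→ℝ (harmonic N))} {0ʳ} lim
    }
    where
    open ℚₚ.≤-Reasoning
    eq : ∀ a b H c d e → a + H * (c + H * e) - (b + H * (d + H * e)) - 0ℚ ≡ a - b + H * (c - d)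
    eq = solve-∀ ℚ-ring
    lim : Lim (λ N → ℚ→ℝ (ζ[ ks ] N) -ʳ eval (c₀ ∷ c₁ ∷ map ℚ→ℝ qs) (ℚ→ℝ (harmonic N))) 0ʳ
    lim ε 0<ε =
      let M , small = tailBound-null (½ * ε) (½-pos 0<ε)
          N₀ , near = cauchy c₀ (½ * ε) (½-pos 0<ε)
      in M ℕ.⊔ N₀ , λ N l → N , λ i N≤i →
      let H = harmonic N
          N₀≤N = ℕₚ.m⊔n≤o⇒n≤o M N₀ l
      in begin
      ∣ ζ[ ks ] N - (seq c₀ i + H * (seq c₁ i + H * seq (eval (map ℚ→ℝ qs) (ℚ→ℝ H)) i)) - 0ℚ ∣
        ≡⟨ cong₂ (λ u v → ∣ u - (seq c₀ i + H * (seq c₁ i + H * v)) - 0ℚ ∣) (ζ≡ N) (seq-eval-rational qs H i) ⟩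
      ∣ seq c₀ N + H * (seq c₁ N + H * evalℚ qs H) - (seq c₀ i + H * (seq c₁ i + H * evalℚ qs H)) - 0ℚ ∣
        ≡⟨ cong ∣_∣ (eq (seq c₀ N) (seq c₀ i) H (seq c₁ N) (seq c₁ i) (evalℚ qs H)) ⟩
      ∣ seq c₀ N - seq c₀ i + H * (seq c₁ N - seq c₁ i) ∣
        ≤⟨ ∣∣≤-+ {seq c₀ N - seq c₀ i} {H * (seq c₁ N - seq c₁ i)}
             (near N i N₀≤N (ℕₚ.≤-trans N₀≤N N≤i))
             (ℚₚ.≤-trans (slow N i N≤i) (small N (ℕₚ.m⊔n≤o⇒m≤o M N₀ l))) ⟩
      ½ * ε + ½ * ε
        ≡⟨ ½+½ ε ⟩
      ε ∎

  -- Uniqueness of the regularizing polynomial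

  infixl 6 _-ₚ_
  _-ₚ_ : Poly → Poly → Poly
  []      -ₚ []      = []
  []      -ₚ (d ∷ Q) = (0ʳ -ʳ d) ∷ ([] -ₚ Q)
  (c ∷ P) -ₚ []      = (c -ʳ 0ʳ) ∷ (P -ₚ [])
  (c ∷ P) -ₚ (d ∷ Q) = (c -ʳ d) ∷ (P -ₚ Q)

  seq-eval-difference : ∀ P Q Y i → seq (eval (P -ₚ Q) Y) i ≡ seq (eval P Y) i - seq (eval Q Y) i
  seq-eval-difference []      []      Y i = refl
  seq-eval-difference []      (d ∷ Q) Y i = trans (cong (λ t → 0ℚ - seq d i + seq Y i * t) (seq-eval-difference [] Q Y i))
    (eq (seq d i) (seq Y i) (seq (eval Q Y) i))
    where
    eq : ∀ d y q → 0ℚ - d + y * (0ℚ - q) ≡ 0ℚ - (d + y * q)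
    eq = solve-∀ ℚ-ring
  seq-eval-difference (c ∷ P) []      Y i = trans (cong (λ t → seq c i - 0ℚ + seq Y i * t) (seq-eval-difference P [] Y i))
    (eq (seq c i) (seq Y i) (seq (eval P Y) i))
    where
    eq : ∀ c y p → c - 0ℚ + y * (p - 0ℚ) ≡ c + y * p - 0ℚ
    eq = solve-∀ ℚ-ring
  seq-eval-difference (c ∷ P) (d ∷ Q) Y i = trans (cong (λ t → seq c i - seq d i + seq Y i * t) (seq-eval-difference P Q Y i))
    (eq (seq c i) (seq d i) (seq Y i) (seq (eval P Y) i) (seq (eval Q Y) i))
    where
    eq : ∀ c d y p q → c - d + y * (p - q) ≡ c + y * p - (d + y * q)
    eq = solve-∀ ℚ-ring

  seq-coeff-difference : ∀ P Q j i → seq (coeff (P -ₚ Q) j) i ≡ seq (coeff P j) i - seq (coeff Q j) i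
  seq-coeff-difference []      []      j       i = refl
  seq-coeff-difference []      (d ∷ Q) zero    i = refl
  seq-coeff-difference []      (d ∷ Q) (suc j) i = seq-coeff-difference [] Q j i
  seq-coeff-difference (c ∷ P) []      zero    i = refl
  seq-coeff-difference (c ∷ P) []      (suc j) i = seq-coeff-difference P [] j i
  seq-coeff-difference (c ∷ P) (d ∷ Q) zero    i = refl
  seq-coeff-difference (c ∷ P) (d ∷ Q) (suc j) i = seq-coeff-difference P Q j i

  eval-≈0 : ∀ R Y → (∀ j → coeff R j ≈ʳ 0ʳ) → eval R Y ≈ʳ 0ʳ
  eval-≈0 []      Y R≈0 = ≈ʳ-refl {0ʳ}
  eval-≈0 (c ∷ R) Y R≈0 = ≈ʳ-trans {c +ʳ Y *ʳ eval R Y} {0ʳ +ʳ Y *ʳ 0ʳ} {0ʳ}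
    (+ʳ-cong {c} {0ʳ} {Y *ʳ eval R Y} {Y *ʳ 0ʳ} (R≈0 0)
      (*ʳ-cong {Y} {Y} {eval R Y} {0ʳ} (≈ʳ-refl {Y}) (eval-≈0 R Y (R≈0 ∘ suc))))
    (≈ʳ-pointwise {0ʳ +ʳ Y *ʳ 0ʳ} {0ʳ} λ i → eq (seq Y i))
    where
    eq : ∀ y → 0ℚ + y * 0ℚ ≡ 0ℚ
    eq = solve-∀ ℚ-ring

  -- If c + H_N V_N is bounded then V_N → 0, since H_N → ∞.
  tail-vanishes : ∀ c (V : ℕ → ℝ) → Lim (λ N → c +ʳ ℚ→ℝ (harmonic N) *ʳ V N) 0ʳ → Lim V 0ʳ
  tail-vanishes c V lim ε 0<ε =
    let B , 0≤B , I₀ , c≤B = ℝ-bounded c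
        j , small = 1/suc-small (1ℚ + B) (0≤-+ 0≤1 0≤B) 0<ε
        N₀ , large = harmonic-unbounded (ν (suc j))
        N₁ , f = lim 1ℚ (ℚₚ.positive⁻¹ 1ℚ)
    in N₀ ℕ.⊔ N₁ , λ N l →
    let I , g = f N (ℕₚ.m⊔n≤o⇒n≤o N₀ N₁ l)
        H = harmonic N
    in I ℕ.⊔ I₀ , λ i l′ →
    let v = seq (V N) i
        cᵢ = seq c i
        ∣Hv∣≤1+B : ∣ H * v ∣ ≤ 1ℚ + B
        ∣Hv∣≤1+B = subst (λ t → ∣ t ∣ ≤ 1ℚ + B) (eq₁ cᵢ (H * v))
          (∣∣≤-+ {cᵢ + H * v - 0ℚ} { - cᵢ} (g i (ℕₚ.m⊔n≤o⇒m≤o I I₀ l′))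
            (subst (_≤ B) (sym (ℚₚ.∣-p∣≡∣p∣ cᵢ)) (c≤B i (ℕₚ.m⊔n≤o⇒n≤o I I₀ l′))))
    in *-cancelˡ-≤ (0<ν-suc j) (begin
    ν (suc j) * ∣ v - 0ℚ ∣    ≡⟨ cong (λ t → ν (suc j) * ∣ t ∣) (eq₂ v) ⟩
    ν (suc j) * ∣ v ∣         ≤⟨ ℚₚ.*-monoʳ-≤-nonNeg ∣ v ∣ {{ℚ.nonNegative (ℚₚ.0≤∣p∣ v)}} (large N (ℕₚ.m⊔n≤o⇒m≤o N₀ N₁ l)) ⟩
    H * ∣ v ∣                 ≡⟨ cong (_* ∣ v ∣) (ℚₚ.0≤p⇒∣p∣≡p (harmonic≥0 N)) ⟨
    ∣ H ∣ * ∣ v ∣             ≡⟨ ℚₚ.∣p*q∣≡∣p∣*∣q∣ H v ⟨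
    ∣ H * v ∣                 ≤⟨ ∣Hv∣≤1+B ⟩
    1ℚ + B                    ≡⟨ ℚₚ.*-identityʳ (1ℚ + B) ⟨
    (1ℚ + B) * 1ℚ             ≡⟨ cong ((1ℚ + B) *_) (1/suc-inverse j) ⟨
    (1ℚ + B) * (1/suc j * ν (suc j)) ≡⟨ eq₃ (1ℚ + B) (1/suc j) (ν (suc j)) ⟩
    ν (suc j) * ((1ℚ + B) * 1/suc j) ≤⟨ *-monoˡ-≤ (0≤ν (suc j)) small ⟩
    ν (suc j) * ε             ∎)
    where
    open ℚₚ.≤-Reasoning
    eq₁ : ∀ c x → c + x - 0ℚ + - c ≡ x
    eq₁ = solve-∀ ℚ-ring
    eq₂ : ∀ v → v - 0ℚ ≡ v
    eq₂ = solve-∀ ℚ-ring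
    eq₃ : ∀ b r n → b * (r * n) ≡ n * (b * r)
    eq₃ = solve-∀ ℚ-ring

  -- In Horner form the value is c + H_N V_N. First V_N → 0, so by induction all coefficients of V
  -- vanish; then V_N itself is 0 and the constant c is left as a null sequence.
  vanishing-polynomial : ∀ R → Lim (λ N → eval R (ℚ→ℝ (harmonic N))) 0ʳ → ∀ j → coeff R j ≈ʳ 0ʳ
  vanishing-polynomial []      lim = λ _ → ≈ʳ-refl {0ʳ}
  vanishing-polynomial (c ∷ R) lim = λ { zero → c≈0 ; (suc j) → R≈0 j }
    where
    Y V : ℕ → ℝ
    Y N = ℚ→ℝ (harmonic N)
    V N = eval R (Y N)
    R≈0 : ∀ j → coeff R j ≈ʳ 0ʳ
    R≈0 = vanishing-polynomial R (tail-vanishes c V lim)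
    eq : ∀ c y → c + y * 0ℚ ≡ c
    eq = solve-∀ ℚ-ring
    c≈0 : c ≈ʳ 0ʳ
    c≈0 = lim-const⁻¹ {c} {0ʳ} (lim-respˡ {λ N → c +ʳ Y N *ʳ V N} {λ _ → c} {0ʳ}
      (λ N → ≈ʳ-trans {c +ʳ Y N *ʳ V N} {c +ʳ Y N *ʳ 0ʳ} {c}
        (+ʳ-cong {c} {c} {Y N *ʳ V N} {Y N *ʳ 0ʳ} (≈ʳ-refl {c})
          (*ʳ-cong {Y N} {Y N} {V N} {0ʳ} (≈ʳ-refl {Y N}) (eval-≈0 R (Y N) R≈0)))
        (≈ʳ-pointwise {c +ʳ Y N *ʳ 0ʳ} {c} λ i → eq (seq c i) (harmonic N)))
      lim)

  -- ζ_N cancels in the difference of the two asymptotic relations, leaving (Q - P)(H_N) → 0.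
  regularizes-unique : ∀ {ks P Q} → Regularizes ks P → Regularizes ks Q → Q ≈ₚ P
  regularizes-unique {ks} {P} {Q} p q j = λ ε 0<ε →
    let N , f = vanishing-polynomial (Q -ₚ P) lim j ε 0<ε
    in N , λ n N≤n → subst (λ t → ∣ t ∣ ≤ ε)
      (trans (cong (_- 0ℚ) (seq-coeff-difference Q P j n)) (eq₁ (seq (coeff Q j) n) (seq (coeff P j) n))) (f n N≤n)
    where
    eq₁ : ∀ a b → a - b - 0ℚ ≡ a - b
    eq₁ = solve-∀ ℚ-ring
    eq₂ : ∀ z p q → z - p + - (z - q) ≡ q - p
    eq₂ = solve-∀ ℚ-ring
    Y : ℕ → ℝ
    Y N = ℚ→ℝ (harmonic N)
    error : Poly → ℕ → ℝ
    error R N = ℚ→ℝ (ζ[ ks ] N) -ʳ eval R (Y N)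
    null : ∀ {R} → Regularizes ks R → Lim (error R) 0ʳ
    null {R} r = ⟶⇒Lim {error R} {0ʳ} (Regularizes.asymptotic r)
    lim : Lim (λ N → eval (Q -ₚ P) (Y N)) 0ʳ
    lim = lim-respˡ {λ N → error P N -ʳ error Q N} {λ N → eval (Q -ₚ P) (Y N)} {0ʳ}
      (λ N → ≈ʳ-pointwise {error P N -ʳ error Q N} {eval (Q -ₚ P) (Y N)} λ i →
        trans (eq₂ (ζ[ ks ] N) (seq (eval P (Y N)) i) (seq (eval Q (Y N)) i)) (sym (seq-eval-difference Q P (Y N) i)))
      (lim-respʳ {λ N → error P N -ʳ error Q N} {0ʳ -ʳ 0ʳ} {0ʳ} (≈ʳ-pointwise {0ʳ -ʳ 0ʳ} {0ʳ} λ _ → refl)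
        (lim-+ {error P} {λ N → -ʳ error Q N} {0ʳ} { -ʳ 0ʳ} (null p) (lim-neg {error Q} {0ʳ} (null q))))

  ζ*-intro : ∀ {ks c P} → Regularizes ks (c ∷ P) → ζ*⟨ ks ⟩≡ c
  ζ*-intro {c = c} {P} r = record
    { ζ*Y = c ∷ P ; regularizes = r ; unique = λ Q q → regularizes-unique r q ; constantTerm = ≈ʳ-refl {c} }

  -- Complex numbers

  ≈ᶜ-pointwise : ∀ {z w} → (∀ i → seq (re z) i ≡ seq (re w) i) → (∀ i → seq (im z) i ≡ seq (im w) i) → z ≈ᶜ w
  ≈ᶜ-pointwise {z} {w} p q = ≈ʳ-pointwise {re z} {re w} p , ≈ʳ-pointwise {im z} {im w} q

  ≈ᶜ-refl : ∀ {z} → z ≈ᶜ z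
  ≈ᶜ-refl {z} = ≈ʳ-refl {re z} , ≈ʳ-refl {im z}

  ≈ᶜ-sym : ∀ {z w} → z ≈ᶜ w → w ≈ᶜ z
  ≈ᶜ-sym {z} {w} (p , q) = ≈ʳ-sym {re z} {re w} p , ≈ʳ-sym {im z} {im w} q

  ≈ᶜ-trans : ∀ {u v w} → u ≈ᶜ v → v ≈ᶜ w → u ≈ᶜ w
  ≈ᶜ-trans {u} {v} {w} (p , q) (p′ , q′) =
    ≈ʳ-trans {re u} {re v} {re w} p p′ , ≈ʳ-trans {im u} {im v} {im w} q q′

  +ᶜ-cong : ∀ {z z′ w w′} → z ≈ᶜ z′ → w ≈ᶜ w′ → z +ᶜ w ≈ᶜ z′ +ᶜ w′
  +ᶜ-cong {z} {z′} {w} {w′} (p , q) (p′ , q′) =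
    +ʳ-cong {re z} {re z′} {re w} {re w′} p p′ , +ʳ-cong {im z} {im z′} {im w} {im w′} q q′

  *ᶜ-cong : ∀ {z z′ w w′} → z ≈ᶜ z′ → w ≈ᶜ w′ → z *ᶜ w ≈ᶜ z′ *ᶜ w′
  *ᶜ-cong {z} {z′} {w} {w′} (p , q) (p′ , q′) =
      +ʳ-cong {re z *ʳ re w} {re z′ *ʳ re w′} { -ʳ (im z *ʳ im w)} { -ʳ (im z′ *ʳ im w′)}
        (*ʳ-cong {re z} {re z′} {re w} {re w′} p p′)
        (-ʳ-cong {im z *ʳ im w} {im z′ *ʳ im w′} (*ʳ-cong {im z} {im z′} {im w} {im w′} q q′))
    , +ʳ-cong {re z *ʳ im w} {re z′ *ʳ im w′} {im z *ʳ re w} {im z′ *ʳ re w′}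
        (*ʳ-cong {re z} {re z′} {im w} {im w′} p q′) (*ʳ-cong {im z} {im z′} {re w} {re w′} q p′)

  ∣∣²-real : ∀ {z x} → z ≈ᶜ ℝ→ℂ x → ∣ z ∣² ≈ʳ x *ʳ x
  ∣∣²-real {z} {x} (p , q) = ≈ʳ-trans {∣ z ∣²} {x *ʳ x +ʳ 0ʳ *ʳ 0ʳ} {x *ʳ x}
    (+ʳ-cong {re z *ʳ re z} {x *ʳ x} {im z *ʳ im z} {0ʳ *ʳ 0ʳ}
      (*ʳ-cong {re z} {x} {re z} {x} p p) (*ʳ-cong {im z} {0ʳ} {im z} {0ʳ} q q))
    (≈ʳ-pointwise {x *ʳ x +ʳ 0ʳ *ʳ 0ʳ} {x *ʳ x} λ i → ℚₚ.+-identityʳ (seq x i * seq x i))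

  ^2-real : ∀ {z x} → z ≈ᶜ ℝ→ℂ x → z ^ᶜ 2 ≈ᶜ ℝ→ℂ (x *ʳ x)
  ^2-real {z} {x} z≈x = ≈ᶜ-trans {z ^ᶜ 2} {ℝ→ℂ x ^ᶜ 2} {ℝ→ℂ (x *ʳ x)}
    (*ᶜ-cong {z} {ℝ→ℂ x} {z *ᶜ 1ᶜ} {ℝ→ℂ x *ᶜ 1ᶜ} z≈x (*ᶜ-cong {z} {ℝ→ℂ x} {1ᶜ} {1ᶜ} z≈x (≈ᶜ-refl {1ᶜ})))
    (≈ᶜ-pointwise {ℝ→ℂ x ^ᶜ 2} {ℝ→ℂ (x *ʳ x)} (λ i → eq₁ (seq x i)) (λ i → eq₂ (seq x i)))
    where
    eq₁ : ∀ x → x * (x * 1ℚ - 0ℚ * 0ℚ) - 0ℚ * (x * 0ℚ + 0ℚ * 1ℚ) ≡ x * x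
    eq₁ = solve-∀ ℚ-ring
    eq₂ : ∀ x → x * (x * 0ℚ + 0ℚ * 1ℚ) + 0ℚ * (x * 1ℚ - 0ℚ * 0ℚ) ≡ 0ℚ
    eq₂ = solve-∀ ℚ-ring

  HasSum-resp : ∀ {f z w} → z ≈ᶜ w → HasSum f z → HasSum f w
  HasSum-resp {f} {z} {w} (p , q) (r , s) =
      Lim⇒⟶ {λ n → re (S n)} {re w} (lim-respʳ {λ n → re (S n)} {re z} {re w} p (⟶⇒Lim {λ n → re (S n)} {re z} r))
    , Lim⇒⟶ {λ n → im (S n)} {im w} (lim-respʳ {λ n → im (S n)} {im z} {im w} q (⟶⇒Lim {λ n → im (S n)} {im z} s))
    where
    S : ℕ → ℂ
    S = sum _+ᶜ_ 0ᶜ f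

  -- A complex number whose imaginary part is represented by the zero sequence.
  Real : ℂ → Set
  Real z = ∀ i → seq (im z) i ≡ 0ℚ

  ^ᶜ-real : ∀ {z} → Real z → ∀ n i → seq (re (z ^ᶜ n)) i ≡ seq (re z ^ʳ n) i × seq (im (z ^ᶜ n)) i ≡ 0ℚ
  ^ᶜ-real         z-real zero    i = refl , refl
  ^ᶜ-real {z} z-real (suc n) i with ^ᶜ-real {z} z-real n i
  ... | p , q =
      trans (cong₂ (λ u v → seq (re z) i * u - v * seq (im (z ^ᶜ n)) i) p (z-real i)) (eq₁ _ (seq (im (z ^ᶜ n)) i))
    , trans (cong₂ (λ u v → seq (re z) i * u + v * seq (re (z ^ᶜ n)) i) q (z-real i)) (eq₂ (seq (re z) i) (seq (re (z ^ᶜ n)) i))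
    where
    eq₁ : ∀ a b → a - 0ℚ * b ≡ a
    eq₁ = solve-∀ ℚ-ring
    eq₂ : ∀ a b → a * 0ℚ + 0ℚ * b ≡ 0ℚ
    eq₂ = solve-∀ ℚ-ring

  expSumᶜ : ℂ → ℕ → ℂ
  expSumᶜ z = sum _+ᶜ_ 0ᶜ λ j → ℚ→ℂ (1/ j !) *ᶜ z ^ᶜ j

  expSumᶜ-real : ∀ {z} → Real z → ∀ n i →
    seq (re (expSumᶜ z n)) i ≡ seq (expSumʳ (re z) n) i × seq (im (expSumᶜ z n)) i ≡ 0ℚ
  expSumᶜ-real {z} z-real zero    i = refl , refl
  expSumᶜ-real {z} z-real (suc n) i with expSumᶜ-real {z} z-real n i | ^ᶜ-real {z} z-real n i
  ... | p , q | p′ , q′ =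
      cong₂ _+_ p (trans (cong (λ t → 1/ n ! * t - 0ℚ * seq (im (z ^ᶜ n)) i) p′) (eq₁ _ (seq (im (z ^ᶜ n)) i)))
    , trans (cong₂ (λ u v → u + (1/ n ! * v + 0ℚ * seq (re (z ^ᶜ n)) i)) q q′) (eq₂ (1/ n !) (seq (re (z ^ᶜ n)) i))
    where
    eq₁ : ∀ a b → a - 0ℚ * b ≡ a
    eq₁ = solve-∀ ℚ-ring
    eq₂ : ∀ a b → 0ℚ + (a * 0ℚ + 0ℚ * b) ≡ 0ℚ
    eq₂ = solve-∀ ℚ-ring

  IsExp⇒Expʳ : ∀ {z e} → Real z → IsExp z e → Expʳ (re z) (re e) × im e ≈ʳ 0ʳ
  IsExp⇒Expʳ {z} {e} z-real (p , q) =
      lim-respˡ {λ n → re (expSumᶜ z n)} {expSumʳ (re z)} {re e}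
        (λ n → ≈ʳ-pointwise {re (expSumᶜ z n)} {expSumʳ (re z) n} λ i → proj₁ (expSumᶜ-real {z} z-real n i))
        (⟶⇒Lim {λ n → re (expSumᶜ z n)} {re e} p)
    , ≈ʳ-sym {0ʳ} {im e} (lim-const⁻¹ {0ʳ} {im e} (lim-respˡ {λ n → im (expSumᶜ z n)} {λ _ → 0ʳ} {im e}
        (λ n → ≈ʳ-pointwise {im (expSumᶜ z n)} {0ʳ} λ i → proj₂ (expSumᶜ-real {z} z-real n i))
        (⟶⇒Lim {λ n → im (expSumᶜ z n)} {im e} q)))

  -- Powers with negative integer exponents and the values ζ(k)

  record IsNatural (k : ℕ) (s : ℂ) : Set where
    field
      re≡ : ∀ i → seq (re s) i ≡ ν k
      im≡ : Real s

  open IsNatural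

  ℕ→ℂ-natural : ∀ k → IsNatural k (ℕ→ℂ k)
  ℕ→ℂ-natural k = record { re≡ = λ _ → ν-def k ; im≡ = λ _ → refl }

  -- C₊(k-1) evaluates ζ at 1 + (k - 1), a term different from `ℕ→ℂ` k; `IsNatural` treats both
  -- alike.
  1+[k-1]-natural : ∀ k → IsNatural k (1ᶜ +ᶜ (ℕ→ℂ k -ᶜ 1ᶜ))
  1+[k-1]-natural k = record { re≡ = λ _ → trans (eq (+ k / 1)) (ν-def k) ; im≡ = λ _ → refl }
    where
    eq : ∀ q → 1ℚ + (q - 1ℚ) ≡ q
    eq = solve-∀ ℚ-ring

  IsPow-recip : ∀ {k s m p} → IsNatural k s → IsPow (suc m) (-ᶜ s) p → p ≈ᶜ ℚ→ℂ (recip^ m k)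
  IsPow-recip {k} {s} {m} {p} nat (ℓ , exp-ℓ , exp-sℓ) =
    let e , im≈0 = IsExp⇒Expʳ { -ᶜ s *ᶜ ℝ→ℂ ℓ} {p} real exp-sℓ
    in expʳ-neg-* {ℓ} {m} {re p} k
         (subst (λ q → Expʳ ℓ (ℚ→ℝ q)) (ν-def (suc m)) (proj₁ (IsExp⇒Expʳ {ℝ→ℂ ℓ} {ℕ→ℂ (suc m)} (λ _ → refl) exp-ℓ)))
         (expʳ-resp {re (-ᶜ s *ᶜ ℝ→ℂ ℓ)} {ℚ→ℝ (- ν k) *ʳ ℓ} {re p}
           (λ i → trans (cong₂ (λ u v → (- u) * seq ℓ i - (- v) * 0ℚ) (re≡ nat i) (im≡ nat i)) (eq₁ (ν k) (seq ℓ i))) e)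
     , im≈0
    where
    eq₁ : ∀ k l → (- k) * l - (- 0ℚ) * 0ℚ ≡ (- k) * l
    eq₁ = solve-∀ ℚ-ring
    eq₂ : ∀ a l → a * 0ℚ + (- 0ℚ) * l ≡ 0ℚ
    eq₂ = solve-∀ ℚ-ring
    real : Real (-ᶜ s *ᶜ ℝ→ℂ ℓ)
    real i = trans (cong (λ v → seq (-ʳ re s) i * 0ℚ + (- v) * seq ℓ i) (im≡ nat i)) (eq₂ (seq (-ʳ re s) i) (seq ℓ i))

  sum-≈ : ∀ {p : ℕ → ℂ} {q : ℕ → ℚ} → (∀ m → p m ≈ᶜ ℚ→ℂ (q m)) → ∀ n → sum _+ᶜ_ 0ᶜ p n ≈ᶜ ℚ→ℂ (Σℚ q n)
  sum-≈         p≈q zero    = ≈ᶜ-refl {0ᶜ}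
  sum-≈ {p} {q} p≈q (suc n) = ≈ᶜ-trans {sum _+ᶜ_ 0ᶜ p (suc n)} {ℚ→ℂ (Σℚ q n) +ᶜ ℚ→ℂ (q n)} {ℚ→ℂ (Σℚ q (suc n))}
    (+ᶜ-cong {sum _+ᶜ_ 0ᶜ p n} {ℚ→ℂ (Σℚ q n)} {p n} {ℚ→ℂ (q n)} (sum-≈ p≈q n) (p≈q n))
    (≈ᶜ-pointwise {ℚ→ℂ (Σℚ q n) +ᶜ ℚ→ℂ (q n)} {ℚ→ℂ (Σℚ q (suc n))} (λ _ → refl) (λ _ → refl))

  Σ-recip^ : ∀ k n → Σℚ (λ m → recip^ m k) n ≡ ζ[ k ∷ [] ] n
  Σ-recip^ k n = Σ-cong n λ m _ → sym (ℚₚ.*-identityˡ (recip^ m k))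

  module _ (Z : RiemannZeta) where
    open RiemannZeta Z

    1<natural : ∀ {j s} → IsNatural (2 ℕ.+ j) s → 1ʳ <ʳ re s
    1<natural {j} {s} nat = 1ℚ , ℚₚ.positive⁻¹ 1ℚ , λ η 0<η → 0 , λ n _ → begin
      1ℚ + 1ℚ                 ≤⟨ ≤-by (ν j) (trans (ν-suc (suc j)) (trans (cong (λ t → 1ℚ + t) (ν-suc j)) (sym (ℚₚ.+-assoc 1ℚ 1ℚ (ν j))))) (0≤ν j) ⟩
      ν (2 ℕ.+ j)             ≡⟨ re≡ nat n ⟨
      seq (re s) n            ≤⟨ ≤-by η refl (ℚₚ.<⇒≤ 0<η) ⟩
      seq (re s) n + η        ∎
      where open ℚₚ.≤-Reasoning

    -- The logarithm of m+1 is taken from the Dirichlet series of ζ at s; the power found there is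
    -- then replaced by the equal rational.
    recip^-powers : ∀ {j s} → s # 1ᶜ → IsNatural (2 ℕ.+ j) s → IsPowers (-ᶜ s) (λ m → ℚ→ℂ (recip^ m (2 ℕ.+ j)))
    recip^-powers {j} {s} s#1 nat m =
      let p , powers , _ = dirichlet s s#1 (1<natural nat)
          ℓ , exp-ℓ , exp-sℓ = powers m
      in ℓ , exp-ℓ , HasSum-resp {λ j → ℚ→ℂ (1/ j !) *ᶜ (-ᶜ s *ᶜ ℝ→ℂ ℓ) ^ᶜ j} {p m} {ℚ→ℂ (recip^ m (2 ℕ.+ j))}
           (IsPow-recip {2 ℕ.+ j} {s} {m} {p m} nat (powers m)) exp-sℓ

    ζ-natural : ∀ {j} s (s#1 : s # 1ᶜ) → IsNatural (2 ℕ.+ j) s → ζ s s#1 ≈ᶜ ℝ→ℂ (ζ₁ j)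
    ζ-natural {j} s s#1 nat =
      let p , powers , re-sum , im-sum = dirichlet s s#1 (1<natural nat)
          S = sum _+ᶜ_ 0ᶜ p
          S≈ = λ n → sum-≈ {p} {λ m → recip^ m (2 ℕ.+ j)} (λ m → IsPow-recip {2 ℕ.+ j} {s} {m} {p m} nat (powers m)) n
      in lim-unique {λ n → re (S n)} {re (ζ s s#1)} {ζ₁ j}
           (⟶⇒Lim {λ n → re (S n)} {re (ζ s s#1)} re-sum)
           (lim-respˡ {λ n → ℚ→ℝ (ζ[ 2 ℕ.+ j ∷ [] ] n)} {λ n → re (S n)} {ζ₁ j}
             (λ n → ≈ʳ-sym {re (S n)} {ℚ→ℝ (ζ[ 2 ℕ.+ j ∷ [] ] n)}
               (subst (λ q → re (S n) ≈ʳ ℚ→ℝ q) (Σ-recip^ (2 ℕ.+ j) n) (proj₁ (S≈ n))))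
             (lim-ℚ (ζ₁ j)))
       , lim-unique {λ n → im (S n)} {im (ζ s s#1)} {0ʳ}
           (⟶⇒Lim {λ n → im (S n)} {im (ζ s s#1)} im-sum)
           (lim-respˡ {λ _ → 0ʳ} {λ n → im (S n)} {0ʳ}
             (λ n → ≈ʳ-sym {im (S n)} {0ʳ} (proj₂ (S≈ n)))
             (lim-const {0ʳ} {0ʳ} (≈ʳ-refl {0ʳ})))

  -- The regularized values

  -- For k = 2+j the first is -(ζ(k,1,k) + ζ(1,k,k) + ζ(k+1,k) + ζ(k,k+1)), and the second is
  -- -(ζ(1,2+l) + ζ(3+l)). Writing + 1 instead of `suc` makes the exponents agree by computation
  -- with those of the stuffle products.
  ζ*[2+j,2+j,1] ζ*[2+l,1] : ℕ → ℝ
  ζ*[2+j,2+j,1] j = ℚ→ℝ (- 1ℚ) *ʳ (ζ₃ (suc j) 0 j +ʳ ζ₃ 0 (suc j) j +ʳ ζ₂ (suc j ℕ.+ 1) j +ʳ ζ₂ (suc j) (j ℕ.+ 1))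
  ζ*[2+l,1] l = ℚ→ℝ (- 1ℚ) *ʳ (ζ₂ 0 l +ʳ ζ₁ (l ℕ.+ 1))

  regularizes-kk1 : ∀ j → let k = 2 ℕ.+ j in
    Regularizes (k ∷ k ∷ 1 ∷ []) (ζ*[2+j,2+j,1] j ∷ ζ₂ (suc j) j ∷ [])
  regularizes-kk1 j = regularizes-intro (k ∷ k ∷ 1 ∷ []) (ζ*[2+j,2+j,1] j) (ζ₂ (suc j) j) []
    (mul (rational _) (add (add (add (ζ₃∈𝒵 (suc j) 0 j) (ζ₃∈𝒵 0 (suc j) j)) (ζ₂∈𝒵 (suc j ℕ.+ 1) j)) (ζ₂∈𝒵 (suc j) (j ℕ.+ 1))))
    (ζ₂∈𝒵 (suc j) j) (ζ₂-slow (suc j) j)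
    λ N → trans (eq₁ (ζ[ k ∷ k ∷ 1 ∷ [] ] N) _)
      (trans (cong (_+ (- 1ℚ) * seq (ζ₃ (suc j) 0 j +ʳ ζ₃ 0 (suc j) j +ʳ ζ₂ (suc j ℕ.+ 1) j +ʳ ζ₂ (suc j) (j ℕ.+ 1)) N)
        (trans (sym (stuffle₂₁ k k 1 N)) (cong (λ t → ζ[ k ∷ k ∷ [] ] N * t) (ζ[1]≡harmonic N))))
        (eq₂ (ζ[ k ∷ k ∷ [] ] N) (harmonic N) _))
    where
    k : ℕ
    k = 2 ℕ.+ j
    eq₁ : ∀ x r → x ≡ x + r + (- 1ℚ) * r
    eq₁ = solve-∀ ℚ-ring
    eq₂ : ∀ z h c → z * h + c ≡ c + h * (z + h * 0ℚ)
    eq₂ = solve-∀ ℚ-ring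

  regularizes-l1 : ∀ l → Regularizes (2 ℕ.+ l ∷ 1 ∷ []) (ζ*[2+l,1] l ∷ ζ₁ l ∷ [])
  regularizes-l1 l = regularizes-intro (2 ℕ.+ l ∷ 1 ∷ []) (ζ*[2+l,1] l) (ζ₁ l) []
    (mul (rational _) (add (ζ₂∈𝒵 0 l) (ζ₁∈𝒵 (l ℕ.+ 1)))) (ζ₁∈𝒵 l) (ζ₁-slow l)
    λ N → trans (eq₁ (ζ[ 2 ℕ.+ l ∷ 1 ∷ [] ] N) (ζ[ 1 ∷ 2 ℕ.+ l ∷ [] ] N) (ζ[ 2 ℕ.+ l ℕ.+ 1 ∷ [] ] N))
      (trans (cong (_+ seq (ζ*[2+l,1] l) N)
        (trans (sym (stuffle₁₁ (2 ℕ.+ l) 1 N)) (cong (λ t → ζ[ 2 ℕ.+ l ∷ [] ] N * t) (ζ[1]≡harmonic N))))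
        (eq₂ (ζ[ 2 ℕ.+ l ∷ [] ] N) (harmonic N) _))
    where
    eq₁ : ∀ x a b → x ≡ x + a + b + (- 1ℚ) * (a + b)
    eq₁ = solve-∀ ℚ-ring
    eq₂ : ∀ z h c → z * h + c ≡ c + h * (z + h * 0ℚ)
    eq₂ = solve-∀ ℚ-ring

  ⅓ ⅙ : ℚ
  ⅓ = + 1 / 3
  ⅙ = + 1 / 6

  ζ*[1,1,1] : ℝ
  ζ*[1,1,1] = ℚ→ℝ ⅓ *ʳ ζ₁ 1

  -- Newton's identity over 6 reads ζ_N(3)/3 - ζ_N(2)H_N/2 + H_N³/6, so the polynomial has a zero
  -- quadratic coefficient.
  regularizes-111 : Regularizes (1 ∷ 1 ∷ 1 ∷ []) (ζ*[1,1,1] ∷ ℚ→ℝ (- ½) *ʳ ζ₁ 0 ∷ map ℚ→ℝ (0ℚ ∷ ⅙ ∷ []))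
  regularizes-111 = regularizes-intro (1 ∷ 1 ∷ 1 ∷ []) ζ*[1,1,1] (ℚ→ℝ (- ½) *ʳ ζ₁ 0) (0ℚ ∷ ⅙ ∷ [])
    (mul (rational _) (ζ₁∈𝒵 1)) (mul (rational _) (ζ₁∈𝒵 0)) slow
    λ N → trans (eq₁ (ζ[ 1 ∷ 1 ∷ 1 ∷ [] ] N)) (trans (cong (⅙ *_) (newton₃ N))
      (eq₂ (harmonic N) (ζ[ 2 ∷ [] ] N) (ζ[ 3 ∷ [] ] N)))
    where
    eq₁ : ∀ z → z ≡ ⅙ * (z * (1ℚ + 1ℚ + 1ℚ + 1ℚ + 1ℚ + 1ℚ))
    eq₁ = solve-∀ ℚ-ring
    eq₂ : ∀ h p₂ p₃ → ⅙ * (h * (h * h) - (1ℚ + 1ℚ + 1ℚ) * (p₂ * h) + (1ℚ + 1ℚ) * p₃) ≡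
      ⅓ * p₃ + h * ((- ½) * p₂ + h * (0ℚ + h * (⅙ + h * 0ℚ)))
    eq₂ = solve-∀ ℚ-ring
    eq₃ : ∀ h a b → h * ((- ½) * a - (- ½) * b) ≡ (- ½) * (h * (a - b))
    eq₃ = solve-∀ ℚ-ring
    slow : Slow (ℚ→ℝ (- ½) *ʳ ζ₁ 0)
    slow N i N≤i = begin
      ∣ harmonic N * ((- ½) * seq (ζ₁ 0) N - (- ½) * seq (ζ₁ 0) i) ∣  ≡⟨ cong ∣_∣ (eq₃ (harmonic N) (seq (ζ₁ 0) N) (seq (ζ₁ 0) i)) ⟩
      ∣ (- ½) * (harmonic N * (seq (ζ₁ 0) N - seq (ζ₁ 0) i)) ∣        ≤⟨ ∣∣≤-* { - ½} {harmonic N * (seq (ζ₁ 0) N - seq (ζ₁ 0) i)}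
        (≤-by ½ refl (ℚₚ.<⇒≤ 0<½)) (ζ₁-slow 0 N i N≤i) ⟩
      1ℚ * tailBound N                                                ≡⟨ ℚₚ.*-identityˡ (tailBound N) ⟩
      tailBound N                                                     ∎
      where open ℚₚ.≤-Reasoning

  -- The constant C₊

  Σ-square : ∀ k N → Σℚ (λ n → ζ[ k ∷ [] ] n * ζ[ k ∷ [] ] n * 1/suc n) N ≡
    ζ[ k ∷ k ∷ 1 ∷ [] ] N + ζ[ k ∷ k ∷ 1 ∷ [] ] N + ζ[ k ℕ.+ k ∷ 1 ∷ [] ] N
  Σ-square k zero    = refl
  Σ-square k (suc N) = trans
    (cong₂ (λ u v → u + v * 1/suc N) (Σ-square k N) (stuffle₁₁ k k N))
    (eq (ζ[ k ∷ k ∷ 1 ∷ [] ] N) (ζ[ k ℕ.+ k ∷ 1 ∷ [] ] N) (ζ[ k ∷ k ∷ [] ] N) (ζ[ k ℕ.+ k ∷ [] ] N) (1/suc N))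
    where
    eq : ∀ x y a b r → x + x + y + (a + a + b) * r ≡ x + a * (r * 1ℚ) + (x + a * (r * 1ℚ)) + (y + b * (r * 1ℚ))
    eq = solve-∀ ℚ-ring

  -- `w` stands for the real ∣ζ(1+a)∣² inside the series of C₊. Only its value is known, not its
  -- representing sequence, so it stays in the partial sums until it is exchanged for ζ(k)².
  module _ (j : ℕ) (w : ℝ) (w≈ζ² : w ≈ʳ ζ₁ j *ʳ ζ₁ j) where
    private
      k : ℕ
      k = 2 ℕ.+ j
      x y : ℝ
      x = ζ*[2+j,2+j,1] j
      -- The shifted index is j + k because 2 + (j + k) computes to k + k.
      y = ζ*[2+l,1] (j ℕ.+ k)
      H : ℕ → ℂ
      H = sum _+ᶜ_ 0ᶜ (λ m → ℚ→ℂ (recip^ m k))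
      summand : ℕ → ℂ
      summand n = ℝ→ℂ (∣ H n ∣² -ʳ w) *ᶜ ℚ→ℂ (1/suc n)
      S : ℕ → ℂ
      S = sum _+ᶜ_ 0ᶜ summand
      A : ℕ → ℚ
      A = Σℚ (λ n → ζ[ k ∷ [] ] n * ζ[ k ∷ [] ] n * 1/suc n)

      H-seq : ∀ n i → seq (re (H n)) i ≡ Σℚ (λ m → recip^ m k) n × seq (im (H n)) i ≡ 0ℚ
      H-seq zero    i = refl , refl
      H-seq (suc n) i with H-seq n i
      ... | p , q = cong (_+ recip^ n k) p , cong (_+ 0ℚ) q

      S-seq : ∀ N i → seq (re (S N)) i ≡ A N - seq w i * harmonic N × seq (im (S N)) i ≡ 0ℚ
      S-seq zero    i = sym (eq (seq w i)) , refl
        where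
        eq : ∀ w → 0ℚ - w * 0ℚ ≡ 0ℚ
        eq = solve-∀ ℚ-ring
      S-seq (suc N) i with S-seq N i | H-seq N i
      ... | p , q | p′ , q′ =
          trans (cong₂ _+_ p (cong₂ (λ u v → (u * u + v * v + - seq w i) * 1/suc N - 0ℚ * 0ℚ)
            (trans p′ (Σ-recip^ k N)) q′)) (eq₁ (A N) (seq w i) (harmonic N) (ζ[ k ∷ [] ] N) (1/suc N))
        , trans (cong (λ t → t + ((a² - seq w i) * 0ℚ + 0ℚ * 1/suc N)) q) (eq₂ (a² - seq w i) (1/suc N))
        where
        a² : ℚ
        a² = seq (∣ H N ∣²) i
        eq₁ : ∀ A w h a r → A - w * h + ((a * a + 0ℚ * 0ℚ + - w) * r - 0ℚ * 0ℚ) ≡ A + a * a * r - w * (h + r)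
        eq₁ = solve-∀ ℚ-ring
        eq₂ : ∀ a r → 0ℚ + (a * 0ℚ + 0ℚ * r) ≡ 0ℚ
        eq₂ = solve-∀ ℚ-ring

      P Q : Poly
      P = x ∷ ζ₂ (suc j) j ∷ []
      Q = y ∷ ζ₁ (j ℕ.+ k) ∷ []
      errorP errorQ combination : ℕ → ℝ
      errorP N = ℚ→ℝ (ζ[ k ∷ k ∷ 1 ∷ [] ] N) -ʳ eval P (ℚ→ℝ (harmonic N))
      errorQ N = ℚ→ℝ (ζ[ k ℕ.+ k ∷ 1 ∷ [] ] N) -ʳ eval Q (ℚ→ℝ (harmonic N))
      combination N = errorP N +ʳ errorP N +ʳ errorQ N +ʳ (x +ʳ x +ʳ y)

      combination-lim : Lim combination (0ʳ +ʳ 0ʳ +ʳ 0ʳ +ʳ (x +ʳ x +ʳ y))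
      combination-lim = lim-+ {λ N → errorP N +ʳ errorP N +ʳ errorQ N} {λ _ → x +ʳ x +ʳ y} {0ʳ +ʳ 0ʳ +ʳ 0ʳ} {x +ʳ x +ʳ y}
        (lim-+ {λ N → errorP N +ʳ errorP N} {errorQ} {0ʳ +ʳ 0ʳ} {0ʳ}
          (lim-+ {errorP} {errorP} {0ʳ} {0ʳ} nullP nullP)
          (⟶⇒Lim {errorQ} {0ʳ} (Regularizes.asymptotic (regularizes-l1 (j ℕ.+ k)))))
        (lim-const {x +ʳ x +ʳ y} {x +ʳ x +ʳ y} (≈ʳ-refl {x +ʳ x +ʳ y}))
        where
        nullP : Lim errorP 0ʳ
        nullP = ⟶⇒Lim {errorP} {0ʳ} (Regularizes.asymptotic (regularizes-kk1 j))

      -- The divergent part of 2ζ_N(k,k,1) + ζ_N(2k,1) is (2ζ(k,k) + ζ(2k)) H_N = ζ(k)² H_N.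
      combination≈S : ∀ N → combination N ≈ʳ re (S N)
      combination≈S N = ≈ʳ-trans {combination N} {ℚ→ℝ (A N) -ʳ ζ₁ j *ʳ ζ₁ j *ʳ h} {re (S N)}
        (≈ʳ-pointwise {combination N} {ℚ→ℝ (A N) -ʳ ζ₁ j *ʳ ζ₁ j *ʳ h} λ i → trans
          (eq (ζ[ k ∷ k ∷ 1 ∷ [] ] N) (ζ[ k ℕ.+ k ∷ 1 ∷ [] ] N) (seq x i) (seq y i)
            (ζ[ k ∷ k ∷ [] ] i) (ζ[ k ℕ.+ k ∷ [] ] i) (harmonic N))
          -- The sums are truncated at N but the coefficients at i: the stuffle product is used at
          -- level i for the factor of H_N.
          (cong₂ (λ u v → u - v * harmonic N) (sym (Σ-square k N)) (sym (stuffle₁₁ k k i))))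
        (≈ʳ-trans {ℚ→ℝ (A N) -ʳ ζ₁ j *ʳ ζ₁ j *ʳ h} {ℚ→ℝ (A N) -ʳ w *ʳ h} {re (S N)}
          (+ʳ-cong {ℚ→ℝ (A N)} {ℚ→ℝ (A N)} { -ʳ (ζ₁ j *ʳ ζ₁ j *ʳ h)} { -ʳ (w *ʳ h)} (≈ʳ-refl {ℚ→ℝ (A N)})
            (-ʳ-cong {ζ₁ j *ʳ ζ₁ j *ʳ h} {w *ʳ h} (*ʳ-cong {ζ₁ j *ʳ ζ₁ j} {w} {h} {h}
              (≈ʳ-sym {w} {ζ₁ j *ʳ ζ₁ j} w≈ζ²) (≈ʳ-refl {h}))))
          (≈ʳ-pointwise {ℚ→ℝ (A N) -ʳ w *ʳ h} {re (S N)} λ i → sym (proj₁ (S-seq N i))))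
        where
        h : ℝ
        h = ℚ→ℝ (harmonic N)
        eq : ∀ s t x y a b h →
          s - (x + h * (a + h * 0ℚ)) + (s - (x + h * (a + h * 0ℚ))) + (t - (y + h * (b + h * 0ℚ))) + (x + x + y) ≡
          s + s + t - (a + a + b) * h
        eq = solve-∀ ℚ-ring

    C₊-sum : HasSum (λ n → ℝ→ℂ (∣ sum _+ᶜ_ 0ᶜ (λ m → ℚ→ℂ (recip^ m (2 ℕ.+ j))) n ∣² -ʳ w) *ᶜ ℚ→ℂ (1/suc n))
      (ℕ→ℂ 2 *ᶜ ℝ→ℂ (ζ*[2+j,2+j,1] j) +ᶜ ℝ→ℂ (ζ*[2+l,1] (j ℕ.+ (2 ℕ.+ j))))
    C₊-sum =
        Lim⇒⟶ {λ N → re (S N)} {re t} (lim-respˡ {combination} {λ N → re (S N)} {re t} combination≈S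
          (lim-respʳ {combination} {0ʳ +ʳ 0ʳ +ʳ 0ʳ +ʳ (x +ʳ x +ʳ y)} {re t}
            (≈ʳ-pointwise {0ʳ +ʳ 0ʳ +ʳ 0ʳ +ʳ (x +ʳ x +ʳ y)} {re t} λ i → trans (eq₁ (seq x i) (seq y i))
              (cong (λ c → c * seq x i - 0ℚ * 0ℚ + seq y i) 2≡)) combination-lim))
      , Lim⇒⟶ {λ N → im (S N)} {im t} (lim-respˡ {λ _ → 0ʳ} {λ N → im (S N)} {im t}
          (λ N → ≈ʳ-pointwise {0ʳ} {im (S N)} λ i → sym (proj₂ (S-seq N i)))
          (lim-const {0ʳ} {im t} (≈ʳ-pointwise {0ʳ} {im t} λ i → eq₂ (seq (re (ℕ→ℂ 2)) i) (seq x i))))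
      where
      t : ℂ
      t = ℕ→ℂ 2 *ᶜ ℝ→ℂ x +ᶜ ℝ→ℂ y
      2≡ : 1ℚ + 1ℚ ≡ + 2 / 1
      2≡ = refl
      eq₁ : ∀ x y → 0ℚ + 0ℚ + 0ℚ + (x + x + y) ≡ (1ℚ + 1ℚ) * x - 0ℚ * 0ℚ + y
      eq₁ = solve-∀ ℚ-ring
      eq₂ : ∀ c x → 0ℚ ≡ c * 0ℚ + 0ℚ * x + 0ℚ
      eq₂ = solve-∀ ℚ-ring

  -- Assembly of the formulas for C₊ and C₀

  +ᶜ-assoc : ∀ u v w → u +ᶜ (v +ᶜ w) ≈ᶜ u +ᶜ v +ᶜ w
  +ᶜ-assoc u v w = ≈ᶜ-pointwise {u +ᶜ (v +ᶜ w)} {u +ᶜ v +ᶜ w}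
    (λ i → sym (ℚₚ.+-assoc (seq (re u) i) (seq (re v) i) (seq (re w) i)))
    (λ i → sym (ℚₚ.+-assoc (seq (im u) i) (seq (im v) i) (seq (im w) i)))

  -- Inserts the relation into the last term of C₀, where the multiple of ζ(3) is subtracted, while
  -- the relation carries a negated coefficient.
  -ᶜ-absorb : ∀ {u v} b q z → u +ᶜ v ≈ᶜ -ᶜ q *ᶜ z → b -ᶜ q *ᶜ z ≈ᶜ b +ᶜ u +ᶜ v
  -ᶜ-absorb {u} {v} b q z uv≈ = ≈ᶜ-trans {b -ᶜ q *ᶜ z} {b +ᶜ (-ᶜ q *ᶜ z)} {b +ᶜ u +ᶜ v}
    (≈ᶜ-pointwise {b -ᶜ q *ᶜ z} {b +ᶜ (-ᶜ q *ᶜ z)}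
      (λ i → eq₁ (seq (re b) i) (seq (re q) i) (seq (im q) i) (seq (re z) i) (seq (im z) i))
      (λ i → eq₂ (seq (im b) i) (seq (re q) i) (seq (im q) i) (seq (re z) i) (seq (im z) i)))
    (≈ᶜ-trans {b +ᶜ (-ᶜ q *ᶜ z)} {b +ᶜ (u +ᶜ v)} {b +ᶜ u +ᶜ v}
      (+ᶜ-cong {b} {b} { -ᶜ q *ᶜ z} {u +ᶜ v} (≈ᶜ-refl {b}) (≈ᶜ-sym {u +ᶜ v} { -ᶜ q *ᶜ z} uv≈))
      (+ᶜ-assoc b u v))
    where
    eq₁ : ∀ b p q x y → b + - (p * x + - (q * y)) ≡ b + ((- p) * x + - ((- q) * y))
    eq₁ = solve-∀ ℚ-ring
    eq₂ : ∀ b p q x y → b + - (p * y + q * x) ≡ b + ((- p) * y + (- q) * x)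
    eq₂ = solve-∀ ℚ-ring

  ζ*-2k : ∀ j → ζ*⟨ 2 ℕ.* (2 ℕ.+ j) ∷ 1 ∷ [] ⟩≡ ζ*[2+l,1] (j ℕ.+ (2 ℕ.+ j))
  -- 2 * k computes to k + (k + 0), whereas the stuffle exponent is k + k.
  ζ*-2k j = subst (λ m → ζ*⟨ 2 ℕ.+ j ℕ.+ m ∷ 1 ∷ [] ⟩≡ ζ*[2+l,1] (j ℕ.+ (2 ℕ.+ j)))
    (sym (ℕₚ.+-identityʳ (2 ℕ.+ j))) (ζ*-intro (regularizes-l1 (j ℕ.+ (2 ℕ.+ j))))

  -- Euler's relation turns -(ζ(1,2) + ζ(3)) into -2ζ(3), and 2/3 - 2 = -4/3.
  2ζ*[1,1,1]+ζ*[2,1] : ∀ {z} → z ≈ᶜ ℝ→ℂ (ζ₁ 1) →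
    ℕ→ℂ 2 *ᶜ ℝ→ℂ ζ*[1,1,1] +ᶜ ℝ→ℂ (ζ*[2+l,1] 0) ≈ᶜ -ᶜ ℚ→ℂ (+ 4 / 3) *ᶜ z
  2ζ*[1,1,1]+ζ*[2,1] {z} z≈ζ3 = ≈ᶜ-trans {lhs (ζ₂ 0 0)} {lhs (ζ₁ 1)} {rhs z}
    (+ᶜ-cong {u} {u} {ℝ→ℂ (ℚ→ℝ (- 1ℚ) *ʳ (ζ₂ 0 0 +ʳ ζ₁ 1))} {ℝ→ℂ (ℚ→ℝ (- 1ℚ) *ʳ (ζ₁ 1 +ʳ ζ₁ 1))} (≈ᶜ-refl {u})
      ( *ʳ-cong {ℚ→ℝ (- 1ℚ)} {ℚ→ℝ (- 1ℚ)} {ζ₂ 0 0 +ʳ ζ₁ 1} {ζ₁ 1 +ʳ ζ₁ 1} (≈ʳ-refl {ℚ→ℝ (- 1ℚ)})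
          (+ʳ-cong {ζ₂ 0 0} {ζ₁ 1} {ζ₁ 1} {ζ₁ 1} euler (≈ʳ-refl {ζ₁ 1}))
      , ≈ʳ-refl {0ʳ}))
    (≈ᶜ-trans {lhs (ζ₁ 1)} {rhs (ℝ→ℂ (ζ₁ 1))} {rhs z}
      (≈ᶜ-pointwise {lhs (ζ₁ 1)} {rhs (ℝ→ℂ (ζ₁ 1))} (λ i → eq₁ (seq (ζ₁ 1) i)) (λ i → eq₂ (seq (ζ₁ 1) i)))
      (*ᶜ-cong { -ᶜ ℚ→ℂ (+ 4 / 3)} { -ᶜ ℚ→ℂ (+ 4 / 3)} {ℝ→ℂ (ζ₁ 1)} {z} (≈ᶜ-refl { -ᶜ ℚ→ℂ (+ 4 / 3)})
        (≈ᶜ-sym {z} {ℝ→ℂ (ζ₁ 1)} z≈ζ3)))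
    where
    u : ℂ
    u = ℕ→ℂ 2 *ᶜ ℝ→ℂ ζ*[1,1,1]
    lhs : ℝ → ℂ
    lhs e = u +ᶜ ℝ→ℂ (ℚ→ℝ (- 1ℚ) *ʳ (e +ʳ ζ₁ 1))
    rhs : ℂ → ℂ
    rhs z = -ᶜ ℚ→ℂ (+ 4 / 3) *ᶜ z
    2ℚ 4/3 : ℚ
    2ℚ = + 2 / 1
    4/3 = + 4 / 3
    eq₁ : ∀ z → 2ℚ * (⅓ * z) - 0ℚ * 0ℚ + (- 1ℚ) * (z + z) ≡ (- 4/3) * z - 0ℚ * 0ℚ
    eq₁ = solve-∀ ℚ-ring
    eq₂ : ∀ z → 2ℚ * 0ℚ + 0ℚ * (⅓ * z) + 0ℚ ≡ (- 4/3) * 0ℚ + 0ℚ * z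
    eq₂ = solve-∀ ℚ-ring

  module _ (Z : RiemannZeta) (S : StieltjesConstants Z) where
    open RiemannZeta Z
    open StieltjesConstants S

    C₊-value : ∀ k (2≤k : 2 ℕ.≤ k) → ∃[ c ] ∃[ x ] ∃[ y ]
      C₊ Z S (ℕ→ℂ k -ᶜ 1ᶜ) (k-1>0 k 2≤k) c × ζ*⟨ k ∷ k ∷ 1 ∷ [] ⟩≡ x × ζ*⟨ 2 ℕ.* k ∷ 1 ∷ [] ⟩≡ y ×
      c ≈ᶜ ζ-at Z k 2≤k ^ᶜ 2 *ᶜ (ℕ→ℂ 2 *ᶜ γ 0 -ᶜ 1ᶜ) +ᶜ ℕ→ℂ 2 *ᶜ ℝ→ℂ x +ᶜ ℝ→ℂ y
    C₊-value k@(suc (suc j)) 2≤k@(s≤s (s≤s z≤n)) =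
      -- `c` is the defining expression of C₊ itself. What remains is to replace ∣ζ(1 + (k-1))∣² by
      -- ζ(k)²; both equal the square of `ζ₁` j.
      c , x , y ,
      ((λ m → ℚ→ℂ (recip^ m k)) , t , recip^-powers Z {j} s#1 nat , C₊-sum j w w≈ζ² , ≈ᶜ-refl {c}) ,
      ζ*-intro (regularizes-kk1 j) , ζ*-2k j ,
      ≈ᶜ-trans {c} {ζ-at Z k 2≤k ^ᶜ 2 *ᶜ g +ᶜ t} {ζ-at Z k 2≤k ^ᶜ 2 *ᶜ g +ᶜ ℕ→ℂ 2 *ᶜ ℝ→ℂ x +ᶜ ℝ→ℂ y}
        (+ᶜ-cong {ℝ→ℂ w *ᶜ g} {ζ-at Z k 2≤k ^ᶜ 2 *ᶜ g} {t} {t}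
          (*ᶜ-cong {ℝ→ℂ w} {ζ-at Z k 2≤k ^ᶜ 2} {g} {g}
            (≈ᶜ-trans {ℝ→ℂ w} {ℝ→ℂ (ζ₁ j *ʳ ζ₁ j)} {ζ-at Z k 2≤k ^ᶜ 2} (w≈ζ² , ≈ʳ-refl {0ʳ})
              (≈ᶜ-sym {ζ-at Z k 2≤k ^ᶜ 2} {ℝ→ℂ (ζ₁ j *ʳ ζ₁ j)}
                (^2-real {ζ-at Z k 2≤k} {ζ₁ j} (ζ-natural Z {j} (ℕ→ℂ k) (k#1 k 2≤k) (ℕ→ℂ-natural k)))))
            (≈ᶜ-refl {g}))
          (≈ᶜ-refl {t}))
        (+ᶜ-assoc (ζ-at Z k 2≤k ^ᶜ 2 *ᶜ g) (ℕ→ℂ 2 *ᶜ ℝ→ℂ x) (ℝ→ℂ y))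
      where
      s t g c : ℂ
      x y w : ℝ
      s = 1ᶜ +ᶜ (ℕ→ℂ k -ᶜ 1ᶜ)
      s#1 : s # 1ᶜ
      s#1 = 1+a#1 (ℕ→ℂ k -ᶜ 1ᶜ) (k-1>0 k 2≤k)
      nat : IsNatural k s
      nat = 1+[k-1]-natural k
      x = ζ*[2+j,2+j,1] j
      y = ζ*[2+l,1] (j ℕ.+ k)
      w = ∣ ζ s s#1 ∣²
      g = ℕ→ℂ 2 *ᶜ γ 0 -ᶜ 1ᶜ
      t = ℕ→ℂ 2 *ᶜ ℝ→ℂ x +ᶜ ℝ→ℂ y
      c = ℝ→ℂ w *ᶜ g +ᶜ t
      w≈ζ² : w ≈ʳ ζ₁ j *ʳ ζ₁ j
      w≈ζ² = ∣∣²-real {ζ s s#1} {ζ₁ j} (ζ-natural Z {j} s s#1 nat)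

    C₀-value : ∃[ x ] ∃[ y ] ζ*⟨ 1 ∷ 1 ∷ 1 ∷ [] ⟩≡ x × ζ*⟨ 2 ∷ 1 ∷ [] ⟩≡ y ×
      ℕ→ℂ 2 *ᶜ ℝ→ℂ x +ᶜ ℝ→ℂ y ≈ᶜ -ᶜ ℚ→ℂ (+ 4 / 3) *ᶜ ζ3 Z ×
      C₀ Z S ≈ᶜ -ᶜ ℕ→ℂ 2 +ᶜ ℕ→ℂ 4 *ᶜ γ 0 -ᶜ ℕ→ℂ 3 *ᶜ γ 0 ^ᶜ 2 +ᶜ ℚ→ℂ (+ 4 / 3) *ᶜ γ 0 ^ᶜ 3
        +ᶜ ℕ→ℂ 2 *ᶜ (1ᶜ -ᶜ γ 0) *ᶜ γ 1 +ᶜ γ 2 +ᶜ ℕ→ℂ 2 *ᶜ ℝ→ℂ x +ᶜ ℝ→ℂ y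
    C₀-value = ζ*[1,1,1] , ζ*[2+l,1] 0 , ζ*-intro regularizes-111 , ζ*-intro (regularizes-l1 0) , relation ,
      -ᶜ-absorb {ℕ→ℂ 2 *ᶜ ℝ→ℂ ζ*[1,1,1]} {ℝ→ℂ (ζ*[2+l,1] 0)}
        (-ᶜ ℕ→ℂ 2 +ᶜ ℕ→ℂ 4 *ᶜ γ 0 -ᶜ ℕ→ℂ 3 *ᶜ γ 0 ^ᶜ 2 +ᶜ ℚ→ℂ (+ 4 / 3) *ᶜ γ 0 ^ᶜ 3
          +ᶜ ℕ→ℂ 2 *ᶜ (1ᶜ -ᶜ γ 0) *ᶜ γ 1 +ᶜ γ 2)
        (ℚ→ℂ (+ 4 / 3)) (ζ3 Z) relation
      where
      relation : ℕ→ℂ 2 *ᶜ ℝ→ℂ ζ*[1,1,1] +ᶜ ℝ→ℂ (ζ*[2+l,1] 0) ≈ᶜ -ᶜ ℚ→ℂ (+ 4 / 3) *ᶜ ζ3 Z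
      relation = 2ζ*[1,1,1]+ζ*[2,1] {ζ3 Z} (ζ-natural Z {1} (ℕ→ℂ 3) (k#1 3 (s≤s (s≤s z≤n))) (ℕ→ℂ-natural 3))

open import Defs

theorem1p4 : (Z : RiemannZeta) (S : StieltjesConstants Z) →
    let γ = StieltjesConstants.γ S in
    (∀ k → (2≤k : 2 ℕ.≤ k) →
    ∃[ c ] ∃[ x ] ∃[ y ]
    C₊ Z S (ℕ→ℂ k - 1ᶜ) (k-1>0 k 2≤k) c ×
    ζ*⟨ k ∷ k ∷ 1 ∷ [] ⟩≡ x ×
    ζ*⟨ 2 ℕ.* k ∷ 1 ∷ [] ⟩≡ y ×
    c ≈ ζ-at Z k 2≤k ^ 2 * (ℕ→ℂ 2 * γ 0 - 1ᶜ) + ℕ→ℂ 2 * ℝ→ℂ x + ℝ→ℂ y) ×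
    (∃[ x ] ∃[ y ]
    ζ*⟨ 1 ∷ 1 ∷ 1 ∷ [] ⟩≡ x ×
    ζ*⟨ 2 ∷ 1 ∷ [] ⟩≡ y ×
    ℕ→ℂ 2 * ℝ→ℂ x + ℝ→ℂ y ≈ - ℚ→ℂ (+ 4 / 3) * ζ3 Z ×
    C₀ Z S ≈ - ℕ→ℂ 2 + ℕ→ℂ 4 * γ 0 - ℕ→ℂ 3 * γ 0 ^ 2 + ℚ→ℂ (+ 4 / 3) * γ 0 ^ 3
    + ℕ→ℂ 2 * (1ᶜ - γ 0) * γ 1 + γ 2 + ℕ→ℂ 2 * ℝ→ℂ x + ℝ→ℂ y)
theorem1p4 Z S = Regularization.C₊-value Z S , Regularization.C₀-value Z S
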